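{- There exists a deterministic algorithm which, on input $T(G,\lambda)$, where $G = (V,E)$ is a graph of maximum degree $\Delta(G) \in o(\sqrt{|E|})$ and $\lambda : V \to \{0,1\}$ is any odd charge labeling, produces a tree-like resolution refutation of $T(G,\lambda)$ in time $$|E|^{O(1)}\, 2^{\left(1 - 2\left(1 - \frac{1}{\sqrt 2}\right)^2\right)|E| + o(|E|)} \le 2^{0.83|E|},$$ where the last inequality holds for $|E|$ sufficiently large.
   Context: Graphs are finite and simple. For a graph $G = (V,E)$ and $\lambda : V \to \{0,1\}$, the Tseitin formula $T(G,\lambda)$ has a Boolean variable $x_e$ for every edge $e \in E$ and states that for every $v \in V$, $\bigoplus_{e \ni v} x_e = \lambda(v)$ (sum modulo 2). The labeling $\lambda$ is called an odd charge labeling if $\bigoplus_{v \in V}\lambda(v) = 1$; in that case $T(G,\lambda)$ is unsatisfiable. As a formula to be refuted, $T(G,\lambda)$ denotes its CNF representation: each vertex constraint is written as the conjunction of all clauses on the variables $x_e$, $e \ni v$, that are falsified exactly by one of the assignments violating the constraint. A tree-like resolution refutation is a resolution refutation whose underlying derivation graph is a tree; equivalently it can be given by a decision tree for the CNF, i.e. a rooted binary tree whose inner nodes are labeled by variables, whose edges are labeled by $0/1$ (the value of the variable queried at the node they come out of), and whose leaves are labeled by clauses falsified by the partial assignment along the path from the root to the leaf. Asymptotic notation is as $|E|\to\infty$; the $o(|E|)$ term depends only on the function of $|E|$ bounding $\Delta(G)$. -}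

module Defs where

open import Data.Bool.Base using (Bool; true; false; not; _xor_)
open import Data.Bool.Properties using () renaming (_≟_ to _≟ᵇ_)
open import Data.Fin.Base as Fin using (Fin; toℕ)
open import Data.Fin.Properties using () renaming (_≟_ to _≟ᶠ_)
open import Data.Integer.Base using (+_)
open import Data.List.Base using (List; []; _∷_; _++_; map; concatMap; filter; foldr; length; allFin)
open import Data.List.Membership.Propositional using (_∈_)
open import Data.List.Relation.Binary.BagAndSetEquality using (_∼[_]_; set)
open import Data.Nat.Base using (ℕ; zero; suc; _+_; _*_; _^_; _⊔_; _≤_; NonZero)
open import Data.Product.Base using (Σ-syntax; ∃-syntax; _×_; _,_; proj₁; proj₂)
open import Data.Product.Properties using (≡-dec)
open import Data.Rational.Base as ℚ using (ℚ; 0ℚ; 1ℚ)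
open import Data.Sum.Base using (_⊎_)
open import Data.Vec.Base using (Vec; []; _∷_; lookup)
open import Function.Definitions using (Injective)
open import Relation.Binary.Definitions using (DecidableEquality)
open import Relation.Binary.PropositionalEquality using (_≡_; refl)
open import Relation.Nullary.Decidable using (Dec; ¬?; _⊎-dec_)

-- A finite simple graph on Fin n whose m edges are enumerated without
-- repetition; an edge {u , v} is stored as (u , v) with u < v.
record Graph : Set where
  field
    n m       : ℕ
    ends      : Fin m → Fin n × Fin n
    ordered   : ∀ e → proj₁ (ends e) Fin.< proj₂ (ends e)
    injective : Injective _≡_ _≡_ ends

  Vertex Edge : Set
  Vertex = Fin n
  Edge   = Fin m

  _∋_ : Edge → Vertex → Set
  e ∋ v = proj₁ (ends e) ≡ v ⊎ proj₂ (ends e) ≡ v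

  _∋?_ : ∀ e v → Dec (e ∋ v)
  e ∋? v = (proj₁ (ends e) ≟ᶠ v) ⊎-dec (proj₂ (ends e) ≟ᶠ v)

  incident : Vertex → List Edge
  incident v = filter (_∋? v) (allFin m)

  degree : Vertex → ℕ
  degree v = length (incident v)

  maxDegree : ℕ
  maxDegree = foldr _⊔_ 0 (map degree (allFin n))

-- (x , true) is the literal x and (x , false) is its negation.
Literal : ℕ → Set
Literal m = Fin m × Bool

Clause : ℕ → Set
Clause m = List (Literal m)

CNF : ℕ → Set
CNF m = List (Clause m)

_≟ˡ_ : ∀ {m} → DecidableEquality (Literal m)
_≟ˡ_ = ≡-dec _≟ᶠ_ _≟ᵇ_

parity : List Bool → Bool
parity = foldr _xor_ false

Charge : Graph → Set
Charge G = Graph.Vertex G → Bool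

OddCharge : (G : Graph) → Charge G → Set
OddCharge G χ = parity (map χ (allFin (Graph.n G))) ≡ true

assignments : ∀ {m} → List (Fin m) → List (List (Fin m × Bool))
assignments []       = [] ∷ []
assignments (x ∷ xs) = map ((x , false) ∷_) (assignments xs)
                    ++ map ((x , true) ∷_) (assignments xs)

-- The clause on the variables of a that is falsified exactly by a.
falsifiedBy : ∀ {m} → List (Fin m × Bool) → Clause m
falsifiedBy = map (λ (x , b) → x , not b)

module _ (G : Graph) (χ : Charge G) where
  open Graph G

  violating : Vertex → List (List (Edge × Bool))
  violating v =
    filter (λ a → ¬? (parity (map proj₂ a) ≟ᵇ χ v)) (assignments (incident v))

  tseitin : CNF m
  tseitin = concatMap (λ v → map falsifiedBy (violating v)) (allFin n)

-- Every node carries its clause; inner nodes also carry the variable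
-- resolved upon.
data ProofTree (m : ℕ) : Set where
  leaf : Clause m → ProofTree m
  node : Clause m → Fin m → ProofTree m → ProofTree m → ProofTree m

remove : ∀ {m} → Literal m → Clause m → Clause m
remove l = filter (λ l′ → ¬? (l′ ≟ˡ l))

resolvent : ∀ {m} → Fin m → Clause m → Clause m → Clause m
resolvent x D E = remove (x , true) D ++ remove (x , false) E

-- A resolvent is determined up to equality of sets of literals.
data Derives {m : ℕ} (F : CNF m) : ProofTree m → Clause m → Set where
  axiom   : ∀ {C} → C ∈ F → Derives F (leaf C) C
  resolve : ∀ {C D E x π ρ} →
            Derives F π D → Derives F ρ E →
            (x , true) ∈ D → (x , false) ∈ E →
            C ∼[ set ] resolvent x D E →
            Derives F (node C x π ρ) C

Refutes : ∀ {m} → CNF m → ProofTree m → Set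
Refutes F π = Derives F π []

-- Model of computation: first-order recursive programs over binary trees
-- ("pure LISP"), evaluated call-by-value. Every evaluation rule is executed
-- in constant time by a pointer machine or RAM with a stack (the program,
-- and so the size of each environment, is fixed), and counts as one step.

data 𝔻 : Set where
  nil : 𝔻
  _∙_ : 𝔻 → 𝔻 → 𝔻

infixr 5 _∙_

size : 𝔻 → ℕ
size nil     = 1
size (a ∙ b) = suc (size a + size b)

-- Expressions with n variables in scope over function symbols Fin f with
-- arities ar. In caseᵉ the last branch binds the two components of the pair,
-- as variables 0 and 1.
data Exp {f : ℕ} (ar : Fin f → ℕ) (n : ℕ) : Set where
  varᵉ  : Fin n → Exp ar n
  nilᵉ  : Exp ar n
  consᵉ : Exp ar n → Exp ar n → Exp ar n
  caseᵉ : Exp ar n → Exp ar n → Exp ar (suc (suc n)) → Exp ar n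
  letᵉ  : Exp ar n → Exp ar (suc n) → Exp ar n
  callᵉ : (g : Fin f) → Vec (Exp ar n) (ar g) → Exp ar n

record Program : Set where
  field
    f    : ℕ
    ar   : Fin f → ℕ
    body : (g : Fin f) → Exp ar (ar g)
    main : Exp ar 1

module Semantics {f : ℕ} {ar : Fin f → ℕ} (body : (g : Fin f) → Exp ar (ar g)) where

  -- ρ ⊢ e ⇓ v [ t ]: in environment ρ, e evaluates to v in t steps.
  data _⊢_⇓_[_] {n} (ρ : Vec 𝔻 n) : Exp ar n → 𝔻 → ℕ → Set
  data _⊢_⇓*_[_] {n} (ρ : Vec 𝔻 n) : ∀ {k} → Vec (Exp ar n) k → Vec 𝔻 k → ℕ → Set

  data _⊢_⇓_[_] {n} ρ where
    ⇓var   : ∀ {x} → ρ ⊢ varᵉ x ⇓ lookup ρ x [ 1 ]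
    ⇓nil   : ρ ⊢ nilᵉ ⇓ nil [ 1 ]
    ⇓cons  : ∀ {e₁ e₂ a b s t} →
             ρ ⊢ e₁ ⇓ a [ s ] → ρ ⊢ e₂ ⇓ b [ t ] →
             ρ ⊢ consᵉ e₁ e₂ ⇓ a ∙ b [ suc (s + t) ]
    ⇓case₀ : ∀ {e e₀ e₁ v s t} →
             ρ ⊢ e ⇓ nil [ s ] → ρ ⊢ e₀ ⇓ v [ t ] →
             ρ ⊢ caseᵉ e e₀ e₁ ⇓ v [ suc (s + t) ]
    ⇓case₁ : ∀ {e e₀ e₁ a b v s t} →
             ρ ⊢ e ⇓ a ∙ b [ s ] → (a ∷ b ∷ ρ) ⊢ e₁ ⇓ v [ t ] →
             ρ ⊢ caseᵉ e e₀ e₁ ⇓ v [ suc (s + t) ]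
    ⇓let   : ∀ {e₁ e₂ u v s t} →
             ρ ⊢ e₁ ⇓ u [ s ] → (u ∷ ρ) ⊢ e₂ ⇓ v [ t ] →
             ρ ⊢ letᵉ e₁ e₂ ⇓ v [ suc (s + t) ]
    ⇓call  : ∀ {g es vs v s t} →
             ρ ⊢ es ⇓* vs [ s ] → vs ⊢ body g ⇓ v [ t ] →
             ρ ⊢ callᵉ g es ⇓ v [ suc (s + t) ]

  data _⊢_⇓*_[_] {n} ρ where
    ⇓[] : ρ ⊢ [] ⇓* [] [ 0 ]
    ⇓∷  : ∀ {k e v s t} {es : Vec (Exp ar n) k} {vs : Vec 𝔻 k} →
          ρ ⊢ e ⇓ v [ s ] → ρ ⊢ es ⇓* vs [ t ] →
          ρ ⊢ e ∷ es ⇓* v ∷ vs [ s + t ]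

  deterministic : ∀ {n} {ρ : Vec 𝔻 n} {e v w s t} →
                  ρ ⊢ e ⇓ v [ s ] → ρ ⊢ e ⇓ w [ t ] → v ≡ w × s ≡ t
  deterministic* : ∀ {n k} {ρ : Vec 𝔻 n} {es : Vec (Exp ar n) k} {vs ws s t} →
                   ρ ⊢ es ⇓* vs [ s ] → ρ ⊢ es ⇓* ws [ t ] → vs ≡ ws × s ≡ t

  deterministic ⇓var ⇓var = refl , refl
  deterministic ⇓nil ⇓nil = refl , refl
  deterministic (⇓cons p q) (⇓cons p′ q′) with deterministic p p′ | deterministic q q′
  ... | refl , refl | refl , refl = refl , refl
  deterministic (⇓case₀ p q) (⇓case₀ p′ q′) with deterministic p p′ | deterministic q q′
  ... | refl , refl | refl , refl = refl , refl
  deterministic (⇓case₀ p q) (⇓case₁ p′ q′) with deterministic p p′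
  ... | () , _
  deterministic (⇓case₁ p q) (⇓case₀ p′ q′) with deterministic p p′
  ... | () , _
  deterministic (⇓case₁ p q) (⇓case₁ p′ q′) with deterministic p p′
  ... | refl , refl with deterministic q q′
  ...   | refl , refl = refl , refl
  deterministic (⇓let p q) (⇓let p′ q′) with deterministic p p′
  ... | refl , refl with deterministic q q′
  ...   | refl , refl = refl , refl
  deterministic (⇓call p q) (⇓call p′ q′) with deterministic* p p′
  ... | refl , refl with deterministic q q′
  ...   | refl , refl = refl , refl

  deterministic* ⇓[] ⇓[] = refl , refl
  deterministic* (⇓∷ p q) (⇓∷ p′ q′) with deterministic p p′ | deterministic* q q′
  ... | refl , refl | refl , refl = refl , refl

-- Values may share subtrees in memory, so the output is charged for
-- separately, as if it were written out symbol by symbol: producing a tree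
-- never takes less time than its size.
Produces_from_within_ : 𝔻 → Program × 𝔻 → ℕ → Set
Produces out from (P , inp) within t =
  ∃[ s ] (inp ∷ []) ⊢ main ⇓ out [ s ] × s + size out ≤ t
  where
  open Program P
  open Semantics body

-- Variables are the indices 0, …, m - 1 in unary.
encodeℕ : ℕ → 𝔻
encodeℕ zero    = nil
encodeℕ (suc n) = nil ∙ encodeℕ n

encodeBool : Bool → 𝔻
encodeBool false = nil
encodeBool true  = nil ∙ nil

encodeList : ∀ {A : Set} → (A → 𝔻) → List A → 𝔻
encodeList enc []       = nil
encodeList enc (x ∷ xs) = enc x ∙ encodeList enc xs

encodeLiteral : ∀ {m} → Literal m → 𝔻
encodeLiteral (x , b) = encodeℕ (toℕ x) ∙ encodeBool b

encodeClause : ∀ {m} → Clause m → 𝔻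
encodeClause = encodeList encodeLiteral

encodeCNF : ∀ {m} → CNF m → 𝔻
encodeCNF = encodeList encodeClause

encodeTree : ∀ {m} → ProofTree m → 𝔻
encodeTree (leaf C)       = nil ∙ encodeClause C
encodeTree (node C x π ρ) =
  (nil ∙ nil) ∙ encodeClause C ∙ encodeℕ (toℕ x) ∙ encodeTree π ∙ encodeTree ρ

-- c · d(m) ≤ √m eventually, for every constant c.
o[√m] : (ℕ → ℕ) → Set
o[√m] d = ∀ c → ∃[ N ] ∀ m → N ≤ m → (c * d m) * (c * d m) ≤ m

o[m] : (ℕ → ℕ) → Set
o[m] r = ∀ c → ∃[ N ] ∀ m → N ≤ m → c * r m ≤ m

2ℚ : ℚ
2ℚ = 1ℚ ℚ.+ 1ℚ

-- The real number α = 1 - 2 (1 - 1/√2)² is given by its Dedekind cut, using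
-- that α = h (1/√2) and that h is increasing for x ≤ 1.
h : ℚ → ℚ
h x = 1ℚ ℚ.- 2ℚ ℚ.* ((1ℚ ℚ.- x) ℚ.* (1ℚ ℚ.- x))

-- The rationals above α are those that are ≥ h x for some rational x with
-- 1/√2 < x ≤ 1.
α<_ : ℚ → Set
α< q = Σ[ x ∈ ℚ ] 0ℚ ℚ.≤ x × 1ℚ ℚ.< 2ℚ ℚ.* (x ℚ.* x) × x ℚ.≤ 1ℚ × h x ℚ.≤ q

-- The rationals below α are those that are ≤ h x for some rational x with
-- 0 ≤ x < 1/√2.
_<α : ℚ → Set
q <α = Σ[ x ∈ ℚ ] 0ℚ ℚ.≤ x × 2ℚ ℚ.* (x ℚ.* x) ℚ.< 1ℚ × q ℚ.≤ h x

-- t ≤ p · 2^(α m + r): the inequality with α replaced by any rational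
-- a / b > α, raised to the power b.
_≤_·2^[α_+_] : (t p m r : ℕ) → Set
t ≤ p ·2^[α m + r ] =
  ∀ (a b : ℕ) .{{_ : NonZero b}} → α< (+ a ℚ./ b) →
  t ^ b ≤ p ^ b * 2 ^ (a * m + b * r)

-- p · 2^(α m + r) ≤ 2^(c m / d): the inequality with α replaced by any
-- rational a / b < α, raised to the power b d.
_·2^[α_+_]≤2^[_/_·_] : (p m r c d m′ : ℕ) → Set
p ·2^[α m + r ]≤2^[ c / d · m′ ] =
  ∀ (a b : ℕ) .{{_ : NonZero b}} → (+ a ℚ./ b) <α →
  (p ^ b * 2 ^ (a * m + b * r)) ^ d ≤ 2 ^ (c * m′ * b)

-- If the edges between two sides of a vertex partition are queried first, one of
-- the sides carries an odd charge, and querying the edges inside that side then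
-- falsifies a clause. The height of this decision tree is the size of the cut plus
-- the number of edges inside a side. The partition is found greedily: for
-- A = (number of edges inside the sides) - (number of edges across) and
-- B = (degree sum of P) - (degree sum of Q), a new vertex is put on the side for
-- which m A - B² increases, up to the square of its degree. So m A ≥ B² - 2 m Δ at
-- the end, which bounds the height by (13 m + 8 Δ) / 16. As 13/16 < 82/100 < α,
-- the remaining factors, which are polynomial in m and 2^Δ, are absorbed.
-- Instead of computing which of the sides is odd, the algorithm tries both.
module Submission where

open import Defs
open import Algebra.Bundles using (CommutativeMonoid; CommutativeRing)
import Algebra.Properties.CommutativeMonoid.Sum as MonoidSum
open import Data.Bool.Base using (Bool; true; false; not; _xor_; if_then_else_)
open import Data.Bool.Properties using (xor-∧-commutativeRing; xor-same) renaming (_≟_ to _≟ᵇ_)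
open import Data.Empty using (⊥; ⊥-elim)
open import Data.Fin.Base using (Fin; zero; suc; toℕ)
open import Data.Fin.Patterns
open import Data.Fin.Properties using (toℕ-injective; toℕ<n; ¬∀⟶∃¬) renaming (_≟_ to _≟ᶠ_; <⇒≢ to <ᶠ⇒≢)
open import Data.Integer.Base as ℤ using ()
import Data.Integer.Properties as ℤ
open import Data.List.Base using (List; []; _∷_; _++_; map; concat; concatMap; filter; foldr; length; allFin; tabulate)
open import Data.List.Membership.Propositional using (_∈_)
open import Data.List.Membership.Propositional.Properties
  using (∈-++⁺ˡ; ∈-++⁺ʳ; ∈-++⁻; ∈-map⁺; ∈-map⁻; ∈-filter⁺; ∈-filter⁻; ∈-concat⁺′; ∈-allFin)
import Data.List.Membership.DecPropositional as DecMembership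
open import Data.List.Properties
  using (length-++; length-map; length-filter; length-tabulate; filter-accept; filter-reject; filter-++;
         map-++; map-cong; map-id; map-∘; concatMap-cong)
open import Data.List.Relation.Binary.Subset.Propositional using (_⊆_)
open import Data.List.Relation.Unary.All using (All; []; _∷_; all?)
  renaming (map to All-map; lookup to All-lookup; tabulate to All-tabulate)
open import Data.List.Relation.Unary.All.Properties using ()
  renaming (++⁺ to All-++⁺; ++⁻ʳ to All-++⁻ʳ; map⁺ to All-map⁺)
open import Data.List.Relation.Unary.Any using (here; there)
open import Data.Maybe.Base using (Maybe; just; nothing; _<∣>_)
import Data.Maybe.Relation.Unary.All as Maybe
open import Data.Nat.Base hiding (parity)
open import Data.Nat.DivMod using (m/n*n≤m; m≡m%n+[m/n]*n; m%n<n; m*n/n≡m; /-monoˡ-≤)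
open import Data.Nat.ListAction using (sum)
open import Data.Nat.ListAction.Properties using (sum-++)
open import Data.Nat.Properties
open import Data.Nat.Tactic.RingSolver using (solve-∀)
open import Data.Product.Base using (Σ-syntax; ∃-syntax; _×_; _,_; proj₁; proj₂)
open import Data.Rational.Base as ℚ using (ℚ; 0ℚ; 1ℚ; nonNegative)
import Data.Rational.Properties as ℚ
open import Data.Rational.Unnormalised.Base using (mkℚᵘ)
import Data.Rational.Unnormalised.Properties as ℚᵘ
open import Data.Sum.Base using (_⊎_; inj₁; inj₂; [_,_]′)
open import Data.Vec.Base using (Vec; []; _∷_; lookup)
open import Function.Base using (_∘_; id)
open import Function.Bundles using (mk⇔)
open import Function.Related.Propositional using (K-refl)
open import Relation.Binary.Definitions using (DecidableEquality)
open import Relation.Binary.PropositionalEquality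
  using (_≡_; _≢_; refl; sym; trans; cong; cong₂; subst; subst₂; module ≡-Reasoning)
open import Relation.Nullary.Decidable
  using (Dec; does; yes; no; map′; _×-dec_; ¬?; True; toWitness; from-yes; does-⇔; dec-true; dec-false)
open import Relation.Nullary.Negation using (¬_)

-- The program

-- Where 13/16 comes from: with a cut of size c, and g more edges inside one side than inside the
-- other, the height is (m + c + g) / 2. As A = m - 2 c and B² = 4 g², the greedy bound reads c ≤
-- m/2 - 2 g²/m + Δ, and g - 2 g²/m is at most m/8. The greedy choice is the method of conditional
-- expectations: on a random side, a vertex leaves A unchanged on average and adds the square of its
-- degree to the average of B²; these squares sum to at most 2 m Δ.
--
-- The program sees the CNF and not the graph, so it must read the incidence lists off the clauses.
-- Isolated vertices are the obstacle. With charge 0 they leave no trace, and with charge 1 each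
-- contributes an empty clause, so that the length of the formula is not bounded in terms of m and
-- Δ. An empty clause is therefore looked for before anything else; if there is none, the formula
-- has at most 2 m 2^Δ clauses.

pattern eqF     = 0F
pattern memF    = 1F
pattern appF    = 2F
pattern remF    = 3F
pattern interF  = 4F
pattern mulF    = 5F
pattern leqF    = 6F
pattern varsF   = 7F
pattern allposF = 8F
pattern itemsF  = 9F
pattern concatF = suc 9F
pattern emptyF  = suc (suc 9F)
pattern subsetF = suc (suc (suc 9F))
pattern findF   = suc (suc (suc (suc 9F)))
pattern clauseF = suc (suc (suc (suc (suc 9F))))
pattern resolveF = suc (suc (suc (suc (suc (suc 9F)))))
pattern buildF  = suc (suc (suc (suc (suc (suc (suc 9F))))))
pattern greedyF = suc (suc (suc (suc (suc (suc (suc (suc 9F)))))))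

pattern 10F = suc 9F
pattern 11F = suc 10F
pattern 12F = suc 11F
pattern 13F = suc 12F
pattern 14F = suc 13F

arity : Fin 18 → ℕ
arity = lookup (2 ∷ 2 ∷ 2 ∷ 2 ∷ 2 ∷ 2 ∷ 2 ∷ 1 ∷ 1 ∷ 1 ∷ 1 ∷ 1 ∷ 2 ∷ 2 ∷ 1 ∷ 3 ∷ 4 ∷ 7 ∷ [])

Expr : ℕ → Set
Expr = Exp arity

trueᵉ : ∀ {n} → Expr n
trueᵉ = consᵉ nilᵉ nilᵉ

-- nil stands for false and for failure, and mulF and leqF take lists as numbers,
-- given by their lengths. The arguments of buildF are the variables to query, then
-- nil or the pair of lists of which one is to be searched after them, the formula,
-- and the literals falsified so far; those of greedyF are the incidence lists left,
-- their initial concatenation, whose length is 2 m, and the components of a Cut.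
code : (g : Fin 18) → Expr (arity g)
code eqF =
  caseᵉ (varᵉ 0F)
    (caseᵉ (varᵉ 1F) trueᵉ nilᵉ)
    (caseᵉ (varᵉ 3F) nilᵉ
      (caseᵉ (callᵉ eqF (varᵉ 2F ∷ varᵉ 0F ∷ [])) nilᵉ
        (callᵉ eqF (varᵉ 5F ∷ varᵉ 3F ∷ []))))
code memF =
  caseᵉ (varᵉ 1F) nilᵉ
    (caseᵉ (callᵉ eqF (varᵉ 2F ∷ varᵉ 0F ∷ []))
      (callᵉ memF (varᵉ 2F ∷ varᵉ 1F ∷ []))
      trueᵉ)
code appF =
  caseᵉ (varᵉ 0F) (varᵉ 1F)
    (consᵉ (varᵉ 0F) (callᵉ appF (varᵉ 1F ∷ varᵉ 3F ∷ [])))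
code remF =
  caseᵉ (varᵉ 1F) nilᵉ
    (caseᵉ (callᵉ eqF (varᵉ 0F ∷ varᵉ 2F ∷ []))
      (consᵉ (varᵉ 0F) (callᵉ remF (varᵉ 2F ∷ varᵉ 1F ∷ [])))
      (callᵉ remF (varᵉ 4F ∷ varᵉ 3F ∷ [])))
code interF =
  caseᵉ (varᵉ 0F) nilᵉ
    (caseᵉ (callᵉ memF (varᵉ 0F ∷ varᵉ 3F ∷ []))
      (callᵉ interF (varᵉ 1F ∷ varᵉ 3F ∷ []))
      (consᵉ (varᵉ 2F) (callᵉ interF (varᵉ 3F ∷ varᵉ 5F ∷ []))))
code mulF =
  caseᵉ (varᵉ 0F) nilᵉ
    (callᵉ appF (varᵉ 3F ∷ callᵉ mulF (varᵉ 1F ∷ varᵉ 3F ∷ []) ∷ []))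
code leqF =
  caseᵉ (varᵉ 0F) trueᵉ
    (caseᵉ (varᵉ 3F) nilᵉ (callᵉ leqF (varᵉ 3F ∷ varᵉ 1F ∷ [])))
code varsF =
  caseᵉ (varᵉ 0F) nilᵉ
    (caseᵉ (varᵉ 0F) nilᵉ
      (consᵉ (varᵉ 0F) (callᵉ varsF (varᵉ 3F ∷ []))))
code allposF =
  caseᵉ (varᵉ 0F) trueᵉ
    (caseᵉ (varᵉ 0F) nilᵉ
      (caseᵉ (varᵉ 1F) nilᵉ (callᵉ allposF (varᵉ 5F ∷ []))))
code itemsF =
  caseᵉ (varᵉ 0F) nilᵉ
    (caseᵉ (varᵉ 0F) (callᵉ itemsF (varᵉ 1F ∷ []))
      (caseᵉ (callᵉ allposF (varᵉ 1F ∷ []))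
        (callᵉ itemsF (varᵉ 3F ∷ []))
        (consᵉ (callᵉ varsF (varᵉ 4F ∷ [])) (callᵉ itemsF (varᵉ 5F ∷ [])))))
code concatF =
  caseᵉ (varᵉ 0F) nilᵉ
    (callᵉ appF (varᵉ 0F ∷ callᵉ concatF (varᵉ 1F ∷ []) ∷ []))
code emptyF =
  caseᵉ (varᵉ 0F) nilᵉ
    (caseᵉ (varᵉ 0F) trueᵉ (callᵉ emptyF (varᵉ 3F ∷ [])))
code subsetF =
  caseᵉ (varᵉ 0F) trueᵉ
    (caseᵉ (callᵉ memF (varᵉ 0F ∷ varᵉ 3F ∷ [])) nilᵉ
      (callᵉ subsetF (varᵉ 3F ∷ varᵉ 5F ∷ [])))
code findF =
  caseᵉ (varᵉ 0F) nilᵉ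
    (caseᵉ (callᵉ subsetF (varᵉ 0F ∷ varᵉ 3F ∷ []))
      (callᵉ findF (varᵉ 1F ∷ varᵉ 3F ∷ []))
      (consᵉ nilᵉ (varᵉ 2F)))
code clauseF =
  caseᵉ (varᵉ 0F) nilᵉ
    (caseᵉ (varᵉ 0F) (varᵉ 1F)
      (caseᵉ (varᵉ 3F) nilᵉ (varᵉ 0F)))
code resolveF =
  caseᵉ (varᵉ 1F) nilᵉ
    (caseᵉ (varᵉ 4F) nilᵉ
      (letᵉ (callᵉ clauseF (varᵉ 5F ∷ []))
        (letᵉ (callᵉ clauseF (varᵉ 7F ∷ []))
          (caseᵉ (callᵉ memF (consᵉ (varᵉ 6F) trueᵉ ∷ varᵉ 1F ∷ [])) (varᵉ 7F)
            (caseᵉ (callᵉ memF (consᵉ (varᵉ 8F) nilᵉ ∷ varᵉ 2F ∷ [])) (varᵉ 10F)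
              (consᵉ trueᵉ
                (consᵉ (callᵉ appF (callᵉ remF (consᵉ (varᵉ 10F) trueᵉ ∷ varᵉ 5F ∷ []) ∷
                                    callᵉ remF (consᵉ (varᵉ 10F) nilᵉ ∷ varᵉ 4F ∷ []) ∷ []))
                  (consᵉ (varᵉ 10F) (consᵉ (varᵉ 11F) (varᵉ 12F))))))))))
code buildF =
  caseᵉ (varᵉ 0F)
    (caseᵉ (varᵉ 1F)
      (callᵉ findF (varᵉ 2F ∷ varᵉ 3F ∷ []))
      (caseᵉ (callᵉ buildF (varᵉ 0F ∷ nilᵉ ∷ varᵉ 4F ∷ varᵉ 5F ∷ []))
        (callᵉ buildF (varᵉ 1F ∷ nilᵉ ∷ varᵉ 4F ∷ varᵉ 5F ∷ []))
        -- A tree found on the first side is a pair that `caseᵉ` has taken apart, so it is put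
        -- together again.
        (consᵉ (varᵉ 0F) (varᵉ 1F))))
    (caseᵉ (callᵉ memF (consᵉ (varᵉ 0F) trueᵉ ∷ varᵉ 5F ∷ []))
      (caseᵉ (callᵉ memF (consᵉ (varᵉ 0F) nilᵉ ∷ varᵉ 5F ∷ []))
        (callᵉ resolveF
          (varᵉ 0F ∷
           callᵉ buildF (varᵉ 1F ∷ varᵉ 3F ∷ varᵉ 4F ∷ consᵉ (consᵉ (varᵉ 0F) trueᵉ) (varᵉ 5F) ∷ []) ∷
           callᵉ buildF (varᵉ 1F ∷ varᵉ 3F ∷ varᵉ 4F ∷ consᵉ (consᵉ (varᵉ 0F) nilᵉ) (varᵉ 5F) ∷ []) ∷ []))
        (callᵉ buildF (varᵉ 3F ∷ varᵉ 5F ∷ varᵉ 6F ∷ varᵉ 7F ∷ [])))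
      (callᵉ buildF (varᵉ 3F ∷ varᵉ 5F ∷ varᵉ 6F ∷ varᵉ 7F ∷ [])))
code greedyF =
  caseᵉ (varᵉ 0F)
    -- The value is `Ec ∙ (Es ∙ Et)`, whose two components are just the first two arguments of
    -- `buildF` in `main`.
    (consᵉ (varᵉ 6F) (consᵉ (varᵉ 4F) (varᵉ 5F)))
    (letᵉ (callᵉ interF (varᵉ 0F ∷ varᵉ 4F ∷ []))
      (letᵉ (callᵉ interF (varᵉ 1F ∷ varᵉ 6F ∷ []))
        (letᵉ (callᵉ appF (varᵉ 2F ∷ varᵉ 2F ∷ []))
          (letᵉ (callᵉ appF (varᵉ 0F ∷ varᵉ 0F ∷ []))
            (caseᵉ (callᵉ leqF
                     (callᵉ appF (callᵉ mulF (varᵉ 2F ∷ varᵉ 7F ∷ []) ∷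
                                  callᵉ mulF (varᵉ 0F ∷ varᵉ 8F ∷ []) ∷ []) ∷
                      callᵉ appF (callᵉ mulF (varᵉ 3F ∷ varᵉ 7F ∷ []) ∷
                                  callᵉ mulF (varᵉ 0F ∷ varᵉ 9F ∷ []) ∷ []) ∷ []))
              (callᵉ greedyF
                (varᵉ 5F ∷ varᵉ 7F ∷ varᵉ 8F ∷ callᵉ appF (varᵉ 4F ∷ varᵉ 9F ∷ []) ∷
                 varᵉ 10F ∷ callᵉ appF (varᵉ 2F ∷ varᵉ 11F ∷ []) ∷
                 callᵉ appF (varᵉ 3F ∷ varᵉ 12F ∷ []) ∷ []))
              (callᵉ greedyF
                (varᵉ 7F ∷ varᵉ 9F ∷ callᵉ appF (varᵉ 6F ∷ varᵉ 10F ∷ []) ∷ varᵉ 11F ∷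
                 callᵉ appF (varᵉ 5F ∷ varᵉ 12F ∷ []) ∷ varᵉ 13F ∷
                 callᵉ appF (varᵉ 4F ∷ varᵉ 14F ∷ []) ∷ [])))))))

program : Program
program = record
  { f    = 18
  ; ar   = arity
  ; body = code
  ; main =
      caseᵉ (callᵉ emptyF (varᵉ 0F ∷ []))
        (letᵉ (callᵉ itemsF (varᵉ 0F ∷ []))
          (letᵉ (callᵉ concatF (varᵉ 0F ∷ []))
            (caseᵉ (callᵉ greedyF (varᵉ 1F ∷ varᵉ 0F ∷ nilᵉ ∷ nilᵉ ∷ nilᵉ ∷ nilᵉ ∷ nilᵉ ∷ []))
              nilᵉ
              (callᵉ buildF (varᵉ 0F ∷ varᵉ 1F ∷ varᵉ 4F ∷ nilᵉ ∷ [])))))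
        -- This is `encodeTree (leaf [])`.
        (consᵉ nilᵉ nilᵉ)
  }

open Semantics code

-- Evaluation with time bounds

record Call (g : Fin 18) (vs : Vec 𝔻 (arity g)) (v : 𝔻) (T : ℕ) : Set where
  constructor call
  field
    {time}  : ℕ
    eval    : vs ⊢ code g ⇓ v [ time ]
    bounded : time ≤ T

-- The time is bounded by a numeral k, counting the steps of the expression
-- itself, plus the bounds as for the calls that it makes.
record Run {n} (ρ : Vec 𝔻 n) (e : Expr n) (v : 𝔻) (k : ℕ) (as : List ℕ) : Set where
  constructor run
  field
    {time}  : ℕ
    eval    : ρ ⊢ e ⇓ v [ time ]
    bounded : time ≤ k + sum as

record Run* {n l} (ρ : Vec 𝔻 n) (es : Vec (Expr n) l) (vs : Vec 𝔻 l) (k : ℕ) (as : List ℕ) : Set where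
  constructor run
  field
    {time}  : ℕ
    eval    : ρ ⊢ es ⇓* vs [ time ]
    bounded : time ≤ k + sum as

merge : ∀ {s t k l} as bs → s ≤ k + sum as → t ≤ l + sum bs → s + t ≤ (k + l) + sum (as ++ bs)
merge {s} {t} {k} {l} as bs p q = begin
  s + t                       ≤⟨ +-mono-≤ p q ⟩
  (k + sum as) + (l + sum bs) ≡⟨ swap k (sum as) l (sum bs) ⟩
  (k + l) + (sum as + sum bs) ≡⟨ cong (k + l +_) (sum-++ as bs) ⟨
  (k + l) + sum (as ++ bs)    ∎
  where
  open ≤-Reasoning
  swap : ∀ a b c d → (a + b) + (c + d) ≡ (a + c) + (b + d)
  swap = solve-∀

module _ {n} {ρ : Vec 𝔻 n} where

  varʳ : ∀ {x} → Run ρ (varᵉ x) (lookup ρ x) 1 []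
  varʳ = run ⇓var ≤-refl

  nilʳ : Run ρ nilᵉ nil 1 []
  nilʳ = run ⇓nil ≤-refl

  consʳ : ∀ {e₁ e₂ a b k l as bs} → Run ρ e₁ a k as → Run ρ e₂ b l bs →
          Run ρ (consᵉ e₁ e₂) (a ∙ b) (suc (k + l)) (as ++ bs)
  consʳ {as = as} {bs} (run d p) (run e q) = run (⇓cons d e) (s≤s (merge as bs p q))

  case₀ʳ : ∀ {e e₀ e₁ v k l as bs} → Run ρ e nil k as → Run ρ e₀ v l bs →
           Run ρ (caseᵉ e e₀ e₁) v (suc (k + l)) (as ++ bs)
  case₀ʳ {as = as} {bs} (run d p) (run e q) = run (⇓case₀ d e) (s≤s (merge as bs p q))

  case₁ʳ : ∀ {e e₀ e₁ a b v k l as bs} → Run ρ e (a ∙ b) k as → Run (a ∷ b ∷ ρ) e₁ v l bs →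
           Run ρ (caseᵉ e e₀ e₁) v (suc (k + l)) (as ++ bs)
  case₁ʳ {as = as} {bs} (run d p) (run e q) = run (⇓case₁ d e) (s≤s (merge as bs p q))

  letʳ : ∀ {e₁ e₂ u v k l as bs} → Run ρ e₁ u k as → Run (u ∷ ρ) e₂ v l bs →
         Run ρ (letᵉ e₁ e₂) v (suc (k + l)) (as ++ bs)
  letʳ {as = as} {bs} (run d p) (run e q) = run (⇓let d e) (s≤s (merge as bs p q))

  callʳ : ∀ {g es vs v k as T} → Run* ρ es vs k as → Call g vs v T →
          Run ρ (callᵉ g es) v (suc (k + 0)) (as ++ T ∷ [])
  callʳ {as = as} {T} (run d p) (call e q) =
    run (⇓call d e) (s≤s (merge as (T ∷ []) p (≤-trans q (≤-reflexive (sym (+-identityʳ T))))))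

  []ʳ : Run* ρ [] [] 0 []
  []ʳ = run ⇓[] z≤n

  infixr 5 _∷ʳ_
  _∷ʳ_ : ∀ {l e v k j as bs} {es : Vec (Expr n) l} {vs} → Run ρ e v k as → Run* ρ es vs j bs →
         Run* ρ (e ∷ es) (v ∷ vs) (k + j) (as ++ bs)
  _∷ʳ_ {as = as} {bs} (run d p) (run e q) = run (⇓∷ d e) (merge as bs p q)

trueʳ : ∀ {n} {ρ : Vec 𝔻 n} → Run ρ trueᵉ (nil ∙ nil) 3 []
trueʳ = consʳ nilʳ nilʳ

-- The numeral `k` is inferred from the rules applied and compared with `K` by evaluation. Hence a
-- round `K` will do, and no steps are ever counted by hand.
within : ∀ {g vs v k as T} K {k≤K : True (k ≤? K)} → K + sum as ≤ T →
         Run vs (code g) v k as → Call g vs v T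
within {as = as} K {k≤K} p (run d q) =
  call d (≤-trans q (≤-trans (+-monoˡ-≤ (sum as) (toWitness k≤K)) p))

weaken : ∀ {g vs v S T} → S ≤ T → Call g vs v S → Call g vs v T
weaken p (call d q) = call d (≤-trans q p)

-- Costs of recursions along a list of length n, with at most a steps at each
-- element.
opaque
  linear : ℕ → ℕ → ℕ
  linear n a = suc n * a

  base≤ : ∀ K n {a} → K ≤ a → K + 0 ≤ linear n a
  base≤ K n {a} K≤a = ≤-trans (≤-reflexive (+-identityʳ K)) (≤-trans K≤a (m≤m+n a (n * a)))

  last≤ : ∀ K n {a b} → K + b ≤ a → K + (b + 0) ≤ linear n a
  last≤ K n {a} {b} p = ≤-trans (≤-reflexive (cong (K +_) (+-identityʳ b))) (≤-trans p (m≤m+n a (n * a)))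

  step₀≤ : ∀ K n {a} → K ≤ a → K + (linear n a + 0) ≤ linear (suc n) a
  step₀≤ K n {a} p = +-mono-≤ p (≤-reflexive (+-identityʳ _))

  step₁≤ : ∀ K n {a b} → K + b ≤ a → K + (b + (linear n a + 0)) ≤ linear (suc n) a
  step₁≤ K n {a} {b} p =
    ≤-trans (≤-reflexive (trans (sym (+-assoc K b _)) (cong (K + b +_) (+-identityʳ _)))) (+-monoˡ-≤ (linear n a) p)

  linear-mono : ∀ {m n a b} → m ≤ n → a ≤ b → linear m a ≤ linear n b
  linear-mono m≤n a≤b = *-mono-≤ (s≤s m≤n) a≤b

_≟𝔻_ : DecidableEquality 𝔻
nil     ≟𝔻 nil     = yes refl
nil     ≟𝔻 (_ ∙ _) = no λ ()
(_ ∙ _) ≟𝔻 nil     = no λ ()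
(a ∙ b) ≟𝔻 (c ∙ d) =
  map′ (λ (p , q) → cong₂ _∙_ p q) (λ { refl → refl , refl }) ((a ≟𝔻 c) ×-dec (b ≟𝔻 d))

-- Each node of `a` is visited at most once, together with the node of `b` at the same position;
-- hence only the size of the first argument enters.
eq𝔻-call : ∀ a b → Call eqF (a ∷ b ∷ []) (encodeBool (does (a ≟𝔻 b))) (size a * 20)
eq𝔻-call nil nil = within 20 ≤-refl (case₀ʳ varʳ (case₀ʳ varʳ trueʳ))
eq𝔻-call nil (_ ∙ _) = within 20 ≤-refl (case₀ʳ varʳ (case₁ʳ varʳ nilʳ))
eq𝔻-call (_ ∙ _) nil = within 20 (m≤m+n 20 _) (case₁ʳ varʳ (case₀ʳ varʳ nilʳ))
eq𝔻-call (a ∙ b) (c ∙ d) with does (a ≟𝔻 c) | eq𝔻-call a c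
... | false | left = within 20 (+-monoʳ-≤ 20 le)
  (case₁ʳ varʳ (case₁ʳ varʳ (case₀ʳ (callʳ (varʳ ∷ʳ varʳ ∷ʳ []ʳ) left) nilʳ)))
  where
  le : size a * 20 + 0 ≤ (size a + size b) * 20
  le = ≤-trans (≤-reflexive (+-identityʳ _)) (*-monoˡ-≤ 20 (m≤m+n (size a) (size b)))
... | true | left = within 20 (+-monoʳ-≤ 20 (≤-reflexive le))
  (case₁ʳ varʳ (case₁ʳ varʳ (case₁ʳ (callʳ (varʳ ∷ʳ varʳ ∷ʳ []ʳ) left)
    (callʳ (varʳ ∷ʳ varʳ ∷ʳ []ʳ) (eq𝔻-call b d)))))
  where
  le : size a * 20 + (size b * 20 + 0) ≡ (size a + size b) * 20
  le = trans (cong (size a * 20 +_) (+-identityʳ _)) (sym (*-distribʳ-+ 20 (size a) (size b)))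

memCost : ℕ → ℕ → ℕ
memCost σ n = linear n (20 + σ * 20)

interCost : ℕ → ℕ → ℕ → ℕ
interCost σ l n = linear l (20 + memCost σ n)

subsetCost : ℕ → ℕ → ℕ → ℕ
subsetCost = interCost

appCost : ℕ → ℕ
appCost n = linear n 20

-- The list functions inspect elements only through `eqF`. By injectivity of the encoding this
-- decides equality of the elements, and one analysis serves both edges and literals.
module Coded {A : Set} (enc : A → 𝔻) (_≟_ : DecidableEquality A)
             (enc-injective : ∀ {x y} → enc x ≡ enc y → x ≡ y)
             (σ : ℕ) (size-enc : ∀ x → size (enc x) ≤ σ) where

  open DecMembership _≟_ using (_∈?_)

  encs : List A → 𝔻
  encs = encodeList enc

  eq-call : ∀ x y → Call eqF (enc x ∷ enc y ∷ []) (encodeBool (does (x ≟ y))) (σ * 20)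
  eq-call x y = weaken (*-monoˡ-≤ 20 (size-enc x))
    (subst (λ b → Call eqF (enc x ∷ enc y ∷ []) (encodeBool b) (size (enc x) * 20))
      (does-⇔ (mk⇔ enc-injective (cong enc)) (enc x ≟𝔻 enc y) (x ≟ y)) (eq𝔻-call (enc x) (enc y)))

  mem-call : ∀ x xs → Call memF (enc x ∷ encs xs ∷ []) (encodeBool (does (x ∈? xs))) (memCost σ (length xs))
  mem-call x [] = within 20 (base≤ 20 0 (m≤m+n 20 _)) (case₀ʳ varʳ nilʳ)
  mem-call x (y ∷ ys) with does (x ≟ y) | eq-call x y
  ... | true  | eq = within 20 (last≤ 20 (suc (length ys)) ≤-refl)
    (case₁ʳ varʳ (case₁ʳ (callʳ (varʳ ∷ʳ varʳ ∷ʳ []ʳ) eq) trueʳ))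
  ... | false | eq = within 20 (step₁≤ 20 (length ys) ≤-refl)
    (case₁ʳ varʳ (case₀ʳ (callʳ (varʳ ∷ʳ varʳ ∷ʳ []ʳ) eq)
      (callʳ (varʳ ∷ʳ varʳ ∷ʳ []ʳ) (mem-call x ys))))

  app-call : ∀ xs ys → Call appF (encs xs ∷ encs ys ∷ []) (encs (xs ++ ys)) (appCost (length xs))
  app-call [] ys = within 20 (base≤ 20 0 ≤-refl) (case₀ʳ varʳ varʳ)
  app-call (x ∷ xs) ys = within 20 (step₀≤ 20 (length xs) ≤-refl)
    (case₁ʳ varʳ (consʳ varʳ (callʳ (varʳ ∷ʳ varʳ ∷ʳ []ʳ) (app-call xs ys))))

  rem-call : ∀ x xs → Call remF (enc x ∷ encs xs ∷ [])
               (encs (filter (λ y → ¬? (y ≟ x)) xs)) (memCost σ (length xs))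
  rem-call x [] = within 20 (base≤ 20 0 (m≤m+n 20 _)) (case₀ʳ varʳ nilʳ)
  rem-call x (y ∷ ys) with does (y ≟ x) | eq-call y x
  ... | true  | eq = within 20 (step₁≤ 20 (length ys) ≤-refl)
    (case₁ʳ varʳ (case₁ʳ (callʳ (varʳ ∷ʳ varʳ ∷ʳ []ʳ) eq)
      (callʳ (varʳ ∷ʳ varʳ ∷ʳ []ʳ) (rem-call x ys))))
  ... | false | eq = within 20 (step₁≤ 20 (length ys) ≤-refl)
    (case₁ʳ varʳ (case₀ʳ (callʳ (varʳ ∷ʳ varʳ ∷ʳ []ʳ) eq)
      (consʳ varʳ (callʳ (varʳ ∷ʳ varʳ ∷ʳ []ʳ) (rem-call x ys)))))

  inter-call : ∀ xs ys → Call interF (encs xs ∷ encs ys ∷ []) (encs (filter (_∈? ys) xs))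
                 (interCost σ (length xs) (length ys))
  inter-call [] ys = within 20 (base≤ 20 0 (m≤m+n 20 _)) (case₀ʳ varʳ nilʳ)
  inter-call (x ∷ xs) ys with does (x ∈? ys) | mem-call x ys
  ... | true  | q = within 20 (step₁≤ 20 (length xs) ≤-refl)
    (case₁ʳ varʳ (case₁ʳ (callʳ (varʳ ∷ʳ varʳ ∷ʳ []ʳ) q)
      (consʳ varʳ (callʳ (varʳ ∷ʳ varʳ ∷ʳ []ʳ) (inter-call xs ys)))))
  ... | false | q = within 20 (step₁≤ 20 (length xs) ≤-refl)
    (case₁ʳ varʳ (case₀ʳ (callʳ (varʳ ∷ʳ varʳ ∷ʳ []ʳ) q)
      (callʳ (varʳ ∷ʳ varʳ ∷ʳ []ʳ) (inter-call xs ys))))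

-- The algorithm on graphs and clauses

copies : ∀ {A : Set} → List A → List A → List A
copies []       ys = []
copies (_ ∷ xs) ys = ys ++ copies xs ys

shorter : ∀ {A : Set} → List A → List A → Bool
shorter []       _        = true
shorter (_ ∷ _)  []       = false
shorter (_ ∷ xs) (_ ∷ ys) = shorter xs ys

hasEmpty : ∀ {m} → CNF m → Bool
hasEmpty []            = false
hasEmpty ([] ∷ F)      = true
hasEmpty ((_ ∷ _) ∷ F) = hasEmpty F

positive : ∀ {m} → Clause m → Bool
positive []              = true
positive ((_ , b) ∷ ls) = if b then positive ls else false

-- Exactly one of the clauses of the constraint of a nonisolated vertex has
-- only positive literals after the first one.
items : ∀ {m} → CNF m → List (List (Fin m))
items []             = []
items ([] ∷ F)       = items F
items ((l ∷ ls) ∷ F) = if positive ls then map proj₁ (l ∷ ls) ∷ items F else items F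

module _ {m : ℕ} where

  open DecMembership (_≟ᶠ_ {m}) public using () renaming (_∈?_ to _∈ᵉ?_)
  open DecMembership (_≟ˡ_ {m}) public using () renaming (_∈?_ to _∈ˡ?_)

  -- P and Q are the edges incident with either side, with multiplicity; Es and
  -- Et are the edges inside either side, Ec those of the cut.
  record Cut : Set where
    constructor cut
    field
      P Q Es Et Ec : List (Fin m)

  -- `V` is the incidence list of the new vertex, of length d, and `W` has length 2 m. Its edges to
  -- `P` and to `Q` are `a` and `b`. Joining `P` changes A by a - b and B² by 2 d B + d², joining
  -- `Q` changes them by b - a and -2 d B + d². So `P` is the better side for m A - B² when 2 m b +
  -- 4 d p ≤ 2 m a + 4 d q, for p and q the lengths of `P` and `Q`. This is the test, and `u` has
  -- length 4 d.
  place : List (Fin m) → List (Fin m) → Cut → Cut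
  place W V (cut P Q Es Et Ec) =
    let a = filter (_∈ᵉ? P) V
        b = filter (_∈ᵉ? Q) V
        u = (V ++ V) ++ (V ++ V)
    in if shorter (copies b W ++ copies u P) (copies a W ++ copies u Q)
       then cut (V ++ P) Q (a ++ Es) Et (b ++ Ec)
       else cut P (V ++ Q) Es (b ++ Et) (a ++ Ec)

  greedy : List (Fin m) → List (List (Fin m)) → Cut → Cut
  greedy W []      c = c
  greedy W (V ∷ I) c = greedy W I (place W V c)

  find : CNF m → Clause m → Maybe (ProofTree m)
  find []      ρ = nothing
  find (C ∷ F) ρ = if does (all? (_∈ˡ? ρ) C) then just (leaf C) else find F ρ

  conclusion : ProofTree m → Clause m
  conclusion (leaf C)       = C
  conclusion (node C _ _ _) = C

  -- `Derives` allows a resolution step only if both literals occur. If one premise lacks its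
  -- literal, its conclusion is falsified without the query at `x`, and this premise takes the place
  -- of the node.
  combine : Fin m → Maybe (ProofTree m) → Maybe (ProofTree m) → Maybe (ProofTree m)
  combine x nothing  _        = nothing
  combine x (just _) nothing  = nothing
  combine x (just π) (just ρ) =
    if does ((x , true) ∈ˡ? conclusion π)
    then (if does ((x , false) ∈ˡ? conclusion ρ)
          then just (node (resolvent x (conclusion π) (conclusion ρ)) x π ρ)
          else just ρ)
    else just π

  -- The parameter `k` says what to do once the variables are used up. With `search` as `k` the tree
  -- over the cut continues into a side, and with `find` that second tree ends in clauses. Variables
  -- already on the path are skipped, which keeps the path consistent.
  build : (Clause m → Maybe (ProofTree m)) → List (Fin m) → Clause m → Maybe (ProofTree m)
  build k []       ρ = k ρ
  build k (x ∷ xs) ρ =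
    if does ((x , true) ∈ˡ? ρ) then build k xs ρ else
    if does ((x , false) ∈ˡ? ρ) then build k xs ρ else
    combine x (build k xs ((x , true) ∷ ρ)) (build k xs ((x , false) ∷ ρ))

  search : CNF m → List (Fin m) → List (Fin m) → Clause m → Maybe (ProofTree m)
  search F Es Et ρ = build (find F) Es ρ <∣> build (find F) Et ρ

encodeMaybe : ∀ {m} → Maybe (ProofTree m) → 𝔻
encodeMaybe nothing  = nil
encodeMaybe (just π) = encodeTree π

-- Correctness and running time of the program

opaque
  unfolding linear

  steps≤ : ∀ K n as {a} → K + sum as ≤ a → K + sum (as ++ linear n a ∷ []) ≤ linear (suc n) a
  steps≤ K n as {a} p = begin
    K + sum (as ++ linear n a ∷ [])   ≡⟨ cong (K +_) (sum-++ as _) ⟩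
    K + (sum as + (linear n a + 0))   ≡⟨ cong (λ z → K + (sum as + z)) (+-identityʳ _) ⟩
    K + (sum as + linear n a)         ≡⟨ +-assoc K (sum as) _ ⟨
    (K + sum as) + linear n a         ≤⟨ +-monoˡ-≤ (linear n a) p ⟩
    linear (suc n) a                  ∎
    where open ≤-Reasoning

length-copies : ∀ {A : Set} (xs ys : List A) → length (copies xs ys) ≡ length xs * length ys
length-copies []       ys = refl
length-copies (_ ∷ xs) ys = trans (length-++ ys) (cong (length ys +_) (length-copies xs ys))

mulCost : ℕ → ℕ → ℕ
mulCost l n = linear l (20 + appCost n)

findCost : ℕ → ℕ → ℕ → ℕ → ℕ
findCost σ N L R = linear N (20 + subsetCost σ L R)

itemsCost : ℕ → ℕ → ℕ
itemsCost N L = linear N (20 + (linear L 20 + (linear L 20 + 0)))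

concatCost : ℕ → ℕ → ℕ
concatCost n L = linear n (20 + appCost L)

resolveCost : ℕ → ℕ → ℕ
resolveCost σ ℓ =
  100 + sum (memCost σ ℓ ∷ memCost σ ℓ ∷ memCost σ ℓ ∷ memCost σ ℓ ∷ appCost ℓ ∷ [])

-- Encodings, and the functions on lists of edges and on clauses

size-encodeℕ : ∀ n → size (encodeℕ n) ≡ suc (n + n)
size-encodeℕ zero    = refl
size-encodeℕ (suc n) = cong suc (trans (cong suc (size-encodeℕ n)) (cong suc (sym (+-suc n n))))

encodeℕ-injective : ∀ {i j} → encodeℕ i ≡ encodeℕ j → i ≡ j
encodeℕ-injective {zero}  {zero}  _  = refl
encodeℕ-injective {suc i} {suc j} eq = cong suc (encodeℕ-injective (∙-injectiveʳ eq))
  where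
  ∙-injectiveʳ : ∀ {a b c d} → a ∙ b ≡ c ∙ d → b ≡ d
  ∙-injectiveʳ refl = refl

literalSize : ℕ → ℕ
literalSize m = suc ((m + m) + 4)

module _ {m : ℕ} where

  private σ = literalSize m

  encodeEdge : Fin m → 𝔻
  encodeEdge x = encodeℕ (toℕ x)

  size-encodeEdge : ∀ x → size (encodeEdge x) ≤ suc (m + m)
  size-encodeEdge x = ≤-trans (≤-reflexive (size-encodeℕ (toℕ x)))
    (s≤s (+-mono-≤ (<⇒≤ (toℕ<n x)) (<⇒≤ (toℕ<n x))))

  encodeLiteral-injective : ∀ {k l : Literal m} → encodeLiteral k ≡ encodeLiteral l → k ≡ l
  encodeLiteral-injective {x , b} {y , c} eq = cong₂ _,_
    (toℕ-injective (encodeℕ-injective (proj₁ (split eq)))) (bool b c (proj₂ (split eq)))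
    where
    split : ∀ {a b c d} → a ∙ b ≡ c ∙ d → a ≡ c × b ≡ d
    split refl = refl , refl
    bool : ∀ b c → encodeBool b ≡ encodeBool c → b ≡ c
    bool false false _ = refl
    bool true  true  _ = refl

  size-encodeLiteral : ∀ (l : Literal m) → size (encodeLiteral l) ≤ σ
  size-encodeLiteral (x , b) = s≤s (≤-trans (+-mono-≤ (size-encodeEdge x) (bool b))
    (≤-reflexive (sym (+-suc (m + m) 3))))
    where
    bool : ∀ b → size (encodeBool b) ≤ 3
    bool false = s≤s z≤n
    bool true  = ≤-refl

  open Coded encodeEdge _≟ᶠ_ (toℕ-injective ∘ encodeℕ-injective) σ
    (λ x → ≤-trans (size-encodeEdge x) (s≤s (m≤m+n (m + m) 4)))
    using () renaming (encs to encodeEdges; app-call to app-edges; inter-call to inter-edges)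
    public
  open Coded encodeLiteral _≟ˡ_ encodeLiteral-injective σ size-encodeLiteral
    using () renaming (mem-call to mem-literals; app-call to app-literals; rem-call to rem-literals)
    public

  mul-call : ∀ xs ys → Call mulF (encodeEdges xs ∷ encodeEdges ys ∷ []) (encodeEdges (copies xs ys))
               (mulCost (length xs) (length ys))
  mul-call [] ys = within 20 (base≤ 20 0 (m≤m+n 20 _)) (case₀ʳ varʳ nilʳ)
  mul-call (x ∷ xs) ys = within 20 (begin
    20 + (mul + (app + 0)) ≡⟨ cong (20 +_) (trans (cong (mul +_) (+-identityʳ app)) (trans (+-comm mul app) (cong (app +_) (sym (+-identityʳ mul))))) ⟩
    20 + (app + (mul + 0)) ≤⟨ step₁≤ 20 (length xs) ≤-refl ⟩
    mulCost (suc (length xs)) (length ys) ∎)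
    (case₁ʳ varʳ (callʳ (varʳ ∷ʳ callʳ (varʳ ∷ʳ varʳ ∷ʳ []ʳ) (mul-call xs ys) ∷ʳ []ʳ) (app-edges ys (copies xs ys))))
    where
    open ≤-Reasoning
    mul = mulCost (length xs) (length ys)
    app = appCost (length ys)

  leq-call : ∀ (xs ys : List (Fin m)) → Call leqF (encodeEdges xs ∷ encodeEdges ys ∷ []) (encodeBool (shorter xs ys))
               (linear (length xs) 20)
  leq-call [] ys = within 20 (base≤ 20 0 ≤-refl) (case₀ʳ varʳ trueʳ)
  leq-call (x ∷ xs) [] = within 20 (base≤ 20 (suc (length xs)) ≤-refl) (case₁ʳ varʳ (case₀ʳ varʳ nilʳ))
  leq-call (x ∷ xs) (y ∷ ys) = within 20 (step₀≤ 20 (length xs) ≤-refl)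
    (case₁ʳ varʳ (case₁ʳ varʳ (callʳ (varʳ ∷ʳ varʳ ∷ʳ []ʳ) (leq-call xs ys))))

  vars-call : ∀ (C : Clause m) → Call varsF (encodeClause C ∷ []) (encodeEdges (map proj₁ C)) (linear (length C) 20)
  vars-call [] = within 20 (base≤ 20 0 ≤-refl) (case₀ʳ varʳ nilʳ)
  vars-call (l ∷ C) = within 20 (step₀≤ 20 (length C) ≤-refl)
    (case₁ʳ varʳ (case₁ʳ varʳ (consʳ varʳ (callʳ (varʳ ∷ʳ []ʳ) (vars-call C)))))

  positive-call : ∀ (C : Clause m) → Call allposF (encodeClause C ∷ []) (encodeBool (positive C)) (linear (length C) 20)
  positive-call [] = within 20 (base≤ 20 0 ≤-refl) (case₀ʳ varʳ trueʳ)
  positive-call ((x , false) ∷ C) = within 20 (base≤ 20 (suc (length C)) ≤-refl)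
    (case₁ʳ varʳ (case₁ʳ varʳ (case₀ʳ varʳ nilʳ)))
  positive-call ((x , true) ∷ C) = within 20 (step₀≤ 20 (length C) ≤-refl)
    (case₁ʳ varʳ (case₁ʳ varʳ (case₁ʳ varʳ (callʳ (varʳ ∷ʳ []ʳ) (positive-call C)))))

  items-call : ∀ {L} (F : CNF m) → All (λ C → length C ≤ L) F →
               Call itemsF (encodeCNF F ∷ []) (encodeList encodeEdges (items F)) (itemsCost (length F) L)
  items-call [] [] = within 20 (base≤ 20 0 (m≤m+n 20 _)) (case₀ʳ varʳ nilʳ)
  items-call ([] ∷ F) (p ∷ ps) = within 20 (step₀≤ 20 (length F) (m≤m+n 20 _))
    (case₁ʳ varʳ (case₀ʳ varʳ (callʳ (varʳ ∷ʳ []ʳ) (items-call F ps))))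
  items-call {L} ((l ∷ C) ∷ F) (p ∷ ps) with positive C | positive-call C
  ... | true  | q = within 20 (steps≤ 20 (length F) (linear L 20 ∷ linear L 20 ∷ []) ≤-refl)
    (case₁ʳ varʳ (case₁ʳ varʳ
      (case₁ʳ (callʳ (varʳ ∷ʳ []ʳ) (weaken (linear-mono (≤-trans (n≤1+n _) p) (≤-refl {20})) q))
        (consʳ (callʳ (varʳ ∷ʳ []ʳ) (weaken (linear-mono p (≤-refl {20})) (vars-call (l ∷ C))))
          (callʳ (varʳ ∷ʳ []ʳ) (items-call F ps))))))
  ... | false | q = within 20 (steps≤ 20 (length F) (linear L 20 ∷ []) (+-monoʳ-≤ 20 (+-monoʳ-≤ (linear L 20) z≤n)))
    (case₁ʳ varʳ (case₁ʳ varʳ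
      (case₀ʳ (callʳ (varʳ ∷ʳ []ʳ) (weaken (linear-mono (≤-trans (n≤1+n _) p) (≤-refl {20})) q))
          (callʳ (varʳ ∷ʳ []ʳ) (items-call F ps)))))

  concat-call : ∀ {L} (I : List (List (Fin m))) → All (λ V → length V ≤ L) I →
                Call concatF (encodeList encodeEdges I ∷ []) (encodeEdges (concat I)) (concatCost (length I) L)
  concat-call [] [] = within 20 (base≤ 20 0 (m≤m+n 20 _)) (case₀ʳ varʳ nilʳ)
  concat-call {L} (V ∷ I) (p ∷ ps) = within 20 (begin
    20 + (rest + (app + 0)) ≡⟨ cong (20 +_) (trans (cong (rest +_) (+-identityʳ app)) (trans (+-comm rest app) (cong (app +_) (sym (+-identityʳ rest))))) ⟩
    20 + (app + (rest + 0)) ≤⟨ step₁≤ 20 (length I) ≤-refl ⟩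
    concatCost (suc (length I)) L ∎)
    (case₁ʳ varʳ (callʳ (varʳ ∷ʳ callʳ (varʳ ∷ʳ []ʳ) (concat-call I ps) ∷ʳ []ʳ)
      (weaken (linear-mono p ≤-refl) (app-edges V (concat I)))))
    where
    open ≤-Reasoning
    rest = concatCost (length I) L
    app = appCost L

  nonempties : CNF m → ℕ
  nonempties []            = 0
  nonempties ([] ∷ F)      = nonempties F
  nonempties ((_ ∷ _) ∷ F) = suc (nonempties F)

  -- The scan stops at the first empty clause, so its time does not depend on how many empty clauses
  -- the isolated vertices contribute.
  empty-call : ∀ (F : CNF m) → Call emptyF (encodeCNF F ∷ []) (encodeBool (hasEmpty F)) (linear (nonempties F) 20)
  empty-call [] = within 20 (base≤ 20 0 ≤-refl) (case₀ʳ varʳ nilʳ)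
  empty-call ([] ∷ F) = within 20 (base≤ 20 (nonempties F) ≤-refl) (case₁ʳ varʳ (case₀ʳ varʳ trueʳ))
  empty-call ((_ ∷ _) ∷ F) = within 20 (step₀≤ 20 (nonempties F) ≤-refl)
    (case₁ʳ varʳ (case₁ʳ varʳ (callʳ (varʳ ∷ʳ []ʳ) (empty-call F))))

  subset-call : ∀ (C ρ : Clause m) → Call subsetF (encodeClause C ∷ encodeClause ρ ∷ [])
                  (encodeBool (does (all? (_∈ˡ? ρ) C))) (subsetCost σ (length C) (length ρ))
  subset-call [] ρ = within 20 (base≤ 20 0 (m≤m+n 20 _)) (case₀ʳ varʳ trueʳ)
  subset-call (l ∷ C) ρ with does (l ∈ˡ? ρ) | mem-literals l ρ
  ... | true  | q = within 20 (step₁≤ 20 (length C) ≤-refl)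
    (case₁ʳ varʳ (case₁ʳ (callʳ (varʳ ∷ʳ varʳ ∷ʳ []ʳ) q) (callʳ (varʳ ∷ʳ varʳ ∷ʳ []ʳ) (subset-call C ρ))))
  ... | false | q = within 20 (last≤ 20 (suc (length C)) ≤-refl)
    (case₁ʳ varʳ (case₀ʳ (callʳ (varʳ ∷ʳ varʳ ∷ʳ []ʳ) q) nilʳ))

  find-call : ∀ {L R} (F : CNF m) → All (λ C → length C ≤ L) F → ∀ ρ → length ρ ≤ R →
              Call findF (encodeCNF F ∷ encodeClause ρ ∷ []) (encodeMaybe (find F ρ)) (findCost σ (length F) L R)
  find-call [] [] ρ r = within 20 (base≤ 20 0 (m≤m+n 20 _)) (case₀ʳ varʳ nilʳ)
  find-call (C ∷ F) (p ∷ ps) ρ r with does (all? (_∈ˡ? ρ) C) | weaken (linear-mono p (+-monoʳ-≤ 20 (linear-mono r ≤-refl))) (subset-call C ρ)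
  ... | true  | q = within 20 (last≤ 20 (suc (length F)) ≤-refl)
    (case₁ʳ varʳ (case₁ʳ (callʳ (varʳ ∷ʳ varʳ ∷ʳ []ʳ) q) (consʳ nilʳ varʳ)))
  ... | false | q = within 20 (step₁≤ 20 (length F) ≤-refl)
    (case₁ʳ varʳ (case₀ʳ (callʳ (varʳ ∷ʳ varʳ ∷ʳ []ʳ) q) (callʳ (varʳ ∷ʳ varʳ ∷ʳ []ʳ) (find-call F ps ρ r))))

  clause-call : ∀ (π : ProofTree m) → Call clauseF (encodeTree π ∷ []) (encodeClause (conclusion π)) 20
  clause-call (leaf C) = within 20 ≤-refl (case₁ʳ varʳ (case₀ʳ varʳ varʳ))
  clause-call (node C x π ρ) = within 20 ≤-refl (case₁ʳ varʳ (case₁ʳ varʳ (case₁ʳ varʳ varʳ)))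

module _ {m : ℕ} where

  private σ = literalSize m

  -- Leaves and nodes are both encoded by pairs, so `caseᵉ` tells a tree from the failure `nil`.
  caseTreeʳ : ∀ {n} {ρ : Vec 𝔻 n} {e e₀ e₁ v k l as bs} (π : ProofTree m) → Run ρ e (encodeTree π) k as →
              (∀ {a b} → encodeTree π ≡ a ∙ b → Run (a ∷ b ∷ ρ) e₁ v l bs) →
              Run ρ (caseᵉ e e₀ e₁) v (suc (k + l)) (as ++ bs)
  caseTreeʳ (leaf _)       p q = case₁ʳ p (q refl)
  caseTreeʳ (node _ _ _ _) p q = case₁ʳ p (q refl)

  Short : ℕ → ProofTree m → Set
  Short ℓ π = length (conclusion π) ≤ ℓ

  resolve-call : ∀ {ℓ} x {M N} → Maybe.All (Short ℓ) M → Maybe.All (Short ℓ) N →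
                 Call resolveF (encodeEdge x ∷ encodeMaybe M ∷ encodeMaybe N ∷ [])
                   (encodeMaybe (combine x M N)) (resolveCost σ ℓ)
  resolve-call x Maybe.nothing q = within {as = []} 100 (+-monoʳ-≤ 100 z≤n) (case₀ʳ varʳ nilʳ)
  resolve-call x {just π} (Maybe.just p) Maybe.nothing =
    within {as = []} 100 (+-monoʳ-≤ 100 z≤n) (caseTreeʳ π varʳ λ _ → case₀ʳ varʳ nilʳ)
  resolve-call {ℓ} x {just π} {just ρ} (Maybe.just p) (Maybe.just q) =
    branch _ (weaken (linear-mono p ≤-refl) (mem-literals (x , true) (conclusion π)))
           _ (weaken (linear-mono q ≤-refl) (mem-literals (x , false) (conclusion ρ)))
    where
    branch : ∀ b₁ → Call memF (encodeLiteral (x , true) ∷ encodeClause (conclusion π) ∷ [])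
                      (encodeBool b₁) (memCost σ ℓ) →
             ∀ b₂ → Call memF (encodeLiteral (x , false) ∷ encodeClause (conclusion ρ) ∷ [])
                      (encodeBool b₂) (memCost σ ℓ) →
             Call resolveF (encodeEdge x ∷ encodeTree π ∷ encodeTree ρ ∷ [])
               (encodeMaybe (if b₁ then (if b₂ then just (node (resolvent x (conclusion π) (conclusion ρ)) x π ρ)
                                         else just ρ) else just π)) (resolveCost σ ℓ)
    branch false mem₁ _ _ = within {as = 20 ∷ 20 ∷ memCost σ ℓ ∷ []} 60
      (+-monoʳ-≤ 100 (+-monoʳ-≤ (memCost σ ℓ) z≤n))
      (caseTreeʳ π varʳ λ _ → caseTreeʳ ρ varʳ λ _ →
        letʳ (callʳ (varʳ ∷ʳ []ʳ) (clause-call π)) (letʳ (callʳ (varʳ ∷ʳ []ʳ) (clause-call ρ))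
          (case₀ʳ (callʳ (consʳ varʳ trueʳ ∷ʳ varʳ ∷ʳ []ʳ) mem₁) varʳ)))
    branch true mem₁ false mem₂ = within {as = 20 ∷ 20 ∷ memCost σ ℓ ∷ memCost σ ℓ ∷ []} 60
      (+-monoʳ-≤ 100 (+-monoʳ-≤ (memCost σ ℓ) (+-monoʳ-≤ (memCost σ ℓ) z≤n)))
      (caseTreeʳ π varʳ λ _ → caseTreeʳ ρ varʳ λ _ →
        letʳ (callʳ (varʳ ∷ʳ []ʳ) (clause-call π)) (letʳ (callʳ (varʳ ∷ʳ []ʳ) (clause-call ρ))
          (case₁ʳ (callʳ (consʳ varʳ trueʳ ∷ʳ varʳ ∷ʳ []ʳ) mem₁)
            (case₀ʳ (callʳ (consʳ varʳ nilʳ ∷ʳ varʳ ∷ʳ []ʳ) mem₂) varʳ))))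
    branch true mem₁ true mem₂ =
      within {as = 20 ∷ 20 ∷ memCost σ ℓ ∷ memCost σ ℓ ∷ memCost σ ℓ ∷ memCost σ ℓ ∷ appCost ℓ ∷ []} 60 ≤-refl
      (caseTreeʳ π varʳ λ _ → caseTreeʳ ρ varʳ λ _ →
        letʳ (callʳ (varʳ ∷ʳ []ʳ) (clause-call π)) (letʳ (callʳ (varʳ ∷ʳ []ʳ) (clause-call ρ))
          (case₁ʳ (callʳ (consʳ varʳ trueʳ ∷ʳ varʳ ∷ʳ []ʳ) mem₁)
            (case₁ʳ (callʳ (consʳ varʳ nilʳ ∷ʳ varʳ ∷ʳ []ʳ) mem₂)
              (consʳ trueʳ (consʳ
                (callʳ (callʳ (consʳ varʳ trueʳ ∷ʳ varʳ ∷ʳ []ʳ)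
                          (weaken (linear-mono p ≤-refl) (rem-literals (x , true) (conclusion π))) ∷ʳ
                        callʳ (consʳ varʳ nilʳ ∷ʳ varʳ ∷ʳ []ʳ)
                          (weaken (linear-mono q ≤-refl) (rem-literals (x , false) (conclusion ρ))) ∷ʳ []ʳ)
                  (weaken (linear-mono (≤-trans (length-filter _ (conclusion π)) p) ≤-refl)
                    (app-literals (remove (x , true) (conclusion π)) _)))
                (consʳ varʳ (consʳ varʳ varʳ))))))))

-- The cost of a complete binary tree of height n with leaves of cost u, and
-- with K as the ratio of the cost at an inner node to the number of leaves
-- below it.
opaque
  treeCost : ℕ → ℕ → ℕ → ℕ
  treeCost u K n = 2 ^ n * (u + n * K)

module _ {u K : ℕ} where

  open ≤-Reasoning

  opaque
    unfolding treeCost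

    -- One more level adds `2 ^ suc n * K` to the two subtrees, which is twice the allowance used
    -- here.
    treeCost-node : ∀ n {o a b} → o ≤ 2 ^ n * K → a ≤ treeCost u K n → b ≤ treeCost u K n →
                    o + (a + b) ≤ treeCost u K (suc n)
    treeCost-node n {o} {a} {b} p q r = begin
      o + (a + b)                                                       ≤⟨ +-mono-≤ p (+-mono-≤ q r) ⟩
      2 ^ n * K + (treeCost u K n + treeCost u K n)                     ≤⟨ m≤m+n _ (2 ^ n * K) ⟩
      2 ^ n * K + (treeCost u K n + treeCost u K n) + 2 ^ n * K         ≡⟨ identity (2 ^ n) u n K ⟩
      treeCost u K (suc n)                                              ∎
      where
      identity : ∀ e u n K → e * K + (e * (u + n * K) + e * (u + n * K)) + e * K ≡
                 (e + (e + 0)) * (u + (K + n * K))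
      identity = solve-∀

    treeCost-suc : ∀ n {o a} → o ≤ 2 ^ n * K → a ≤ treeCost u K n → o + a ≤ treeCost u K (suc n)
    treeCost-suc n {o} {a} p q = begin
      o + a       ≡⟨ cong (o +_) (+-identityʳ a) ⟨
      o + (a + 0) ≤⟨ treeCost-node n p q z≤n ⟩
      treeCost u K (suc n) ∎

    treeCost-zero : u ≤ treeCost u K 0
    treeCost-zero = ≤-trans (m≤m+n u (0 * K)) (≤-reflexive (sym (+-identityʳ _)))

    -- For sizes the whole of `2 ^ suc n * K` is spent, since the clause at the new node may have
    -- length `2 ^ suc n * ℓ`.
    treeCost-double : ∀ n → (2 ^ n * K + 2 ^ n * K) + (treeCost u K n + treeCost u K n) ≡ treeCost u K (suc n)
    treeCost-double n = identity (2 ^ n) u n K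
      where
      identity : ∀ e u n K → (e * K + e * K) + (e * (u + n * K) + e * (u + n * K)) ≡
                 (e + (e + 0)) * (u + (K + n * K))
      identity = solve-∀

1≤2^ : ∀ n → 1 ≤ 2 ^ n
1≤2^ n = m^n>0 2 n

≤2^* : ∀ n a → a ≤ 2 ^ n * a
≤2^* n a = m≤n*m a (2 ^ n) {{>-nonZero (1≤2^ n)}}

opaque
  unfolding linear

  linear-scale : ∀ n ℓ c → linear (2 ^ n * ℓ) c ≤ 2 ^ n * linear ℓ c
  linear-scale n ℓ c = begin
    suc (2 ^ n * ℓ) * c       ≤⟨ *-monoˡ-≤ c (+-monoˡ-≤ (2 ^ n * ℓ) (1≤2^ n)) ⟩
    (2 ^ n + 2 ^ n * ℓ) * c   ≡⟨ cong (_* c) (*-suc (2 ^ n) ℓ) ⟨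
    2 ^ n * suc ℓ * c         ≡⟨ *-assoc (2 ^ n) (suc ℓ) c ⟩
    2 ^ n * (suc ℓ * c)       ∎
    where open ≤-Reasoning

resolveCost-scale : ∀ n σ ℓ → resolveCost σ (2 ^ n * ℓ) ≤ 2 ^ n * resolveCost σ ℓ
resolveCost-scale n σ ℓ = scale+ 100 _ (≤2^* n 100) (scale+ _ _ mem (scale+ _ _ mem
  (scale+ _ _ mem (scale+ _ _ mem (scale+ _ _ (linear-scale n ℓ 20) z≤n)))))
  where
  mem = linear-scale n ℓ (20 + σ * 20)
  scale+ : ∀ {a b} c d → a ≤ 2 ^ n * c → b ≤ 2 ^ n * d → a + b ≤ 2 ^ n * (c + d)
  scale+ c d p q = ≤-trans (+-mono-≤ p q) (≤-reflexive (sym (*-distribˡ-+ (2 ^ n) c d)))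

-- Size of the trees and time for building them

nodeCost : ℕ → ℕ → ℕ → ℕ
nodeCost σ R ℓ = 80 + sum (memCost σ R ∷ memCost σ R ∷ resolveCost σ ℓ ∷ [])

nodeSize : ℕ → ℕ → ℕ
nodeSize σ ℓ = 8 + σ + ℓ * suc σ

module _ {m : ℕ} where

  private σ = literalSize m

  combine-All : ∀ {P Q : ProofTree m → Set} x → (∀ {π} → P π → Q π) →
                (∀ {π ρ} → P π → P ρ → Q (node (resolvent x (conclusion π) (conclusion ρ)) x π ρ)) →
                ∀ {M N} → Maybe.All P M → Maybe.All P N → Maybe.All Q (combine x M N)
  combine-All x keep join Maybe.nothing q = Maybe.nothing
  combine-All x keep join (Maybe.just p) Maybe.nothing = Maybe.nothing
  combine-All x keep join {just π} {just ρ} (Maybe.just p) (Maybe.just q)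
    with does ((x , true) ∈ˡ? conclusion π)
  ... | false = Maybe.just (keep p)
  ... | true with does ((x , false) ∈ˡ? conclusion ρ)
  ...   | false = Maybe.just (keep q)
  ...   | true  = Maybe.just (join p q)

  size-encodeClause : ∀ (C : Clause m) → size (encodeClause C) ≤ suc (length C * suc σ)
  size-encodeClause []      = ≤-refl
  size-encodeClause (l ∷ C) = s≤s (begin
    size (encodeLiteral l) + size (encodeClause C) ≤⟨ +-mono-≤ (size-encodeLiteral l) (size-encodeClause C) ⟩
    σ + suc (length C * suc σ)                     ≡⟨ +-suc σ _ ⟩
    suc σ + length C * suc σ                       ∎)
    where open ≤-Reasoning

  length-resolvent : ∀ x (C D : Clause m) → length (resolvent x C D) ≤ length C + length D
  length-resolvent x C D = begin
    length (remove (x , true) C ++ remove (x , false) D)      ≡⟨ length-++ (remove (x , true) C) ⟩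
    length (remove (x , true) C) + length (remove (x , false) D) ≤⟨ +-mono-≤ (length-filter _ C) (length-filter _ D) ⟩
    length C + length D ∎
    where open ≤-Reasoning

  -- `resolvent` concatenates without merging duplicates, so the bound on the length of clauses
  -- doubles at every level. This is harmless: the number of nodes halves from level to level, so
  -- every level contributes about the same total.
  Small : ℕ → ℕ → ℕ → ProofTree m → Set
  Small ℓ u n π = Short (2 ^ n * ℓ) π × size (encodeTree π) ≤ treeCost u (nodeSize σ ℓ) n

  Small-suc : ∀ {ℓ u} n {π} → Small ℓ u n π → Small ℓ u (suc n) π
  Small-suc {ℓ} n (p , q) =
    ≤-trans p (*-monoˡ-≤ ℓ (m≤m+n (2 ^ n) (2 ^ n + 0))) , treeCost-suc n z≤n q

  Small-node : ∀ {ℓ u} n x {π ρ} → Small ℓ u n π → Small ℓ u n ρ →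
               Small ℓ u (suc n) (node (resolvent x (conclusion π) (conclusion ρ)) x π ρ)
  Small-node {ℓ} {u} n x {π} {ρ} (p , q) (p′ , q′) = short , (begin
    size (encodeTree (node C x π ρ))
      ≡⟨ rearrange (size (encodeClause C)) (size (encodeEdge x)) (size (encodeTree π)) (size (encodeTree ρ)) ⟩
    (7 + size (encodeEdge x) + size (encodeClause C)) + (size (encodeTree π) + size (encodeTree ρ))
      ≤⟨ +-monoˡ-≤ _ (+-mono-≤ (+-monoʳ-≤ 7 size-x) (size-encodeClause C)) ⟩
    (7 + σ + suc (length C * suc σ)) + (size (encodeTree π) + size (encodeTree ρ))
      ≤⟨ +-monoˡ-≤ _ overhead ⟩
    (2 ^ n * nodeSize σ ℓ + 2 ^ n * nodeSize σ ℓ) + (size (encodeTree π) + size (encodeTree ρ))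
      ≤⟨ +-monoʳ-≤ (2 ^ n * nodeSize σ ℓ + 2 ^ n * nodeSize σ ℓ) (+-mono-≤ q q′) ⟩
    (2 ^ n * nodeSize σ ℓ + 2 ^ n * nodeSize σ ℓ) + (treeCost u (nodeSize σ ℓ) n + treeCost u (nodeSize σ ℓ) n)
      ≡⟨ treeCost-double n ⟩
    treeCost u (nodeSize σ ℓ) (suc n) ∎)
    where
    open ≤-Reasoning
    C = resolvent x (conclusion π) (conclusion ρ)
    short : length C ≤ 2 ^ suc n * ℓ
    short = begin
      length C                                      ≤⟨ length-resolvent x (conclusion π) (conclusion ρ) ⟩
      length (conclusion π) + length (conclusion ρ) ≤⟨ +-mono-≤ p p′ ⟩
      2 ^ n * ℓ + 2 ^ n * ℓ                         ≡⟨ *-distribʳ-+ ℓ (2 ^ n) (2 ^ n) ⟨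
      (2 ^ n + 2 ^ n) * ℓ                           ≡⟨ cong (λ z → (2 ^ n + z) * ℓ) (+-identityʳ (2 ^ n)) ⟨
      2 ^ suc n * ℓ                                 ∎
    size-x : size (encodeEdge x) ≤ σ
    size-x = ≤-trans (size-encodeEdge x) (s≤s (m≤m+n (m + m) 4))
    rearrange : ∀ c x p q → suc (3 + suc (c + suc (x + suc (p + q)))) ≡ (7 + x + c) + (p + q)
    rearrange = solve-∀
    regroup : ∀ σ c → 7 + σ + suc c ≡ 8 + σ + c
    regroup = solve-∀
    regroup′ : ∀ e a l s → e * a + (e + (e + 0)) * l * s ≤ e * (a + l * s) + e * (a + l * s)
    regroup′ e a l s = ≤-trans (m≤m+n _ (e * a)) (≤-reflexive (lemma e a l s))
      where
      lemma : ∀ e a l s → e * a + (e + (e + 0)) * l * s + e * a ≡ e * (a + l * s) + e * (a + l * s)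
      lemma = solve-∀
    overhead : 7 + σ + suc (length C * suc σ) ≤ 2 ^ n * nodeSize σ ℓ + 2 ^ n * nodeSize σ ℓ
    overhead = begin
      7 + σ + suc (length C * suc σ)              ≡⟨ regroup σ (length C * suc σ) ⟩
      8 + σ + length C * suc σ                    ≤⟨ +-mono-≤ (≤2^* n (8 + σ)) (*-monoˡ-≤ (suc σ) short) ⟩
      2 ^ n * (8 + σ) + 2 ^ suc n * ℓ * suc σ     ≤⟨ regroup′ (2 ^ n) (8 + σ) ℓ (suc σ) ⟩
      2 ^ n * nodeSize σ ℓ + 2 ^ n * nodeSize σ ℓ ∎

  module _ {ℓ u : ℕ} {k : Clause m → Maybe (ProofTree m)} (small : ∀ ρ → Maybe.All (Small ℓ u 0) (k ρ)) where

    build-small : ∀ xs ρ → Maybe.All (Small ℓ u (length xs)) (build k xs ρ)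
    build-small [] ρ = small ρ
    build-small (x ∷ xs) ρ with does ((x , true) ∈ˡ? ρ)
    ... | true  = Maybe.map (Small-suc (length xs)) (build-small xs ρ)
    ... | false with does ((x , false) ∈ˡ? ρ)
    ...   | true  = Maybe.map (Small-suc (length xs)) (build-small xs ρ)
    ...   | false = combine-All x (Small-suc (length xs)) (Small-node (length xs) x)
                      (build-small xs ((x , true) ∷ ρ)) (build-small xs ((x , false) ∷ ρ))

    module _ {T R : ℕ} {d f : 𝔻}
             (leaf-call : ∀ ρ → length ρ ≤ R →
                          Call buildF (nil ∷ d ∷ f ∷ encodeClause ρ ∷ []) (encodeMaybe (k ρ)) T) where

      private
        K = nodeCost σ R ℓ
        M = memCost σ R

      -- A query moves one variable from `xs` to the path, so `R` bounds every path met in the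
      -- recursion, and with it the time of the membership tests.
      build-call : ∀ xs ρ → length ρ + length xs ≤ R →
                   Call buildF (encodeEdges xs ∷ d ∷ f ∷ encodeClause ρ ∷ []) (encodeMaybe (build k xs ρ))
                     (treeCost T K (length xs))
      build-call [] ρ p = weaken treeCost-zero
        (leaf-call ρ (≤-trans (m≤m+n _ 0) p))
      build-call (x ∷ xs) ρ p = branch
        where
        open ≤-Reasoning
        n = length xs
        p′ : length ρ + n ≤ R
        p′ = ≤-trans (+-monoʳ-≤ (length ρ) (n≤1+n n)) p
        p″ : suc (length ρ) + n ≤ R
        p″ = ≤-trans (≤-reflexive (sym (+-suc (length ρ) n))) p
        mem : ∀ b → Call memF (encodeLiteral (x , b) ∷ encodeClause ρ ∷ [])
                (encodeBool (does ((x , b) ∈ˡ? ρ))) M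
        mem b = weaken (linear-mono (≤-trans (m≤m+n _ n) p′) ≤-refl) (mem-literals (x , b) ρ)
        skip : ∀ o → o ≤ K → o + (treeCost T K n + 0) ≤ treeCost T K (suc n)
        skip o q = treeCost-suc n (≤-trans q (≤2^* n K)) (≤-reflexive (+-identityʳ _))
        pack : ∀ K M t r → K + (M + (M + (t + (t + (r + 0))))) ≡ (K + (M + (M + (r + 0)))) + (t + t)
        pack = solve-∀
        join : 80 + (M + (M + (treeCost T K n + (treeCost T K n + (resolveCost σ (2 ^ n * ℓ) + 0)))))
               ≤ treeCost T K (suc n)
        join = begin
          80 + (M + (M + (treeCost T K n + (treeCost T K n + (resolveCost σ (2 ^ n * ℓ) + 0)))))
            ≡⟨ pack 80 M (treeCost T K n) (resolveCost σ (2 ^ n * ℓ)) ⟩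
          (80 + (M + (M + (resolveCost σ (2 ^ n * ℓ) + 0)))) + (treeCost T K n + treeCost T K n)
            ≤⟨ treeCost-node n overhead ≤-refl ≤-refl ⟩
          treeCost T K (suc n) ∎
          where
          overhead : 80 + (M + (M + (resolveCost σ (2 ^ n * ℓ) + 0))) ≤ 2 ^ n * K
          overhead = begin
            80 + (M + (M + (resolveCost σ (2 ^ n * ℓ) + 0)))
              ≤⟨ +-mono-≤ (≤2^* n 80) (+-mono-≤ (≤2^* n M) (+-mono-≤ (≤2^* n M)
                   (+-monoˡ-≤ 0 (resolveCost-scale n σ ℓ)))) ⟩
            2 ^ n * 80 + (2 ^ n * M + (2 ^ n * M + (2 ^ n * resolveCost σ ℓ + 0)))
              ≡⟨ distribute (2 ^ n) 80 M (resolveCost σ ℓ) ⟩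
            2 ^ n * K ∎
            where
            distribute : ∀ e a M r → e * a + (e * M + (e * M + (e * r + 0))) ≡ e * (a + (M + (M + (r + 0))))
            distribute = solve-∀
        branch : Call buildF (encodeEdges (x ∷ xs) ∷ d ∷ f ∷ encodeClause ρ ∷ [])
                   (encodeMaybe (build k (x ∷ xs) ρ)) (treeCost T K (suc n))
        branch with does ((x , true) ∈ˡ? ρ) | mem true
        ... | true  | q = within {as = M ∷ treeCost T K n ∷ []} 80
          (≤-trans (≤-reflexive (sym (+-assoc 80 M (treeCost T K n + 0)))) (skip (80 + M) (+-monoʳ-≤ 80 (m≤m+n M _))))
          (case₁ʳ varʳ (case₁ʳ (callʳ (consʳ varʳ trueʳ ∷ʳ varʳ ∷ʳ []ʳ) q)
            (callʳ (varʳ ∷ʳ varʳ ∷ʳ varʳ ∷ʳ varʳ ∷ʳ []ʳ) (build-call xs ρ p′))))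
        ... | false | q with does ((x , false) ∈ˡ? ρ) | mem false
        ...   | true  | r = within {as = M ∷ M ∷ treeCost T K n ∷ []} 80
          (≤-trans (≤-reflexive (trans (cong (80 +_) (sym (+-assoc M M (treeCost T K n + 0)))) (sym (+-assoc 80 (M + M) (treeCost T K n + 0)))))
            (skip (80 + (M + M)) (+-monoʳ-≤ 80 (+-monoʳ-≤ M (m≤m+n M _)))))
          (case₁ʳ varʳ (case₀ʳ (callʳ (consʳ varʳ trueʳ ∷ʳ varʳ ∷ʳ []ʳ) q)
            (case₁ʳ (callʳ (consʳ varʳ nilʳ ∷ʳ varʳ ∷ʳ []ʳ) r)
              (callʳ (varʳ ∷ʳ varʳ ∷ʳ varʳ ∷ʳ varʳ ∷ʳ []ʳ) (build-call xs ρ p′)))))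
        ...   | false | r = within {as = M ∷ M ∷ treeCost T K n ∷ treeCost T K n ∷ resolveCost σ (2 ^ n * ℓ) ∷ []} 80 join
          (case₁ʳ varʳ (case₀ʳ (callʳ (consʳ varʳ trueʳ ∷ʳ varʳ ∷ʳ []ʳ) q)
            (case₀ʳ (callʳ (consʳ varʳ nilʳ ∷ʳ varʳ ∷ʳ []ʳ) r)
              (callʳ (varʳ ∷ʳ
                callʳ (varʳ ∷ʳ varʳ ∷ʳ varʳ ∷ʳ consʳ (consʳ varʳ trueʳ) varʳ ∷ʳ []ʳ)
                  (build-call xs ((x , true) ∷ ρ) p″) ∷ʳ
                callʳ (varʳ ∷ʳ varʳ ∷ʳ varʳ ∷ʳ consʳ (consʳ varʳ nilʳ) varʳ ∷ʳ []ʳ)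
                  (build-call xs ((x , false) ∷ ρ) p″) ∷ʳ []ʳ)
                (resolve-call x (Maybe.map proj₁ (build-small xs ((x , true) ∷ ρ)))
                  (Maybe.map proj₁ (build-small xs ((x , false) ∷ ρ))))))))

-- Running time of the greedy partition

four : ℕ → ℕ
four n = (n + n) + (n + n)

-- The bounds are listed in the order in which `greedyF` makes its calls, so that the list collected
-- along a run is this one by computation. Both outcomes of the comparison give the same list.
placeCosts : ℕ → ℕ → List ℕ
placeCosts σ B =
  interCost σ B B ∷ interCost σ B B ∷ appCost B ∷ appCost (B + B) ∷
  mulCost B B ∷ mulCost (four B) B ∷ appCost (B * B) ∷
  mulCost B B ∷ mulCost (four B) B ∷ appCost (B * B) ∷
  linear (B * B + four B * B) 20 ∷ appCost B ∷ appCost B ∷ appCost B ∷ []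

placeCost : ℕ → ℕ → ℕ
placeCost σ B = 150 + sum (placeCosts σ B)

module _ {m : ℕ} where

  private σ = literalSize m

  encodeCut : Cut {m} → 𝔻
  encodeCut (cut P Q Es Et Ec) = encodeEdges Ec ∙ encodeEdges Es ∙ encodeEdges Et

  length-place : ∀ W V (c : Cut {m}) →
                 length (Cut.P (place W V c)) + length (Cut.Q (place W V c)) ≡
                 length V + (length (Cut.P c) + length (Cut.Q c))
  length-place W V (cut P Q Es Et Ec)
    with shorter (copies (filter (_∈ᵉ? Q) V) W ++ copies ((V ++ V) ++ (V ++ V)) P)
                 (copies (filter (_∈ᵉ? P) V) W ++ copies ((V ++ V) ++ (V ++ V)) Q)
  ... | true  = trans (cong (_+ length Q) (length-++ V)) (+-assoc (length V) _ _)
  ... | false = trans (cong (length P +_) (length-++ V)) (shuffle (length P) (length V) (length Q))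
    where
    shuffle : ∀ p v q → p + (v + q) ≡ v + (p + q)
    shuffle = solve-∀

  greedy-call : ∀ {B} W I (c : Cut {m}) → length W ≤ B →
                (length (Cut.P c) + length (Cut.Q c)) + length (concat I) ≤ B →
                Call greedyF
                  (encodeList encodeEdges I ∷ encodeEdges W ∷ encodeEdges (Cut.P c) ∷ encodeEdges (Cut.Q c) ∷
                   encodeEdges (Cut.Es c) ∷ encodeEdges (Cut.Et c) ∷ encodeEdges (Cut.Ec c) ∷ [])
                  (encodeCut (greedy W I c)) (linear (length I) (placeCost σ B))
  greedy-call W [] (cut P Q Es Et Ec) _ _ = within {as = []} 20 (base≤ 20 0 (m≤m+n 20 _))
    (case₀ʳ varʳ (consʳ varʳ (consʳ varʳ varʳ)))
  greedy-call {B} W (V ∷ I) (cut P Q Es Et Ec) lenW lenPQ =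
    branch _ (weaken (linear-mono len₁ (≤-refl {20})) (leq-call (copies b W ++ copies u P) (copies a W ++ copies u Q)))
      (λ c → greedy-call W I c lenW)
      (≤-trans (≤-reflexive (trans (cong (_+ length (concat I)) (length-place W V (cut P Q Es Et Ec)))
        total)) lenPQ)
    where
    a = filter (_∈ᵉ? P) V
    b = filter (_∈ᵉ? Q) V
    u = (V ++ V) ++ (V ++ V)
    X = copies b W ++ copies u P
    Y = copies a W ++ copies u Q
    left right : Cut {m}
    left  = cut (V ++ P) Q (a ++ Es) Et (b ++ Ec)
    right = cut P (V ++ Q) Es (b ++ Et) (a ++ Ec)
    shuffle : ∀ p q v w → v + (p + q) + w ≡ (p + q) + (v + w)
    shuffle = solve-∀
    total : length V + (length P + length Q) + length (concat I) ≡ (length P + length Q) + length (V ++ concat I)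
    total = trans (shuffle (length P) (length Q) (length V) (length (concat I)))
              (cong (length P + length Q +_) (sym (length-++ V)))
    lenV : length V ≤ B
    lenV = ≤-trans (m≤m+n _ (length (concat I))) (≤-trans (≤-reflexive (sym (length-++ V)))
             (≤-trans (m≤n+m _ (length P + length Q)) lenPQ))
    lenP : length P ≤ B
    lenP = ≤-trans (m≤m+n _ (length Q)) (≤-trans (m≤m+n _ _) lenPQ)
    lenQ : length Q ≤ B
    lenQ = ≤-trans (m≤n+m _ (length P)) (≤-trans (m≤m+n _ _) lenPQ)
    lena : length a ≤ B
    lena = ≤-trans (length-filter _ V) lenV
    lenb : length b ≤ B
    lenb = ≤-trans (length-filter _ V) lenV
    lenVV : length (V ++ V) ≤ B + B
    lenVV = ≤-trans (≤-reflexive (length-++ V)) (+-mono-≤ lenV lenV)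
    lenu : length u ≤ four B
    lenu = ≤-trans (≤-reflexive (length-++ (V ++ V))) (+-mono-≤ lenVV lenVV)
    product : ∀ {i j} (x y : List (Fin m)) → length x ≤ i → length y ≤ j → length (copies x y) ≤ i * j
    product x y p q = ≤-trans (≤-reflexive (length-copies x y)) (*-mono-≤ p q)
    len₁ : length X ≤ B * B + four B * B
    len₁ = ≤-trans (≤-reflexive (length-++ (copies b W))) (+-mono-≤ (product b W lenb lenW) (product u P lenu lenP))
    inter : ∀ R → length R ≤ B → Call interF (encodeEdges V ∷ encodeEdges R ∷ []) (encodeEdges (filter (_∈ᵉ? R) V)) (interCost σ B B)
    inter R p = weaken (linear-mono lenV (+-monoʳ-≤ 20 (linear-mono p ≤-refl))) (inter-edges V R)
    app : ∀ {n} xs ys → length xs ≤ n → Call appF (encodeEdges xs ∷ encodeEdges ys ∷ []) (encodeEdges (xs ++ ys)) (appCost n)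
    app xs ys p = weaken (linear-mono p ≤-refl) (app-edges xs ys)
    mul : ∀ {i j} xs ys → length xs ≤ i → length ys ≤ j →
          Call mulF (encodeEdges xs ∷ encodeEdges ys ∷ []) (encodeEdges (copies xs ys)) (mulCost i j)
    mul xs ys p q = weaken (linear-mono p (+-monoʳ-≤ 20 (linear-mono q ≤-refl))) (mul-call xs ys)
    rest = linear (length I) (placeCost σ B)
    branch : ∀ t → Call leqF (encodeEdges X ∷ encodeEdges Y ∷ []) (encodeBool t) (linear (B * B + four B * B) 20) →
             (∀ c → (length (Cut.P c) + length (Cut.Q c)) + length (concat I) ≤ B →
              Call greedyF
                (encodeList encodeEdges I ∷ encodeEdges W ∷ encodeEdges (Cut.P c) ∷ encodeEdges (Cut.Q c) ∷
                 encodeEdges (Cut.Es c) ∷ encodeEdges (Cut.Et c) ∷ encodeEdges (Cut.Ec c) ∷ [])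
                (encodeCut (greedy W I c)) rest) →
             (let c = if t then left else right in (length (Cut.P c) + length (Cut.Q c)) + length (concat I) ≤ B) →
             Call greedyF
               (encodeList encodeEdges (V ∷ I) ∷ encodeEdges W ∷ encodeEdges P ∷ encodeEdges Q ∷
                encodeEdges Es ∷ encodeEdges Et ∷ encodeEdges Ec ∷ [])
               (encodeCut (greedy W I (if t then left else right))) (linear (suc (length I)) (placeCost σ B))
    branch false leq rec len = within {as = placeCosts σ B ++ rest ∷ []} 150 (steps≤ 150 (length I) (placeCosts σ B) ≤-refl)
      (case₁ʳ varʳ
        (letʳ (callʳ (varʳ ∷ʳ varʳ ∷ʳ []ʳ) (inter P lenP))
        (letʳ (callʳ (varʳ ∷ʳ varʳ ∷ʳ []ʳ) (inter Q lenQ))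
        (letʳ (callʳ (varʳ ∷ʳ varʳ ∷ʳ []ʳ) (app V V lenV))
        (letʳ (callʳ (varʳ ∷ʳ varʳ ∷ʳ []ʳ) (app (V ++ V) (V ++ V) lenVV))
        (case₀ʳ
          (callʳ
            (callʳ (callʳ (varʳ ∷ʳ varʳ ∷ʳ []ʳ) (mul b W lenb lenW) ∷ʳ
                    callʳ (varʳ ∷ʳ varʳ ∷ʳ []ʳ) (mul u P lenu lenP) ∷ʳ []ʳ)
              (app (copies b W) (copies u P) (product b W lenb lenW)) ∷ʳ
             callʳ (callʳ (varʳ ∷ʳ varʳ ∷ʳ []ʳ) (mul a W lena lenW) ∷ʳ
                    callʳ (varʳ ∷ʳ varʳ ∷ʳ []ʳ) (mul u Q lenu lenQ) ∷ʳ []ʳ)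
              (app (copies a W) (copies u Q) (product a W lena lenW)) ∷ʳ []ʳ)
            leq)
          (callʳ (varʳ ∷ʳ varʳ ∷ʳ varʳ ∷ʳ callʳ (varʳ ∷ʳ varʳ ∷ʳ []ʳ) (app V Q lenV) ∷ʳ
                  varʳ ∷ʳ callʳ (varʳ ∷ʳ varʳ ∷ʳ []ʳ) (app b Et lenb) ∷ʳ
                  callʳ (varʳ ∷ʳ varʳ ∷ʳ []ʳ) (app a Ec lena) ∷ʳ []ʳ)
            (rec right len))))))))
    branch true leq rec len = within {as = placeCosts σ B ++ rest ∷ []} 150 (steps≤ 150 (length I) (placeCosts σ B) ≤-refl)
      (case₁ʳ varʳ
        (letʳ (callʳ (varʳ ∷ʳ varʳ ∷ʳ []ʳ) (inter P lenP))
        (letʳ (callʳ (varʳ ∷ʳ varʳ ∷ʳ []ʳ) (inter Q lenQ))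
        (letʳ (callʳ (varʳ ∷ʳ varʳ ∷ʳ []ʳ) (app V V lenV))
        (letʳ (callʳ (varʳ ∷ʳ varʳ ∷ʳ []ʳ) (app (V ++ V) (V ++ V) lenVV))
        (case₁ʳ
          (callʳ
            (callʳ (callʳ (varʳ ∷ʳ varʳ ∷ʳ []ʳ) (mul b W lenb lenW) ∷ʳ
                    callʳ (varʳ ∷ʳ varʳ ∷ʳ []ʳ) (mul u P lenu lenP) ∷ʳ []ʳ)
              (app (copies b W) (copies u P) (product b W lenb lenW)) ∷ʳ
             callʳ (callʳ (varʳ ∷ʳ varʳ ∷ʳ []ʳ) (mul a W lena lenW) ∷ʳ
                    callʳ (varʳ ∷ʳ varʳ ∷ʳ []ʳ) (mul u Q lenu lenQ) ∷ʳ []ʳ)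
              (app (copies a W) (copies u Q) (product a W lena lenW)) ∷ʳ []ʳ)
            leq)
          (callʳ (varʳ ∷ʳ varʳ ∷ʳ callʳ (varʳ ∷ʳ varʳ ∷ʳ []ʳ) (app V P lenV) ∷ʳ varʳ ∷ʳ
                  callʳ (varʳ ∷ʳ varʳ ∷ʳ []ʳ) (app a Es lena) ∷ʳ varʳ ∷ʳ
                  callʳ (varʳ ∷ʳ varʳ ∷ʳ []ʳ) (app b Ec lenb) ∷ʳ []ʳ)
            (rec left len))))))))

opaque
  unfolding treeCost

  treeCost-mono : ∀ {u v K J n l} → u ≤ v → K ≤ J → n ≤ l → treeCost u K n ≤ treeCost v J l
  treeCost-mono p q r = *-mono-≤ (^-monoʳ-≤ 2 r) (+-mono-≤ p (*-mono-≤ r q))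

  -- Meant for the tree over the cut, whose leaves are themselves trees over a side: with `e` as
  -- `2 ^ S`, the two exponentials are collected in front of a polynomial.
  treeCost-bound : ∀ {e u v K J} n → u ≤ e * v → K ≤ e * J → treeCost u K n ≤ (2 ^ n * e) * (v + n * J)
  treeCost-bound {e} {u} {v} {K} {J} n p q = begin
    2 ^ n * (u + n * K)             ≤⟨ *-monoʳ-≤ (2 ^ n) (+-mono-≤ p (*-monoʳ-≤ n q)) ⟩
    2 ^ n * (e * v + n * (e * J))   ≡⟨ identity (2 ^ n) e v n J ⟩
    (2 ^ n * e) * (v + n * J)       ∎
    where
    open ≤-Reasoning
    identity : ∀ d e v n J → d * (e * v + n * (e * J)) ≡ (d * e) * (v + n * J)
    identity = solve-∀

  treeCost-≡ : ∀ u K n → treeCost u K n ≡ 2 ^ n * (u + n * K)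
  treeCost-≡ _ _ _ = refl

nodeCost-scale : ∀ n σ R ℓ → nodeCost σ R (2 ^ n * ℓ) ≤ 2 ^ n * nodeCost σ R ℓ
nodeCost-scale n σ R ℓ = begin
  80 + (M + (M + (resolveCost σ (2 ^ n * ℓ) + 0)))
    ≤⟨ +-mono-≤ (≤2^* n 80) (+-mono-≤ (≤2^* n M) (+-mono-≤ (≤2^* n M) (+-monoˡ-≤ 0 (resolveCost-scale n σ ℓ)))) ⟩
  2 ^ n * 80 + (2 ^ n * M + (2 ^ n * M + (2 ^ n * resolveCost σ ℓ + 0)))
    ≡⟨ distribute (2 ^ n) 80 M (resolveCost σ ℓ) ⟩
  2 ^ n * nodeCost σ R ℓ ∎
  where
  open ≤-Reasoning
  M = memCost σ R
  distribute : ∀ e a M r → e * a + (e * M + (e * M + (e * r + 0))) ≡ e * (a + (M + (M + (r + 0))))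
  distribute = solve-∀

nodeSize-scale : ∀ n σ ℓ → nodeSize σ (2 ^ n * ℓ) ≤ 2 ^ n * nodeSize σ ℓ
nodeSize-scale n σ ℓ = begin
  8 + σ + 2 ^ n * ℓ * suc σ               ≤⟨ +-monoˡ-≤ _ (≤2^* n (8 + σ)) ⟩
  2 ^ n * (8 + σ) + 2 ^ n * ℓ * suc σ     ≡⟨ cong (2 ^ n * (8 + σ) +_) (*-assoc (2 ^ n) ℓ (suc σ)) ⟩
  2 ^ n * (8 + σ) + 2 ^ n * (ℓ * suc σ)   ≡⟨ *-distribˡ-+ (2 ^ n) (8 + σ) (ℓ * suc σ) ⟨
  2 ^ n * nodeSize σ ℓ                    ∎
  where open ≤-Reasoning

relax : ∀ {n} {ρ : Vec 𝔻 n} {e v k as K} {k≤K : True (k ≤? K)} → Run ρ e v k as → Run ρ e v K as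
relax {as = as} {k≤K = k≤K} (run d p) = run d (≤-trans p (+-monoˡ-≤ (sum as) (toWitness k≤K)))

-- The search below the cut, and the whole run

leafCost : ℕ → ℕ → ℕ
leafCost σ Y = 20 + (findCost σ Y Y Y + 0)

leafSize : ℕ → ℕ → ℕ
leafSize σ Y = 3 + Y * suc σ

module _ {m : ℕ} where

  private σ = literalSize m

  length-items : ∀ (F : CNF m) → length (items F) ≤ length F
  length-items []             = z≤n
  length-items ([] ∷ F)       = m≤n⇒m≤1+n (length-items F)
  length-items ((l ∷ ls) ∷ F) with positive ls
  ... | true  = s≤s (length-items F)
  ... | false = m≤n⇒m≤1+n (length-items F)

  items-short : ∀ {L} {F : CNF m} → All (λ C → length C ≤ L) F → All (λ V → length V ≤ L) (items F)
  items-short [] = []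
  items-short {F = [] ∷ F} (p ∷ ps) = items-short ps
  items-short {F = (l ∷ ls) ∷ F} (p ∷ ps) with positive ls
  ... | true  = ≤-trans (≤-reflexive (cong suc (length-map proj₁ ls))) p ∷ items-short ps
  ... | false = items-short ps

  nonempties≤length : ∀ (F : CNF m) → nonempties F ≤ length F
  nonempties≤length []            = z≤n
  nonempties≤length ([] ∷ F)      = m≤n⇒m≤1+n (nonempties≤length F)
  nonempties≤length ((_ ∷ _) ∷ F) = s≤s (nonempties≤length F)

  Small-mono : ∀ {ℓ u n l} → n ≤ l → ∀ {π : ProofTree m} → Small ℓ u n π → Small ℓ u l π
  Small-mono {ℓ} {u} n≤l (p , q) =
    ≤-trans p (*-monoˡ-≤ ℓ (^-monoʳ-≤ 2 n≤l)) , ≤-trans q (treeCost-mono (≤-refl {u}) ≤-refl n≤l)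

  -- A finished tree over a side is treated as a leaf of the tree over the cut, with its bounds as
  -- the new bounds for leaves.
  Small-leaf : ∀ {ℓ u n} {π : ProofTree m} → Small ℓ u n π → Small (2 ^ n * ℓ) (treeCost u (nodeSize σ ℓ) n) 0 π
  Small-leaf (p , q) = ≤-trans p (≤-reflexive (sym (+-identityʳ _))) , ≤-trans q treeCost-zero

  module _ {Y : ℕ} {F : CNF m} (short : All (λ C → length C ≤ Y) F) where

    find-small : ∀ ρ → Maybe.All (Small Y (leafSize σ Y) 0) (find F ρ)
    find-small ρ = go F short
      where
      go : ∀ F → All (λ C → length C ≤ Y) F → Maybe.All (Small Y (leafSize σ Y) 0) (find F ρ)
      go []      []       = Maybe.nothing
      go (C ∷ F) (p ∷ ps) with does (all? (_∈ˡ? ρ) C)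
      ... | true  = Maybe.just
        ( ≤-trans p (≤-reflexive (sym (+-identityʳ Y)))
        , ≤-trans (s≤s (s≤s (≤-trans (size-encodeClause C) (s≤s (*-monoˡ-≤ (suc σ) p))))) treeCost-zero )
      ... | false = go F ps

    module _ (Es Et : List (Fin m)) (S : ℕ) (Es≤S : length Es ≤ S) (Et≤S : length Et ≤ S) where

      searchSize : ℕ
      searchSize = treeCost (leafSize σ Y) (nodeSize σ Y) S

      search-small : ∀ ρ → Maybe.All (Small (2 ^ S * Y) searchSize 0) (search F Es Et ρ)
      search-small ρ with build (find F) Es ρ | build-small {ℓ = Y} {u = leafSize σ Y} find-small Es ρ
      ... | just π  | Maybe.just p  = Maybe.just (Small-leaf (Small-mono Es≤S p))
      ... | nothing | Maybe.nothing =
        Maybe.map (λ p → Small-leaf (Small-mono Et≤S p)) (build-small {ℓ = Y} {u = leafSize σ Y} find-small Et ρ)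

      private
        inner = treeCost (leafCost σ Y) (nodeCost σ Y Y) S

      searchCost : ℕ
      searchCost = 40 + (inner + (inner + 0))

      module _ (len : length F ≤ Y) {R : ℕ} (R+S≤Y : R + S ≤ Y) where

        leaf-call : ∀ ρ → length ρ ≤ Y →
          Call buildF (nil ∷ nil ∷ encodeCNF F ∷ encodeClause ρ ∷ []) (encodeMaybe (find F ρ)) (leafCost σ Y)
        leaf-call ρ p = within {as = findCost σ Y Y Y ∷ []} 20 ≤-refl
          (case₀ʳ varʳ (case₀ʳ varʳ (callʳ (varʳ ∷ʳ varʳ ∷ʳ []ʳ)
            (weaken (linear-mono len ≤-refl) (find-call F short ρ p)))))

        inner-call : ∀ E → length E ≤ S → ∀ ρ → length ρ ≤ R →
          Call buildF (encodeEdges E ∷ nil ∷ encodeCNF F ∷ encodeClause ρ ∷ [])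
            (encodeMaybe (build (find F) E ρ)) inner
        inner-call E p ρ q = weaken (treeCost-mono (≤-refl {leafCost σ Y}) ≤-refl p)
          (build-call find-small leaf-call E ρ (≤-trans (+-mono-≤ q p) R+S≤Y))

        search-call : ∀ ρ → length ρ ≤ R →
          Call buildF (nil ∷ (encodeEdges Es ∙ encodeEdges Et) ∷ encodeCNF F ∷ encodeClause ρ ∷ [])
            (encodeMaybe (search F Es Et ρ)) searchCost
        search-call ρ p = try (build (find F) Es ρ) (inner-call Es Es≤S ρ p)
          where
          try : ∀ M → Call buildF (encodeEdges Es ∷ nil ∷ encodeCNF F ∷ encodeClause ρ ∷ []) (encodeMaybe M) inner →
                Call buildF (nil ∷ (encodeEdges Es ∙ encodeEdges Et) ∷ encodeCNF F ∷ encodeClause ρ ∷ [])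
                  (encodeMaybe (M <∣> build (find F) Et ρ)) searchCost
          try nothing  q = within {as = inner ∷ inner ∷ []} 40 ≤-refl
            (case₀ʳ varʳ (case₁ʳ varʳ (case₀ʳ (callʳ (varʳ ∷ʳ nilʳ ∷ʳ varʳ ∷ʳ varʳ ∷ʳ []ʳ) q)
              (callʳ (varʳ ∷ʳ nilʳ ∷ʳ varʳ ∷ʳ varʳ ∷ʳ []ʳ) (inner-call Et Et≤S ρ p)))))
          try (just π) q = within {as = inner ∷ []} 40 (+-monoʳ-≤ 40 (+-monoʳ-≤ inner z≤n))
            (case₀ʳ varʳ (case₁ʳ varʳ (caseTreeʳ π (callʳ (varʳ ∷ʳ nilʳ ∷ʳ varʳ ∷ʳ varʳ ∷ʳ []ʳ) q)
              λ eq → subst (λ v → Run _ _ v 3 []) (sym eq) (consʳ varʳ varʳ))))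

  initialCut : Cut {m}
  initialCut = cut [] [] [] [] []

  greedyCut : CNF m → Cut {m}
  greedyCut F = greedy (concat (items F)) (items F) initialCut

  refute : CNF m → Maybe (ProofTree m)
  refute F = let cut _ _ Es Et Ec = greedyCut F in build (search F Es Et) Ec []

  module _ {Y : ℕ} {F : CNF m} (short : All (λ C → length C ≤ Y) F) (len : length F ≤ Y)
           (ends≤Y : length (concat (items F)) ≤ Y) where

    open Cut (greedyCut F)

    module _ {S : ℕ} (Es≤S : length Es ≤ S) (Et≤S : length Et ≤ S) (height≤Y : length Ec + S ≤ Y) where

      refute-small : Maybe.All (Small (2 ^ S * Y) (searchSize short Es Et S Es≤S Et≤S) (length Ec)) (refute F)
      refute-small = build-small (search-small short Es Et S Es≤S Et≤S) Ec []

      refuteCost : ℕ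
      refuteCost = treeCost (searchCost short Es Et S Es≤S Et≤S) (nodeCost σ (length Ec) (2 ^ S * Y)) (length Ec)

      refute-call : Call buildF (encodeEdges Ec ∷ (encodeEdges Es ∙ encodeEdges Et) ∷ encodeCNF F ∷ nil ∷ [])
                      (encodeMaybe (refute F)) refuteCost
      refute-call = build-call (search-small short Es Et S Es≤S Et≤S)
        (search-call short Es Et S Es≤S Et≤S len height≤Y) Ec [] ≤-refl

      mainCosts : List ℕ
      mainCosts = linear Y 20 ∷ itemsCost Y Y ∷ concatCost Y Y ∷ linear Y (placeCost σ Y) ∷ refuteCost ∷ []

      main-run : hasEmpty F ≡ false → Run (encodeCNF F ∷ []) (Program.main program) (encodeMaybe (refute F)) 30 mainCosts
      main-run eq = relax (case₀ʳ (callʳ (varʳ ∷ʳ []ʳ) (weaken (linear-mono (≤-trans (nonempties≤length F) len) (≤-refl {20}))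
          (subst (λ b → Call emptyF (encodeCNF F ∷ []) (encodeBool b) (linear (nonempties F) 20)) eq (empty-call F))))
        (letʳ (callʳ (varʳ ∷ʳ []ʳ) (weaken (linear-mono len ≤-refl) (items-call F short)))
        (letʳ (callʳ (varʳ ∷ʳ []ʳ) (weaken (linear-mono items≤Y ≤-refl) (concat-call (items F) (items-short short))))
        (case₁ʳ
          (callʳ (varʳ ∷ʳ varʳ ∷ʳ nilʳ ∷ʳ nilʳ ∷ʳ nilʳ ∷ʳ nilʳ ∷ʳ nilʳ ∷ʳ []ʳ)
            (weaken (linear-mono items≤Y ≤-refl) (greedy-call (concat (items F)) (items F) initialCut ends≤Y ends≤Y)))
          (callʳ (varʳ ∷ʳ varʳ ∷ʳ varʳ ∷ʳ nilʳ ∷ʳ []ʳ) refute-call)))))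
        where
        items≤Y : length (items F) ≤ Y
        items≤Y = ≤-trans (length-items F) len

-- A polynomial bound on everything but the number of leaves

mainPoly : ℕ → ℕ → ℕ
mainPoly σ Y =
  (30 + (linear Y 20 + (itemsCost Y Y + (concatCost Y Y + linear Y (placeCost σ Y))))) +
  ((40 + ((leafCost σ Y + Y * nodeCost σ Y Y) + (leafCost σ Y + Y * nodeCost σ Y Y)) + Y * nodeCost σ Y Y) +
   ((leafSize σ Y + Y * nodeSize σ Y) + Y * nodeSize σ Y))

-- Bounds of the form `Y ^ i` compose along the shape of an expression: a product adds the
-- exponents, a sum costs one extra factor because 2 ≤ `Y`, and the numerals that occur are at most
-- 200. No exponent has to be written down.
module Degree {Y : ℕ} (200≤Y : 200 ≤ Y) where

  instance
    Y-nonZero : NonZero Y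
    Y-nonZero = >-nonZero (≤-trans (s≤s z≤n) 200≤Y)

  record _≤Y^_ (a i : ℕ) : Set where
    constructor bound
    field ≤^ : a ≤ Y ^ i

  open _≤Y^_ public

  infix  4 _≤Y^_
  infixl 6 _⊕_
  infixl 7 _⊗_

  private
    2≤Y : 2 ≤ Y
    2≤Y = ≤-trans (s≤s (s≤s z≤n)) 200≤Y

  atom : ∀ {a} → a ≤ Y → a ≤Y^ 1
  atom p = bound (≤-trans p (≤-reflexive (sym (*-identityʳ Y))))

  numeral : ∀ n {n≤200 : True (n ≤? 200)} → n ≤Y^ 1
  numeral n {p} = atom (≤-trans (toWitness p) 200≤Y)

  _⊕_ : ∀ {a b i j} → a ≤Y^ i → b ≤Y^ j → a + b ≤Y^ suc (i ⊔ j)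
  _⊕_ {a} {b} {i} {j} (bound p) (bound q) = bound (begin
    a + b                     ≤⟨ +-mono-≤ (≤-trans p (^-monoʳ-≤ Y (m≤m⊔n i j))) (≤-trans q (^-monoʳ-≤ Y (m≤n⊔m i j))) ⟩
    Y ^ (i ⊔ j) + Y ^ (i ⊔ j) ≡⟨ cong (Y ^ (i ⊔ j) +_) (+-identityʳ _) ⟨
    2 * Y ^ (i ⊔ j)           ≤⟨ *-monoˡ-≤ (Y ^ (i ⊔ j)) 2≤Y ⟩
    Y ^ suc (i ⊔ j)           ∎)
    where open ≤-Reasoning

  _⊗_ : ∀ {a b i j} → a ≤Y^ i → b ≤Y^ j → a * b ≤Y^ (i + j)
  _⊗_ {i = i} {j} (bound p) (bound q) = bound (≤-trans (*-mono-≤ p q) (≤-reflexive (sym (^-distribˡ-+-* Y i j))))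

  zero⊕ : ∀ {a i} → a ≤Y^ i → a + 0 ≤Y^ i
  zero⊕ (bound p) = bound (≤-trans (≤-reflexive (+-identityʳ _)) p)

  opaque
    unfolding linear

    linear-degree : ∀ {n a i j} → n ≤Y^ i → a ≤Y^ j → linear n a ≤Y^ (suc (1 ⊔ i) + j)
    linear-degree p q = (numeral 1 ⊕ p) ⊗ q

  module _ {σ : ℕ} (σ≤Y : σ ≤ Y) where

    private
      Y¹ = atom (≤-refl {Y})
      σ¹ = atom σ≤Y
      lin20 = λ {n} {i} (p : n ≤Y^ i) → linear-degree p (numeral 20)
      mem = linear-degree Y¹ (numeral 20 ⊕ σ¹ ⊗ numeral 20)
      inter = linear-degree Y¹ (numeral 20 ⊕ mem)
      item = linear-degree Y¹ (numeral 20 ⊕ (lin20 Y¹ ⊕ zero⊕ (lin20 Y¹)))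
      concat′ = linear-degree Y¹ (numeral 20 ⊕ lin20 Y¹)
      2Y = Y¹ ⊕ Y¹
      4Y = 2Y ⊕ 2Y
      YY = Y¹ ⊗ Y¹
      mul = linear-degree Y¹ (numeral 20 ⊕ lin20 Y¹)
      mul4 = linear-degree 4Y (numeral 20 ⊕ lin20 Y¹)
      place′ = numeral 150 ⊕ (inter ⊕ (inter ⊕ (lin20 Y¹ ⊕ (lin20 2Y ⊕ (mul ⊕ (mul4 ⊕ (lin20 YY ⊕
               (mul ⊕ (mul4 ⊕ (lin20 YY ⊕ (lin20 (YY ⊕ 4Y ⊗ Y¹) ⊕ (lin20 Y¹ ⊕ (lin20 Y¹ ⊕ zero⊕ (lin20 Y¹))))))))))))))
      find′ = linear-degree Y¹ (numeral 20 ⊕ inter)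
      leafC = numeral 20 ⊕ zero⊕ find′
      resolve′ = numeral 100 ⊕ (mem ⊕ (mem ⊕ (mem ⊕ (mem ⊕ zero⊕ (lin20 Y¹)))))
      node′ = numeral 80 ⊕ (mem ⊕ (mem ⊕ zero⊕ resolve′))
      leafS = numeral 3 ⊕ Y¹ ⊗ (numeral 1 ⊕ σ¹)
      nodeS = (numeral 8 ⊕ σ¹) ⊕ Y¹ ⊗ (numeral 1 ⊕ σ¹)

    mainPoly-degree : mainPoly σ Y ≤Y^ _
    mainPoly-degree =
      (numeral 30 ⊕ (lin20 Y¹ ⊕ (item ⊕ (concat′ ⊕ linear-degree Y¹ place′)))) ⊕
      ((numeral 40 ⊕ ((leafC ⊕ Y¹ ⊗ node′) ⊕ (leafC ⊕ Y¹ ⊗ node′)) ⊕ Y¹ ⊗ node′) ⊕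
       ((leafS ⊕ Y¹ ⊗ nodeS) ⊕ Y¹ ⊗ nodeS))

-- The witness is inferred from `mainPoly-degree`. The order of the quantifiers makes it independent
-- of `σ` and `Y`.
mainDegree : ∃[ k ] ∀ {σ Y} (200≤Y : 200 ≤ Y) → σ ≤ Y → Degree._≤Y^_ 200≤Y (mainPoly σ Y) k
mainDegree = _ , λ {σ} p q → Degree.mainPoly-degree p {σ} q

opaque
  -- Only the existence of a fixed exponent matters. Being opaque, it stays a symbol in the
  -- arithmetic below.
  exponent : ℕ
  exponent = proj₁ mainDegree

  mainPoly≤ : ∀ {σ Y} → 200 ≤ Y → σ ≤ Y → mainPoly σ Y ≤ Y ^ exponent
  mainPoly≤ p q = Degree._≤Y^_.≤^ (proj₂ mainDegree p q)

module _ {m : ℕ} where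

  private σ = literalSize m

  empty-produces : ∀ {Y} (F : CNF m) → hasEmpty F ≡ true → nonempties F ≤ Y →
                   Produces encodeTree {m} (leaf []) from (program , encodeCNF F) within mainPoly σ Y
  empty-produces {Y} F eq p = fits (case₁ʳ (callʳ (varʳ ∷ʳ []ʳ) (weaken (linear-mono p (≤-refl {20}))
      (subst (λ b → Call emptyF (encodeCNF F ∷ []) (encodeBool b) (linear (nonempties F) 20)) eq (empty-call F))))
    (consʳ nilʳ nilʳ))
    where
    open ≤-Reasoning
    -- The summand 3 is the size of the output `nil ∙ nil`.
    bound : ∀ {s} → s ≤ 6 + (linear Y 20 + 0) → s + 3 ≤ mainPoly σ Y
    bound {s} q = begin
      s + 3                          ≤⟨ +-monoˡ-≤ 3 q ⟩
      (6 + (linear Y 20 + 0)) + 3    ≡⟨ shift (linear Y 20) ⟩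
      9 + linear Y 20                ≤⟨ +-monoˡ-≤ (linear Y 20) (m≤m+n 9 21) ⟩
      30 + linear Y 20               ≤⟨ +-monoʳ-≤ 30 (m≤m+n (linear Y 20) _) ⟩
      30 + (linear Y 20 + (itemsCost Y Y + (concatCost Y Y + linear Y (placeCost σ Y)))) ≤⟨ m≤m+n _ _ ⟩
      mainPoly σ Y                   ∎
      where
      shift : ∀ l → (6 + (l + 0)) + 3 ≡ 9 + l
      shift = solve-∀
    fits : Run (encodeCNF F ∷ []) (Program.main program) (nil ∙ nil) _ _ →
           Produces encodeTree {m} (leaf []) from (program , encodeCNF F) within mainPoly σ Y
    fits (run d q) = _ , d , bound q

  module _ {Y : ℕ} {F : CNF m} (short : All (λ C → length C ≤ Y) F) (len : length F ≤ Y)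
           (ends≤Y : length (concat (items F)) ≤ Y) where

    open Cut (greedyCut F)

    refute-produces : ∀ {S π} → length Es ≤ S → length Et ≤ S → length Ec + S ≤ Y → hasEmpty F ≡ false →
                      refute F ≡ just π →
                      Produces encodeTree π from (program , encodeCNF F) within (2 ^ (length Ec + S) * mainPoly σ Y)
    refute-produces {S} {π} Es≤S Et≤S height≤Y nonempty eq =
      fits (main-run short len ends≤Y Es≤S Et≤S height≤Y nonempty)
           (refute-small short len ends≤Y Es≤S Et≤S height≤Y) eq
      where
      open ≤-Reasoning
      c = length Ec
      E = 2 ^ c * 2 ^ S
      A = leafCost σ Y
      K = nodeCost σ Y Y
      S≤Y : S ≤ Y
      S≤Y = ≤-trans (m≤n+m S c) height≤Y
      c≤Y : c ≤ Y
      c≤Y = ≤-trans (m≤m+n c S) height≤Y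
      inner = treeCost A K S
      inner≤ : inner ≤ 2 ^ S * (A + Y * K)
      inner≤ = ≤-trans (≤-reflexive (treeCost-≡ A K S)) (*-monoʳ-≤ (2 ^ S) (+-monoʳ-≤ A (*-monoˡ-≤ K S≤Y)))
      front = linear Y 20 + (itemsCost Y Y + (concatCost Y Y + linear Y (placeCost σ Y)))
      searchPoly = 40 + ((A + Y * K) + (A + Y * K))
      outer = refuteCost short len ends≤Y Es≤S Et≤S height≤Y
      outer≤ : outer ≤ E * (searchPoly + Y * K)
      outer≤ = ≤-trans (treeCost-bound {2 ^ S} {J = K} c search≤ node≤)
        (*-monoʳ-≤ E (+-monoʳ-≤ searchPoly (*-monoˡ-≤ K c≤Y)))
        where
        search≤ : 40 + (inner + (inner + 0)) ≤ 2 ^ S * searchPoly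
        search≤ = begin
          40 + (inner + (inner + 0))
            ≤⟨ +-mono-≤ (≤2^* S 40) (+-mono-≤ inner≤ (+-monoˡ-≤ 0 inner≤)) ⟩
          2 ^ S * 40 + (2 ^ S * (A + Y * K) + (2 ^ S * (A + Y * K) + 0))
            ≡⟨ distribute (2 ^ S) 40 (A + Y * K) ⟩
          2 ^ S * searchPoly ∎
          where
          distribute : ∀ e n a → e * n + (e * a + (e * a + 0)) ≡ e * (n + (a + a))
          distribute = solve-∀
        node≤ : nodeCost σ c (2 ^ S * Y) ≤ 2 ^ S * K
        node≤ = ≤-trans (nodeCost-scale S σ c Y) (*-monoʳ-≤ (2 ^ S)
          (+-monoʳ-≤ 80 (+-mono-≤ mem≤ (+-monoˡ-≤ _ mem≤))))
          where
          mem≤ : memCost σ c ≤ memCost σ Y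
          mem≤ = linear-mono c≤Y ≤-refl
      κ = nodeSize σ Y
      sizePoly = (leafSize σ Y + Y * κ) + Y * κ
      size≤ : treeCost (treeCost (leafSize σ Y) κ S) (nodeSize σ (2 ^ S * Y)) c ≤ E * sizePoly
      size≤ = ≤-trans (treeCost-bound {2 ^ S} {J = κ} c
          (≤-trans (≤-reflexive (treeCost-≡ (leafSize σ Y) κ S)) (*-monoʳ-≤ (2 ^ S) (+-monoʳ-≤ (leafSize σ Y) (*-monoˡ-≤ κ S≤Y))))
          (nodeSize-scale S σ Y))
        (*-monoʳ-≤ E (+-monoʳ-≤ (leafSize σ Y + Y * κ) (*-monoˡ-≤ κ c≤Y)))
      total : ∀ {s n} → s ≤ 30 + sum (mainCosts short len ends≤Y Es≤S Et≤S height≤Y) → n ≤ E * sizePoly →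
              s + n ≤ 2 ^ (c + S) * mainPoly σ Y
      total {s} {n} p q = begin
        s + n
          ≤⟨ +-mono-≤ p q ⟩
        (30 + (linear Y 20 + (itemsCost Y Y + (concatCost Y Y + (linear Y (placeCost σ Y) + (outer + 0)))))) + E * sizePoly
          ≡⟨ cong (_+ E * sizePoly) (regroup 30 (linear Y 20) (itemsCost Y Y) (concatCost Y Y) (linear Y (placeCost σ Y)) outer) ⟩
        ((30 + front) + outer) + E * sizePoly
          ≤⟨ +-monoˡ-≤ (E * sizePoly) (+-mono-≤ front≤ outer≤) ⟩
        (E * (30 + front) + E * (searchPoly + Y * K)) + E * sizePoly
          ≡⟨ distribute E (30 + front) (searchPoly + Y * K) sizePoly ⟩
        E * mainPoly σ Y
          ≡⟨ cong (_* mainPoly σ Y) (^-distribˡ-+-* 2 c S) ⟨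
        2 ^ (c + S) * mainPoly σ Y ∎
        where
        regroup : ∀ n a b c d o → n + (a + (b + (c + (d + (o + 0))))) ≡ (n + (a + (b + (c + d)))) + o
        regroup = solve-∀
        distribute : ∀ e a b c → (e * a + e * b) + e * c ≡ e * (a + (b + c))
        distribute = solve-∀
        front≤ : 30 + front ≤ E * (30 + front)
        front≤ = ≤-trans (≤2^* (c + S) (30 + front)) (≤-reflexive (cong (_* (30 + front)) (^-distribˡ-+-* 2 c S)))
      fits : ∀ {M} → Run (encodeCNF F ∷ []) (Program.main program) (encodeMaybe M) 30
                      (mainCosts short len ends≤Y Es≤S Et≤S height≤Y) →
             Maybe.All (Small (2 ^ S * Y) (searchSize short Es Et S Es≤S Et≤S) c) M → M ≡ just π →
             Produces encodeTree π from (program , encodeCNF F) within (2 ^ (c + S) * mainPoly σ Y)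
      fits (run d p) (Maybe.just (_ , q)) refl = _ , d , total p (≤-trans q size≤)

-- Handshaking

module Handshake {a ℓ} (M : CommutativeMonoid a ℓ) where

  open CommutativeMonoid M using (_≈_; ε; assoc; identityˡ; identityʳ; ∙-cong; ∙-congˡ; setoid)
    renaming (Carrier to A; _∙_ to _⊹_; refl to ≈-refl; sym to ≈-sym; trans to ≈-trans)
  open MonoidSum M using () renaming (sum to ∑; sum-cong-≋ to ∑-cong; ∑-distrib-+ to ∑-distrib; ∑-comm to ∑-swap) public
  import Relation.Binary.Reasoning.Setoid setoid as ≈-Reasoning

  fold : ∀ {B : Set} → List B → (B → A) → A
  fold L f = foldr _⊹_ ε (map f L)

  when : Bool → A → A
  when b x = if b then x else ε

  fold-++ : ∀ {B : Set} (K L : List B) f → fold (K ++ L) f ≈ fold K f ⊹ fold L f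
  fold-++ []      L f = ≈-sym (identityˡ _)
  fold-++ (x ∷ K) L f = ≈-trans (∙-congˡ (fold-++ K L f)) (≈-sym (assoc _ _ _))

  fold-concatMap : ∀ {B C : Set} (h : B → List C) L f → fold (concatMap h L) f ≈ fold L (λ v → fold (h v) f)
  fold-concatMap h []      f = ≈-refl
  fold-concatMap h (x ∷ L) f = ≈-trans (fold-++ (h x) (concatMap h L) f) (∙-congˡ (fold-concatMap h L f))

  fold-filter-tabulate : ∀ {B : Set} {p} {P : B → Set p} (P? : ∀ b → Dec (P b)) f {n} (g : Fin n → B) →
                         fold (filter P? (tabulate g)) f ≈ ∑ (λ i → when (does (P? (g i))) (f (g i)))
  fold-filter-tabulate P? f {zero}  g = ≈-refl
  fold-filter-tabulate P? f {suc n} g with does (P? (g zero))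
  ... | true  = ∙-congˡ (fold-filter-tabulate P? f (g ∘ suc))
  ... | false = ≈-trans (fold-filter-tabulate P? f (g ∘ suc)) (≈-sym (identityˡ _))

  fold-tabulate : ∀ {B : Set} f {n} (g : Fin n → B) → fold (tabulate g) f ≈ ∑ (λ i → f (g i))
  fold-tabulate f {zero}  g = ≈-refl
  fold-tabulate f {suc n} g = ∙-congˡ (fold-tabulate f (g ∘ suc))

  ∑-ε : ∀ n → ∑ {n} (λ _ → ε) ≈ ε
  ∑-ε zero    = ≈-refl
  ∑-ε (suc n) = ≈-trans (identityˡ _) (∑-ε n)

  ∑-single : ∀ {n} (j : Fin n) (f : Fin n → A) → ∑ (λ i → when (does (j ≟ᶠ i)) (f i)) ≈ f j
  ∑-single {suc n} zero    f = ≈-trans (∙-congˡ (∑-ε n)) (identityʳ _)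
  ∑-single {suc n} (suc j) f = ≈-trans (identityˡ _) (∑-single j (f ∘ suc))

  module _ (G : Graph) where
    open Graph G

    when-∋ : ∀ e v x → when (does (e ∋? v)) x ≈
                       when (does (proj₁ (ends e) ≟ᶠ v)) x ⊹ when (does (proj₂ (ends e) ≟ᶠ v)) x
    when-∋ e v x with proj₁ (ends e) ≟ᶠ v | proj₂ (ends e) ≟ᶠ v
    -- There are no loops, as the ends of an edge are strictly ordered.
    ... | yes p | yes q = ⊥-elim (<ᶠ⇒≢ (ordered e) (trans p (sym q)))
    ... | yes _ | no  _ = ≈-sym (identityʳ x)
    ... | no  _ | yes _ = ≈-sym (identityˡ x)
    ... | no  _ | no  _ = ≈-sym (identityˡ ε)

    -- Exchanging the sums over vertices and edges leaves each edge with its two ends. Over the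
    -- natural numbers this gives multiplicities and lengths; over `xor` the two terms cancel, which
    -- makes odd charges unsatisfiable.
    handshake : ∀ f → fold (concatMap incident (allFin n)) f ≈ ∑ (λ e → f e ⊹ f e)
    handshake f = begin
      fold (concatMap incident (allFin n)) f        ≈⟨ fold-concatMap incident (allFin n) f ⟩
      fold (allFin n) (λ v → fold (incident v) f)   ≈⟨ fold-tabulate (λ v → fold (incident v) f) id ⟩
      ∑ (λ v → fold (incident v) f)                 ≈⟨ ∑-cong (λ v → fold-filter-tabulate (_∋? v) f id) ⟩
      ∑ (λ v → ∑ (λ e → when (does (e ∋? v)) (f e)))  ≈⟨ ∑-swap (λ v e → when (does (e ∋? v)) (f e)) ⟩
      ∑ (λ e → ∑ (λ v → when (does (e ∋? v)) (f e)))  ≈⟨ ∑-cong twice ⟩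
      ∑ (λ e → f e ⊹ f e) ∎
      where
      open ≈-Reasoning
      twice : ∀ e → ∑ (λ v → when (does (e ∋? v)) (f e)) ≈ f e ⊹ f e
      twice e = begin
        ∑ (λ v → when (does (e ∋? v)) (f e))
          ≈⟨ ∑-cong (λ v → when-∋ e v (f e)) ⟩
        ∑ (λ v → when (does (proj₁ (ends e) ≟ᶠ v)) (f e) ⊹ when (does (proj₂ (ends e) ≟ᶠ v)) (f e))
          ≈⟨ ∑-distrib (λ v → when (does (proj₁ (ends e) ≟ᶠ v)) (f e)) (λ v → when (does (proj₂ (ends e) ≟ᶠ v)) (f e)) ⟩
        ∑ (λ v → when (does (proj₁ (ends e) ≟ᶠ v)) (f e)) ⊹ ∑ (λ v → when (does (proj₂ (ends e) ≟ᶠ v)) (f e))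
          ≈⟨ ∙-cong (∑-single (proj₁ (ends e)) (λ _ → f e)) (∑-single (proj₂ (ends e)) (λ _ → f e)) ⟩
        f e ⊹ f e ∎

-- Multiplicities of edges in lists

module ℕ-Handshake = Handshake +-0-commutativeMonoid
open ℕ-Handshake using (∑; ∑-cong; ∑-distrib; ∑-single; fold-++)

∑-1 : ∀ m → ∑ {m} (λ _ → 1) ≡ m
∑-1 zero    = refl
∑-1 (suc m) = cong suc (∑-1 m)

module _ {m : ℕ} where

  indicator : Fin m → Fin m → ℕ
  indicator x y = if does (x ≟ᶠ y) then 1 else 0

  count : Fin m → List (Fin m) → ℕ
  count x L = ℕ-Handshake.fold L (indicator x)

  count-++ : ∀ x K L → count x (K ++ L) ≡ count x K + count x L
  count-++ x K L = fold-++ K L (indicator x)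

  ∑-indicator : ∀ y → ∑ (λ x → indicator x y) ≡ 1
  ∑-indicator y = trans (∑-cong flip) (∑-single y (λ _ → 1))
    where
    flip : ∀ x → indicator x y ≡ indicator y x
    flip x = cong (if_then 1 else 0) (does-⇔ (mk⇔ sym sym) (x ≟ᶠ y) (y ≟ᶠ x))

  -- Through this identity, pointwise facts on multiplicities become facts on lengths.
  length-∑ : ∀ L → length L ≡ ∑ (λ x → count x L)
  length-∑ []      = sym (ℕ-Handshake.∑-ε m)
  length-∑ (y ∷ L) = sym (trans (∑-distrib (λ x → indicator x y) (λ x → count x L))
                            (cong₂ _+_ (∑-indicator y) (sym (length-∑ L))))

  ∈⇒count : ∀ {x L} → x ∈ L → 1 ≤ count x L
  ∈⇒count {x} {y ∷ L} (here p) with x ≟ᶠ y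
  ... | yes _ = s≤s z≤n
  ... | no ¬p = ⊥-elim (¬p p)
  ∈⇒count {x} {y ∷ L} (there p) = ≤-trans (∈⇒count p) (m≤n+m _ (indicator x y))

  count⇒∈ : ∀ {x L} → 1 ≤ count x L → x ∈ L
  count⇒∈ {x} {y ∷ L} p with x ≟ᶠ y
  ... | yes eq = here eq
  ... | no _   = there (count⇒∈ p)

  gate : ℕ → ℕ → ℕ
  gate zero    v = 0
  gate (suc _) v = v

  gate-+ : ∀ p v w → gate p (v + w) ≡ gate p v + gate p w
  gate-+ zero    v w = refl
  gate-+ (suc p) v w = refl

  -- Whether `x` is in `P` depends only on whether its multiplicity there is zero. So the
  -- bookkeeping of the greedy algorithm becomes arithmetic with the multiplicities of a single
  -- edge.
  count-filter : ∀ x P V → count x (filter (_∈ᵉ? P) V) ≡ gate (count x P) (count x V)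
  count-filter x P [] with count x P
  ... | zero  = refl
  ... | suc _ = refl
  count-filter x P (y ∷ V) = trans (step (y ∈ᵉ? P)) (sym (gate-+ (count x P) (indicator x y) (count x V)))
    where
    rest = count-filter x P V
    member : y ∈ P → indicator x y ≡ gate (count x P) (indicator x y)
    member y∈P with x ≟ᶠ y
    member y∈P | no  _    with count x P
    ... | zero  = refl
    ... | suc _ = refl
    member y∈P | yes refl with count x P | ∈⇒count y∈P
    ... | suc _ | _ = refl
    nonmember : ¬ (y ∈ P) → 0 ≡ gate (count x P) (indicator x y)
    nonmember y∉P with x ≟ᶠ y
    nonmember y∉P | no  _    with count x P
    ... | zero  = refl
    ... | suc _ = refl
    nonmember y∉P | yes refl with count x P in eq
    ... | zero  = refl
    ... | suc _ = ⊥-elim (y∉P (count⇒∈ (≤-trans (s≤s z≤n) (≤-reflexive (sym eq)))))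
    step : Dec (y ∈ P) → count x (filter (_∈ᵉ? P) (y ∷ V)) ≡
           gate (count x P) (indicator x y) + gate (count x P) (count x V)
    step (yes y∈P) = trans (cong (count x) (filter-accept (_∈ᵉ? P) y∈P)) (cong₂ _+_ (member y∈P) rest)
    step (no  y∉P) = trans (cong (count x) (filter-reject (_∈ᵉ? P) y∉P)) (cong₂ _+_ (nonmember y∉P) rest)

-- The greedy cut

  data Placed (W V : List (Fin m)) : Cut {m} → Cut {m} → Set where
    left  : ∀ {P Q Es Et Ec} → let a = filter (_∈ᵉ? P) V ; b = filter (_∈ᵉ? Q) V ; u = (V ++ V) ++ (V ++ V) in
            length (copies b W ++ copies u P) ≤ length (copies a W ++ copies u Q) →
            Placed W V (cut P Q Es Et Ec) (cut (V ++ P) Q (a ++ Es) Et (b ++ Ec))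
    right : ∀ {P Q Es Et Ec} → let a = filter (_∈ᵉ? P) V ; b = filter (_∈ᵉ? Q) V ; u = (V ++ V) ++ (V ++ V) in
            length (copies a W ++ copies u Q) ≤ length (copies b W ++ copies u P) →
            Placed W V (cut P Q Es Et Ec) (cut P (V ++ Q) Es (b ++ Et) (a ++ Ec))

  shorter-true : ∀ {A : Set} (xs ys : List A) → shorter xs ys ≡ true → length xs ≤ length ys
  shorter-true []       ys       _  = z≤n
  shorter-true (x ∷ xs) (y ∷ ys) eq = s≤s (shorter-true xs ys eq)

  shorter-false : ∀ {A : Set} (xs ys : List A) → shorter xs ys ≡ false → length ys ≤ length xs
  shorter-false (x ∷ xs) []       _  = z≤n
  shorter-false (x ∷ xs) (y ∷ ys) eq = s≤s (shorter-false xs ys eq)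

  placed : ∀ W V c → Placed W V c (place W V c)
  placed W V (cut P Q Es Et Ec)
    with shorter (copies (filter (_∈ᵉ? Q) V) W ++ copies ((V ++ V) ++ (V ++ V)) P)
                 (copies (filter (_∈ᵉ? P) V) W ++ copies ((V ++ V) ++ (V ++ V)) Q) in eq
  ... | true  = left (shorter-true (copies (filter (_∈ᵉ? Q) V) W ++ copies ((V ++ V) ++ (V ++ V)) P)
                        (copies (filter (_∈ᵉ? P) V) W ++ copies ((V ++ V) ++ (V ++ V)) Q) eq)
  ... | false = right (shorter-false (copies (filter (_∈ᵉ? Q) V) W ++ copies ((V ++ V) ++ (V ++ V)) P)
                        (copies (filter (_∈ᵉ? P) V) W ++ copies ((V ++ V) ++ (V ++ V)) Q) eq)

  -- Let an edge occur p times in `P` and q times in `Q`, at most twice in total. Then `p ∸ 1`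
  -- indicates that it lies inside `P`, and `p * q` that it crosses the cut. Here and in
  -- `gate-across`, these indicators are seen to be updated correctly when a vertex with v
  -- occurrences of the edge joins `P`.
  gate-inside : ∀ v p q → v ≤ 1 → (v + p) + q ≤ 2 → gate p v + (p ∸ 1) ≡ (v + p) ∸ 1
  gate-inside 0 zero    q _ _ = refl
  gate-inside 0 (suc p) q _ _ = refl
  gate-inside 1 zero    q _ _ = refl
  gate-inside 1 (suc p) q _ _ = refl
  gate-inside (suc (suc v)) p q (s≤s ()) _

  gate-across : ∀ v p q → v ≤ 1 → (v + p) + q ≤ 2 → gate q v + p * q ≡ (v + p) * q
  gate-across 0 p zero    _ _ = refl
  gate-across 0 p (suc q) _ _ = refl
  gate-across 1 p zero    _ _ = refl
  gate-across 1 p (suc zero) _ _ = refl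
  gate-across 1 p (suc (suc q)) _ h = ⊥-elim (<⇒≱ (s≤s (s≤s z≤n)) (≤-trans (≤-trans (m≤n+m _ p) (≤-reflexive refl)) (s≤s⁻¹ h)))
  gate-across (suc (suc v)) p q (s≤s ()) _

  -- The last field is the invariant M A + 2 Δ (p + q) ≥ 2 (p - q)² of the greedy
  -- choice, where A is the number of edges inside the two sides minus the size
  -- of the cut, written without subtraction.
  record Balanced (W : List (Fin m)) (Δ : ℕ) (I : List (List (Fin m))) (c : Cut {m}) : Set where
    open Cut c
    field
      total     : ∀ x → (count x P + count x Q) + count x (concat I) ≡ 2
      inside-P  : ∀ x → count x Es ≡ count x P ∸ 1
      inside-Q  : ∀ x → count x Et ≡ count x Q ∸ 1
      across    : ∀ x → count x Ec ≡ count x P * count x Q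
      potential : let p = length P ; q = length Q in
                  length W * length Ec + 2 * (p * p + q * q) ≤
                  length W * (length Es + length Et) + 4 * (p * q) + 2 * (Δ * (p + q))

  -- The sum of three inequalities: the old invariant, the greedy choice, and 2 d² ≤ 2 Δ d. Twice
  -- the square of p - q grows by 4 d (p - q) + 2 d²; the choice pays for the first term, and the
  -- second goes into the error term, where p + q grows by d.
  potential-step : ∀ M Δ d p q a b s s′ c → d ≤ Δ →
    b * M + ((d + d) + (d + d)) * p ≤ a * M + ((d + d) + (d + d)) * q →
    M * c + 2 * (p * p + q * q) ≤ M * (s + s′) + 4 * (p * q) + 2 * (Δ * (p + q)) →
    M * (b + c) + 2 * ((d + p) * (d + p) + q * q) ≤
    M * ((a + s) + s′) + 4 * ((d + p) * q) + 2 * (Δ * ((d + p) + q))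
  potential-step M Δ d p q a b s s′ c d≤Δ choice inv = begin
    M * (b + c) + 2 * ((d + p) * (d + p) + q * q)
      ≡⟨ before M d p q b c ⟩
    (M * c + 2 * (p * p + q * q)) + (b * M + ((d + d) + (d + d)) * p) + 2 * (d * d)
      ≤⟨ +-mono-≤ (+-mono-≤ inv choice) (*-monoʳ-≤ 2 (*-monoˡ-≤ d d≤Δ)) ⟩
    (M * (s + s′) + 4 * (p * q) + 2 * (Δ * (p + q))) + (a * M + ((d + d) + (d + d)) * q) + 2 * (Δ * d)
      ≡⟨ after M Δ d p q a s s′ ⟩
    M * ((a + s) + s′) + 4 * ((d + p) * q) + 2 * (Δ * ((d + p) + q)) ∎
    where
    open ≤-Reasoning
    before : ∀ M d p q b c → M * (b + c) + 2 * ((d + p) * (d + p) + q * q) ≡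
             (M * c + 2 * (p * p + q * q)) + (b * M + ((d + d) + (d + d)) * p) + 2 * (d * d)
    before = solve-∀
    after : ∀ M Δ d p q a s s′ →
            (M * (s + s′) + 4 * (p * q) + 2 * (Δ * (p + q))) + (a * M + ((d + d) + (d + d)) * q) + 2 * (Δ * d) ≡
            M * ((a + s) + s′) + 4 * ((d + p) * q) + 2 * (Δ * ((d + p) + q))
    after = solve-∀

  -- The inequalities of `left` and `right` are both non-strict, so a step of one kind is a step of
  -- the other on the mirrored cut, and the invariant has to be checked for one side only.
  mirror : Cut {m} → Cut {m}
  mirror (cut P Q Es Et Ec) = cut Q P Et Es Ec

  Balanced-mirror : ∀ {W Δ I c} → Balanced W Δ I c → Balanced W Δ I (mirror c)
  Balanced-mirror {W} {Δ} {I} {cut P Q Es Et Ec} B = record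
    { total     = λ x → trans (cong (_+ count x (concat I)) (+-comm (count x Q) (count x P))) (B.total x)
    ; inside-P  = B.inside-Q
    ; inside-Q  = B.inside-P
    ; across    = λ x → trans (B.across x) (*-comm (count x P) (count x Q))
    ; potential = subst₂ _≤_ (lhs (length W * length Ec) (length P) (length Q))
                    (rhs (length W) Δ (length P) (length Q) (length Es) (length Et)) B.potential
    }
    where
    module B = Balanced B
    lhs : ∀ c p q → c + 2 * (p * p + q * q) ≡ c + 2 * (q * q + p * p)
    lhs = solve-∀
    rhs : ∀ M Δ p q s t → M * (s + t) + 4 * (p * q) + 2 * (Δ * (p + q)) ≡ M * (t + s) + 4 * (q * p) + 2 * (Δ * (q + p))
    rhs = solve-∀

  length-choice : ∀ (b W V P : List (Fin m)) → length (copies b W ++ copies ((V ++ V) ++ (V ++ V)) P) ≡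
    length b * length W + ((length V + length V) + (length V + length V)) * length P
  length-choice b W V P = trans (length-++ (copies b W)) (cong₂ _+_ (length-copies b W)
    (trans (length-copies ((V ++ V) ++ (V ++ V)) P) (cong (_* length P)
      (trans (length-++ (V ++ V)) (cong₂ _+_ (length-++ V) (length-++ V))))))

  Regular : ℕ → List (Fin m) → Set
  Regular Δ V = (∀ x → count x V ≤ 1) × length V ≤ Δ

  Balanced-left : ∀ {W Δ I V P Q Es Et Ec} → Regular Δ V →
    let a = filter (_∈ᵉ? P) V ; b = filter (_∈ᵉ? Q) V ; u = (V ++ V) ++ (V ++ V) in
    length (copies b W ++ copies u P) ≤ length (copies a W ++ copies u Q) →
    Balanced W Δ (V ∷ I) (cut P Q Es Et Ec) → Balanced W Δ I (cut (V ++ P) Q (a ++ Es) Et (b ++ Ec))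
  Balanced-left {W} {Δ} {I} {V} {P} {Q} {Es} {Et} {Ec} (V≤1 , V≤Δ) choice B = record
    { total     = total
    ; inside-P  = λ x → trans (count-++ x a Es) (trans (cong₂ _+_ (count-filter x P V) (B.inside-P x))
                    (trans (gate-inside (count x V) (count x P) (count x Q) (V≤1 x) (≤2 x))
                      (cong (_∸ 1) (sym (count-++ x V P)))))
    ; inside-Q  = B.inside-Q
    ; across    = λ x → trans (count-++ x b Ec) (trans (cong₂ _+_ (count-filter x Q V) (B.across x))
                    (trans (gate-across (count x V) (count x P) (count x Q) (V≤1 x) (≤2 x))
                      (cong (_* count x Q) (sym (count-++ x V P)))))
    ; potential = potential
    }
    where
    module B = Balanced B
    a = filter (_∈ᵉ? P) V
    b = filter (_∈ᵉ? Q) V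
    shuffle : ∀ v p q r → ((v + p) + q) + r ≡ (p + q) + (v + r)
    shuffle = solve-∀
    total : ∀ x → (count x (V ++ P) + count x Q) + count x (concat I) ≡ 2
    total x = trans (cong (λ z → (z + count x Q) + count x (concat I)) (count-++ x V P))
      (trans (shuffle (count x V) (count x P) (count x Q) (count x (concat I)))
        (trans (cong (count x P + count x Q +_) (sym (count-++ x V (concat I)))) (B.total x)))
    ≤2 : ∀ x → (count x V + count x P) + count x Q ≤ 2
    ≤2 x = ≤-trans (m≤m+n _ (count x (concat I)))
      (≤-reflexive (trans (cong (λ z → (z + count x Q) + count x (concat I)) (sym (count-++ x V P))) (total x)))
    potential : let p = length (V ++ P) ; q = length Q in
                length W * length (b ++ Ec) + 2 * (p * p + q * q) ≤
                length W * (length (a ++ Es) + length Et) + 4 * (p * q) + 2 * (Δ * (p + q))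
    potential rewrite length-++ V {P} | length-++ a {Es} | length-++ b {Ec} =
      potential-step (length W) Δ (length V) (length P) (length Q) (length a) (length b) (length Es) (length Et) (length Ec)
        V≤Δ (subst₂ _≤_ (length-choice b W V P) (length-choice a W V Q) choice) B.potential

  Balanced-placed : ∀ {W Δ I V c c′} → Regular Δ V → Placed W V c c′ → Balanced W Δ (V ∷ I) c → Balanced W Δ I c′
  Balanced-placed r (left p)  B = Balanced-left r p B
  Balanced-placed r (right p) B = Balanced-mirror (Balanced-left r p (Balanced-mirror B))

  greedy-balanced : ∀ {W Δ} I c → All (Regular Δ) I → Balanced W Δ I c → Balanced W Δ [] (greedy W I c)
  greedy-balanced []      c []       B = B
  greedy-balanced (V ∷ I) c (r ∷ rs) B = greedy-balanced I _ rs (Balanced-placed r (placed _ V c) B)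

  Placed-⊆ : ∀ {W V c c′} → Placed W V c c′ →
             Cut.P c ⊆ Cut.P c′ × Cut.Q c ⊆ Cut.Q c′ × (V ⊆ Cut.P c′ ⊎ V ⊆ Cut.Q c′)
  Placed-⊆ {V = V} (left _)  = ∈-++⁺ʳ V , id , inj₁ ∈-++⁺ˡ
  Placed-⊆ {V = V} (right _) = id , ∈-++⁺ʳ V , inj₂ ∈-++⁺ˡ

  greedy-⊆ : ∀ W I c → let c′ = greedy W I c in Cut.P c ⊆ Cut.P c′ × Cut.Q c ⊆ Cut.Q c′
  greedy-⊆ W []      c = id , id
  greedy-⊆ W (V ∷ I) c with Placed-⊆ (placed W V c) | greedy-⊆ W I (place W V c)
  ... | p , q , _ | p′ , q′ = p′ ∘ p , q′ ∘ q

  greedy-covers : ∀ W I c → let c′ = greedy W I c in All (λ V → V ⊆ Cut.P c′ ⊎ V ⊆ Cut.Q c′) I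
  greedy-covers W []      c = []
  greedy-covers W (V ∷ I) c with Placed-⊆ (placed W V c) | greedy-⊆ W I (place W V c)
  ... | _ , _ , inj₁ r | p , q = inj₁ (p ∘ r) ∷ greedy-covers W I (place W V c)
  ... | _ , _ , inj₂ r | p , q = inj₂ (q ∘ r) ∷ greedy-covers W I (place W V c)

2ab≤a²+b² : ∀ a b → 2 * (a * b) ≤ a * a + b * b
2ab≤a²+b² a b with ≤-total a b
... | inj₁ a≤b = subst (λ b → 2 * (a * b) ≤ a * a + b * b) (m+[n∸m]≡n a≤b)
  (≤-trans (m≤m+n _ ((b ∸ a) * (b ∸ a))) (≤-reflexive (identity a (b ∸ a))))
  where
  identity : ∀ a k → 2 * (a * (a + k)) + k * k ≡ a * a + (a + k) * (a + k)
  identity = solve-∀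
... | inj₂ b≤a = subst (λ a → 2 * (a * b) ≤ a * a + b * b) (m+[n∸m]≡n b≤a)
  (≤-trans (m≤m+n _ ((a ∸ b) * (a ∸ b))) (≤-reflexive (identity b (a ∸ b))))
  where
  identity : ∀ b k → 2 * ((b + k) * b) + k * k ≡ (b + k) * (b + k) + b * b
  identity = solve-∀

-- The potential gives 8 m c + 16 g² ≤ 4 m² + 8 Δ m for the excess g = s - t, and
-- 8 m g ≤ m² + 16 g².
height-bound : ∀ m Δ s t c g → (s + t) + c ≡ m → s ≡ t + g →
  (m + m) * c + 2 * ((2 * s + c) * (2 * s + c) + (2 * t + c) * (2 * t + c)) ≤
  (m + m) * (s + t) + 4 * ((2 * s + c) * (2 * t + c)) + 2 * (Δ * ((2 * s + c) + (2 * t + c))) →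
  16 * (c + s) ≤ 13 * m + 8 * Δ
-- For nonzero `m` the bound is obtained multiplied by `m`, which is then cancelled.
height-bound zero Δ s t c g sum≡0 _ _ = ≤-trans (≤-reflexive (cong₂ (λ c s → 16 * (c + s)) c≡0 s≡0)) z≤n
  where
  c≡0 = m+n≡0⇒n≡0 (s + t) sum≡0
  s≡0 = m+n≡0⇒m≡0 s (m+n≡0⇒m≡0 (s + t) sum≡0)
height-bound m@(suc _) Δ s t c g sum≡m refl potential = *-cancelˡ-≤ m (+-cancelʳ-≤ (16 * (g * g)) _ _ (begin
  m * (16 * (c + (t + g))) + 16 * (g * g)
    ≡⟨ expand m t c g ⟩
  8 * (m * (((t + g) + t) + c)) + (8 * (m * c) + 2 * (m * (4 * g))) + 16 * (g * g)
    ≡⟨ cong (λ z → 8 * (m * z) + (8 * (m * c) + 2 * (m * (4 * g))) + 16 * (g * g)) sum≡m ⟩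
  8 * (m * m) + (8 * (m * c) + 2 * (m * (4 * g))) + 16 * (g * g)
    ≤⟨ +-monoˡ-≤ (16 * (g * g)) (+-monoʳ-≤ (8 * (m * m)) (+-monoʳ-≤ (8 * (m * c)) (2ab≤a²+b² m (4 * g)))) ⟩
  8 * (m * m) + (8 * (m * c) + (m * m + 4 * g * (4 * g))) + 16 * (g * g)
    ≡⟨ regroup m c g ⟩
  9 * (m * m) + 2 * (2 * (m * c) + 8 * (g * g)) + (4 * (m * c) + 16 * (g * g))
    ≤⟨ +-monoˡ-≤ _ (+-monoʳ-≤ (9 * (m * m)) (*-monoʳ-≤ 2 excess)) ⟩
  9 * (m * m) + 2 * (2 * (m * ((t + g) + t)) + 4 * (Δ * m)) + (4 * (m * c) + 16 * (g * g))
    ≡⟨ collect m Δ t c g ⟩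
  9 * (m * m) + 4 * (m * (((t + g) + t) + c)) + 8 * (Δ * m) + 16 * (g * g)
    ≡⟨ cong (λ z → 9 * (m * m) + 4 * (m * z) + 8 * (Δ * m) + 16 * (g * g)) sum≡m ⟩
  9 * (m * m) + 4 * (m * m) + 8 * (Δ * m) + 16 * (g * g)
    ≡⟨ finish m Δ g ⟩
  m * (13 * m + 8 * Δ) + 16 * (g * g) ∎))
  where
  open ≤-Reasoning
  p = 2 * (t + g) + c
  q = 2 * t + c
  expand : ∀ m t c g → m * (16 * (c + (t + g))) + 16 * (g * g) ≡
           8 * (m * (((t + g) + t) + c)) + (8 * (m * c) + 2 * (m * (4 * g))) + 16 * (g * g)
  expand = solve-∀
  regroup : ∀ m c g → 8 * (m * m) + (8 * (m * c) + (m * m + 4 * g * (4 * g))) + 16 * (g * g) ≡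
            9 * (m * m) + 2 * (2 * (m * c) + 8 * (g * g)) + (4 * (m * c) + 16 * (g * g))
  regroup = solve-∀
  collect : ∀ m Δ t c g →
            9 * (m * m) + 2 * (2 * (m * ((t + g) + t)) + 4 * (Δ * m)) + (4 * (m * c) + 16 * (g * g)) ≡
            9 * (m * m) + 4 * (m * (((t + g) + t) + c)) + 8 * (Δ * m) + 16 * (g * g)
  collect = solve-∀
  finish : ∀ m Δ g → 9 * (m * m) + 4 * (m * m) + 8 * (Δ * m) + 16 * (g * g) ≡ m * (13 * m + 8 * Δ) + 16 * (g * g)
  finish = solve-∀
  squares : ∀ m t c g → (m + m) * c + 2 * ((2 * (t + g) + c) * (2 * (t + g) + c) + (2 * t + c) * (2 * t + c)) ≡
            4 * ((2 * (t + g) + c) * (2 * t + c)) + (2 * (m * c) + 8 * (g * g))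
  squares = solve-∀
  degrees : ∀ m Δ t c g → (m + m) * ((t + g) + t) + 4 * ((2 * (t + g) + c) * (2 * t + c)) + 2 * (Δ * ((2 * (t + g) + c) + (2 * t + c))) ≡
            4 * ((2 * (t + g) + c) * (2 * t + c)) + (2 * (m * ((t + g) + t)) + 4 * (Δ * (((t + g) + t) + c)))
  degrees = solve-∀
  excess : 2 * (m * c) + 8 * (g * g) ≤ 2 * (m * ((t + g) + t)) + 4 * (Δ * m)
  excess = +-cancelˡ-≤ (4 * (p * q)) _ _ (begin
    4 * (p * q) + (2 * (m * c) + 8 * (g * g))    ≡⟨ squares m t c g ⟨
    (m + m) * c + 2 * (p * p + q * q)            ≤⟨ potential ⟩
    (m + m) * ((t + g) + t) + 4 * (p * q) + 2 * (Δ * (p + q)) ≡⟨ degrees m Δ t c g ⟩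
    4 * (p * q) + (2 * (m * ((t + g) + t)) + 4 * (Δ * (((t + g) + t) + c)))
      ≡⟨ cong (λ z → 4 * (p * q) + (2 * (m * ((t + g) + t)) + 4 * (Δ * z))) sum≡m ⟩
    4 * (p * q) + (2 * (m * ((t + g) + t)) + 4 * (Δ * m)) ∎)

module _ {m : ℕ} where

  module FinalCut {W : List (Fin m)} {Δ} {c : Cut {m}} (len : length W ≡ m + m) (B : Balanced W Δ [] c) where
    open Cut c
    open Balanced B

    twice : ∀ x → count x P + count x Q ≡ 2
    twice x = trans (sym (+-identityʳ _)) (total x)

    private
      -- Every edge has both of its ends placed. The three cases are an edge inside `Q`, one across,
      -- and one inside `P`.
      once : ∀ p q → p + q ≡ 2 → ((p ∸ 1) + (q ∸ 1)) + p * q ≡ 1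
      once 0 .2 refl = refl
      once 1 .1 refl = refl
      once 2 .0 refl = refl
      double : ∀ p q → p + q ≡ 2 → p ≡ 2 * (p ∸ 1) + p * q
      double 0 .2 refl = refl
      double 1 .1 refl = refl
      double 2 .0 refl = refl

    edges : (length Es + length Et) + length Ec ≡ m
    edges = begin
      (length Es + length Et) + length Ec
        ≡⟨ cong₂ _+_ (cong₂ _+_ (length-∑ Es) (length-∑ Et)) (length-∑ Ec) ⟩
      (∑ (λ x → count x Es) + ∑ (λ x → count x Et)) + ∑ (λ x → count x Ec)
        ≡⟨ cong (_+ ∑ (λ x → count x Ec)) (∑-distrib (λ x → count x Es) (λ x → count x Et)) ⟨
      ∑ (λ x → count x Es + count x Et) + ∑ (λ x → count x Ec)
        ≡⟨ ∑-distrib (λ x → count x Es + count x Et) (λ x → count x Ec) ⟨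
      ∑ (λ x → (count x Es + count x Et) + count x Ec)
        ≡⟨ ∑-cong (λ x → trans (cong₂ _+_ (cong₂ _+_ (inside-P x) (inside-Q x)) (across x))
                            (once (count x P) (count x Q) (twice x))) ⟩
      ∑ {m} (λ _ → 1)
        ≡⟨ ∑-1 m ⟩
      m ∎
      where open ≡-Reasoning

    private
      ends : ∀ (P Q Es Ec : List (Fin m)) → (∀ x → count x P + count x Q ≡ 2) →
             (∀ x → count x Es ≡ count x P ∸ 1) → (∀ x → count x Ec ≡ count x P * count x Q) →
             length P ≡ 2 * length Es + length Ec
      ends P Q Es Ec twice inside across = begin
        length P
          ≡⟨ length-∑ P ⟩
        ∑ (λ x → count x P)
          ≡⟨ ∑-cong (λ x → trans (double (count x P) (count x Q) (twice x))
               (cong₂ (λ y z → (y + (y + 0)) + z) (sym (inside x)) (sym (across x)))) ⟩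
        ∑ (λ x → (count x Es + (count x Es + 0)) + count x Ec)
          ≡⟨ ∑-distrib (λ x → count x Es + (count x Es + 0)) (λ x → count x Ec) ⟩
        ∑ (λ x → count x Es + (count x Es + 0)) + ∑ (λ x → count x Ec)
          ≡⟨ cong (_+ ∑ (λ x → count x Ec)) (trans (∑-distrib (λ x → count x Es) (λ x → count x Es + 0))
               (cong (∑ (λ x → count x Es) +_) (∑-cong {m} (λ x → +-identityʳ (count x Es))))) ⟩
        (∑ (λ x → count x Es) + ∑ (λ x → count x Es)) + ∑ (λ x → count x Ec)
          ≡⟨ cong₂ (λ y z → (y + y) + z) (length-∑ Es) (length-∑ Ec) ⟨
        (length Es + length Es) + length Ec
          ≡⟨ cong (λ z → (length Es + z) + length Ec) (+-identityʳ (length Es)) ⟨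
        2 * length Es + length Ec ∎
        where open ≡-Reasoning

    ends-P : length P ≡ 2 * length Es + length Ec
    ends-P = ends P Q Es Ec twice inside-P across

    ends-Q : length Q ≡ 2 * length Et + length Ec
    ends-Q = ends Q P Et Ec (λ x → trans (+-comm (count x Q) (count x P)) (twice x)) inside-Q
               (λ x → trans (across x) (*-comm (count x P) (count x Q)))

    private
      inside-or-across : ∀ p q → p + q ≡ 2 → 1 ≤ p → 1 ≤ p ∸ 1 ⊎ 1 ≤ p * q
      inside-or-across 1 .1 refl _ = inj₂ ≤-refl
      inside-or-across 2 .0 refl _ = inj₁ ≤-refl
      apart : ∀ p q → p + q ≡ 2 → 1 ≤ q → ¬ (1 ≤ p ∸ 1)
      apart 0 .2 refl _ ()
      apart 1 .1 refl _ ()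
      apart 2 .0 refl () _

    P⊆ : ∀ {x} → x ∈ P → x ∈ Es ⊎ x ∈ Ec
    P⊆ {x} x∈P with inside-or-across (count x P) (count x Q) (twice x) (∈⇒count x∈P)
    ... | inj₁ p = inj₁ (count⇒∈ (≤-trans p (≤-reflexive (sym (inside-P x)))))
    ... | inj₂ p = inj₂ (count⇒∈ (≤-trans p (≤-reflexive (sym (across x)))))

    Q⊆ : ∀ {x} → x ∈ Q → x ∈ Et ⊎ x ∈ Ec
    Q⊆ {x} x∈Q with inside-or-across (count x Q) (count x P) (trans (+-comm (count x Q) (count x P)) (twice x)) (∈⇒count x∈Q)
    ... | inj₁ p = inj₁ (count⇒∈ (≤-trans p (≤-reflexive (sym (inside-Q x)))))
    ... | inj₂ p = inj₂ (count⇒∈ (≤-trans p (≤-reflexive (sym (trans (across x) (*-comm (count x P) (count x Q)))))))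

    Q∩Es : ∀ {x} → x ∈ Q → ¬ (x ∈ Es)
    Q∩Es {x} x∈Q x∈Es = apart (count x P) (count x Q) (twice x) (∈⇒count x∈Q)
      (≤-trans (∈⇒count x∈Es) (≤-reflexive (inside-P x)))

    height : 16 * (length Ec + (length Es ⊔ length Et)) ≤ 13 * m + 8 * Δ
    height with ≤-total (length Et) (length Es)
    ... | inj₁ t≤s = subst (λ z → 16 * (length Ec + z) ≤ 13 * m + 8 * Δ) (sym (m≥n⇒m⊔n≡m t≤s))
      (height-bound m Δ (length Es) (length Et) (length Ec) (length Es ∸ length Et) edges (sym (m+[n∸m]≡n t≤s))
        (subst₂ (λ p q → (m + m) * length Ec + 2 * (p * p + q * q) ≤
                   (m + m) * (length Es + length Et) + 4 * (p * q) + 2 * (Δ * (p + q))) ends-P ends-Q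
          (subst (λ M → M * length Ec + _ ≤ M * (length Es + length Et) + 4 * (length P * length Q) + 2 * (Δ * (length P + length Q))) len potential)))
    ... | inj₂ s≤t = subst (λ z → 16 * (length Ec + z) ≤ 13 * m + 8 * Δ) (sym (m≤n⇒m⊔n≡n s≤t))
      (height-bound m Δ (length Et) (length Es) (length Ec) (length Et ∸ length Es)
        (trans (cong (_+ length Ec) (+-comm (length Et) (length Es))) edges) (sym (m+[n∸m]≡n s≤t))
        (subst₂ (λ q p → (m + m) * length Ec + 2 * (q * q + p * p) ≤
                   (m + m) * (length Et + length Es) + 4 * (q * p) + 2 * (Δ * (q + p))) ends-Q ends-P
          (subst (λ M → M * length Ec + _ ≤ M * (length Et + length Es) + 4 * (length Q * length P) + 2 * (Δ * (length Q + length P))) len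
            (Balanced.potential (Balanced-mirror B)))))

-- The clauses of the constraint of a vertex

solo : ∀ {A : Set} → List A → List (List A)
solo []         = []
solo L@(_ ∷ _) = L ∷ []

-- `solo` drops the empty incidence lists of isolated vertices, which cannot be recovered from the
-- formula. They contribute nothing to the concatenation anyway.
concat-solo : ∀ {A B : Set} (h : B → List A) L → concat (concatMap (solo ∘ h) L) ≡ concatMap h L
concat-solo h []      = refl
concat-solo h (v ∷ L) with h v
... | []     = concat-solo h L
... | x ∷ xs = cong ((x ∷ xs) ++_) (concat-solo h L)

All-solo⁺ : ∀ {A B : Set} {R : List A → Set} (h : B → List A) → (∀ v → R (h v)) → ∀ L → All R (concatMap (solo ∘ h) L)
All-solo⁺ h r []      = []
All-solo⁺ h r (v ∷ L) with h v | r v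
... | []    | _ = All-solo⁺ h r L
... | _ ∷ _ | p = p ∷ All-solo⁺ h r L

All-solo⁻ : ∀ {A B : Set} {R : List A → Set} (h : B → List A) → R [] → ∀ {L} → All R (concatMap (solo ∘ h) L) →
            All (R ∘ h) L
All-solo⁻ {R = R} h r {[]}    []  = []
All-solo⁻ {R = R} h r {v ∷ L} ps = head (h v) ps ∷ All-solo⁻ {R = R} h r (All-++⁻ʳ (solo (h v)) ps)
  where
  head : ∀ V {Vs} → All R (solo V ++ Vs) → R V
  head []      _       = r
  head (_ ∷ _) (p ∷ _) = p

items-++ : ∀ {m} → (F F′ : CNF m) → items (F ++ F′) ≡ items F ++ items F′
items-++ []             F′ = refl
items-++ ([] ∷ F)       F′ = items-++ F F′
items-++ ((l ∷ ls) ∷ F) F′ with positive ls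
... | true  = cong (_ ∷_) (items-++ F F′)
... | false = items-++ F F′

items-concatMap : ∀ {m} {B : Set} (f : B → CNF m) L → items (concatMap f L) ≡ concatMap (items ∘ f) L
items-concatMap f []      = refl
items-concatMap f (v ∷ L) = trans (items-++ (f v) (concatMap f L)) (cong (items (f v) ++_) (items-concatMap f L))

zeros : ∀ {m} → List (Fin m) → List (Fin m × Bool)
zeros = map (_, false)

private
  Zero? : ∀ {m} → (a : List (Fin m × Bool)) → Dec (positive (falsifiedBy a) ≡ true)
  Zero? a = positive (falsifiedBy a) ≟ᵇ true

  filter-false : ∀ {m} (x : Fin m) L → filter Zero? (map ((x , false) ∷_) L) ≡ map ((x , false) ∷_) (filter Zero? L)
  filter-false x []      = refl
  filter-false x (a ∷ L) with positive (falsifiedBy a)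
  ... | true  = cong (_ ∷_) (filter-false x L)
  ... | false = filter-false x L

  filter-true : ∀ {m} (x : Fin m) L → filter Zero? (map ((x , true) ∷_) L) ≡ []
  filter-true x []      = refl
  filter-true x (a ∷ L) = filter-true x L

  filter-zeros : ∀ {m} (xs : List (Fin m)) → filter Zero? (assignments xs) ≡ zeros xs ∷ []
  filter-zeros []       = refl
  filter-zeros (x ∷ xs) = begin
    filter Zero? (map ((x , false) ∷_) A ++ map ((x , true) ∷_) A)
      ≡⟨ filter-++ Zero? (map ((x , false) ∷_) A) _ ⟩
    filter Zero? (map ((x , false) ∷_) A) ++ filter Zero? (map ((x , true) ∷_) A)
      ≡⟨ cong₂ _++_ (trans (filter-false x A) (cong (map ((x , false) ∷_)) (filter-zeros xs))) (filter-true x A) ⟩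
    zeros (x ∷ xs) ∷ [] ∎
    where
    open ≡-Reasoning
    A = assignments xs

  -- `items` selects the assignments that are zero after the first variable. Moving this selection
  -- before `P?` leaves a single candidate for each value of the first variable, by `filter-zeros`.
  items-filter : ∀ {m} {P : List (Fin m × Bool) → Set} (P? : ∀ a → Dec (P a)) c L →
                 items (map falsifiedBy (filter P? (map (c ∷_) L))) ≡
                 map (map proj₁) (filter P? (map (c ∷_) (filter Zero? L)))
  items-filter P? c []      = refl
  items-filter P? c (a ∷ L) with P? (c ∷ a)
  items-filter P? c (a ∷ L) | yes p with positive (falsifiedBy a)
  ... | false = items-filter P? c L
  ... | true  with P? (c ∷ a)
  ...   | yes _ = cong₂ _∷_ (cong (proj₁ c ∷_) (sym (map-∘ a))) (items-filter P? c L)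
  ...   | no ¬p = ⊥-elim (¬p p)
  items-filter P? c (a ∷ L) | no ¬p with positive (falsifiedBy a)
  ... | false = items-filter P? c L
  ... | true  with P? (c ∷ a)
  ...   | yes p = ⊥-elim (¬p p)
  ...   | no _  = items-filter P? c L

  parity-zeros : ∀ {m} (xs : List (Fin m)) → parity (map proj₂ (zeros xs)) ≡ false
  parity-zeros []       = refl
  parity-zeros (x ∷ xs) = parity-zeros xs

violations : ∀ {m} → Bool → List (Fin m) → List (List (Fin m × Bool))
violations b xs = filter (λ a → ¬? (parity (map proj₂ a) ≟ᵇ b)) (assignments xs)

-- The two candidates differ only at the first variable, so their parities are opposite and exactly
-- one of them violates the constraint, whatever the charge `b`.
items-violations : ∀ {m} b (xs : List (Fin m)) → items (map falsifiedBy (violations b xs)) ≡ solo xs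
items-violations false []       = refl
items-violations true  []       = refl
items-violations b     (x ∷ xs) = begin
  items (map falsifiedBy (filter P? (map ((x , false) ∷_) A ++ map ((x , true) ∷_) A)))
    ≡⟨ cong (items ∘ map falsifiedBy) (filter-++ P? (map ((x , false) ∷_) A) _) ⟩
  items (map falsifiedBy (filter P? (map ((x , false) ∷_) A) ++ filter P? (map ((x , true) ∷_) A)))
    ≡⟨ cong items (map-++ falsifiedBy (filter P? (map ((x , false) ∷_) A)) _) ⟩
  items (map falsifiedBy (filter P? (map ((x , false) ∷_) A)) ++ map falsifiedBy (filter P? (map ((x , true) ∷_) A)))
    ≡⟨ items-++ (map falsifiedBy (filter P? (map ((x , false) ∷_) A))) _ ⟩
  items (map falsifiedBy (filter P? (map ((x , false) ∷_) A))) ++ items (map falsifiedBy (filter P? (map ((x , true) ∷_) A)))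
    ≡⟨ cong₂ _++_ (part false) (part true) ⟩
  map (map proj₁) (filter P? (((x , false) ∷ zeros xs) ∷ [])) ++ map (map proj₁) (filter P? (((x , true) ∷ zeros xs) ∷ []))
    ≡⟨ one b ⟩
  (x ∷ xs) ∷ [] ∎
  where
  open ≡-Reasoning
  A = assignments xs
  P? = λ a → ¬? (parity (map proj₂ a) ≟ᵇ b)
  part : ∀ c → items (map falsifiedBy (filter P? (map ((x , c) ∷_) A))) ≡
               map (map proj₁) (filter P? (((x , c) ∷ zeros xs) ∷ []))
  part c = trans (items-filter P? (x , c) A)
    (cong (λ L → map (map proj₁) (filter P? (map ((x , c) ∷_) L))) (filter-zeros xs))
  vars : map proj₁ (zeros xs) ≡ xs
  vars = trans (sym (map-∘ xs)) (map-id xs)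
  one : ∀ b → let P? = λ a → ¬? (parity (map proj₂ a) ≟ᵇ b) in
        map (map proj₁) (filter P? (((x , false) ∷ zeros xs) ∷ [])) ++
        map (map proj₁) (filter P? (((x , true) ∷ zeros xs) ∷ [])) ≡ (x ∷ xs) ∷ []
  one false rewrite parity-zeros xs = cong (λ ys → (x ∷ ys) ∷ []) vars
  one true  rewrite parity-zeros xs = cong (λ ys → (x ∷ ys) ∷ []) vars

length-assignments : ∀ {m} (xs : List (Fin m)) → length (assignments xs) ≡ 2 ^ length xs
length-assignments []       = refl
length-assignments (x ∷ xs) = trans (length-++ (map ((x , false) ∷_) A))
  (cong₂ _+_ (trans (length-map _ A) (length-assignments xs))
    (trans (trans (length-map _ A) (length-assignments xs)) (sym (+-identityʳ _))))
  where A = assignments xs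

length-∈-assignments : ∀ {m} (xs : List (Fin m)) → All (λ a → length a ≡ length xs) (assignments xs)
length-∈-assignments []       = refl ∷ []
length-∈-assignments (x ∷ xs) = All-++⁺ (All-map⁺ (All-map (cong suc) rest)) (All-map⁺ (All-map (cong suc) rest))
  where rest = length-∈-assignments xs

∈-assignments : ∀ {m} (τ : Fin m → Bool) xs → map (λ x → x , τ x) xs ∈ assignments xs
∈-assignments τ []       = here refl
∈-assignments τ (x ∷ xs) with τ x
... | false = ∈-++⁺ˡ (∈-map⁺ _ (∈-assignments τ xs))
... | true  = ∈-++⁺ʳ (map ((x , false) ∷_) (assignments xs)) (∈-map⁺ _ (∈-assignments τ xs))

nonempties-++ : ∀ {m} → (F F′ : CNF m) → nonempties (F ++ F′) ≡ nonempties F + nonempties F′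
nonempties-++ []            F′ = refl
nonempties-++ ([] ∷ F)      F′ = nonempties-++ F F′
nonempties-++ ((_ ∷ _) ∷ F) F′ = cong suc (nonempties-++ F F′)

hasEmpty-false : ∀ {m} → (F : CNF m) → hasEmpty F ≡ false → length F ≡ nonempties F
hasEmpty-false []            _  = refl
hasEmpty-false ((_ ∷ _) ∷ F) eq = cong suc (hasEmpty-false F eq)

hasEmpty-true : ∀ {m} → (F : CNF m) → hasEmpty F ≡ true → [] ∈ F
hasEmpty-true ([] ∷ F)      _  = here refl
hasEmpty-true ((_ ∷ _) ∷ F) eq = there (hasEmpty-true F eq)

nonempties-all-empty : ∀ {m} {F : CNF m} → All (λ C → length C ≡ 0) F → nonempties F ≡ 0
nonempties-all-empty []                    = refl
nonempties-all-empty {F = [] ∷ F} (_ ∷ ps) = nonempties-all-empty ps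

All-filter : ∀ {A : Set} {R P : A → Set} (P? : ∀ a → Dec (P a)) {L} → All R L → All R (filter P? L)
All-filter P? []       = []
All-filter P? {a ∷ L} (p ∷ ps) with does (P? a)
... | true  = p ∷ All-filter P? ps
... | false = All-filter P? ps

length-violations : ∀ {m} b (xs : List (Fin m)) → All (λ C → length C ≡ length xs) (map falsifiedBy (violations b xs))
length-violations b xs = All-map⁺ (All-filter _ (All-map (λ {a} → trans (length-map _ a)) (length-∈-assignments xs)))

-- The factor `length xs` is generous for one vertex, but turns the sum over all vertices into a
-- degree sum, which is 2 m however many isolated vertices there are.
nonempties-violations : ∀ {m} {Δ} b (xs : List (Fin m)) → length xs ≤ Δ →
                        nonempties (map falsifiedBy (violations b xs)) ≤ length xs * 2 ^ Δ
nonempties-violations b []       _ = ≤-reflexive (nonempties-all-empty (length-violations b []))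
nonempties-violations {m} {Δ} b xs@(_ ∷ _) p = begin
  nonempties (map falsifiedBy (violations b xs)) ≤⟨ nonempties≤length (map falsifiedBy (violations b xs)) ⟩
  length (map falsifiedBy (violations b xs))     ≡⟨ length-map falsifiedBy (violations b xs) ⟩
  length (violations b xs)                       ≤⟨ length-filter _ (assignments xs) ⟩
  length (assignments xs)                        ≡⟨ length-assignments xs ⟩
  2 ^ length xs                                  ≤⟨ ^-monoʳ-≤ 2 p ⟩
  2 ^ Δ                                          ≤⟨ m≤m+n (2 ^ Δ) _ ⟩
  length xs * 2 ^ Δ ∎
  where open ≤-Reasoning

-- Tseitin formulas

module XorHandshake = Handshake (CommutativeRing.+-commutativeMonoid xor-∧-commutativeRing)

≤-foldr-⊔ : ∀ {B : Set} (f : B → ℕ) {L v} → v ∈ L → f v ≤ foldr _⊔_ 0 (map f L)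
≤-foldr-⊔ f (here refl) = m≤m⊔n _ _
≤-foldr-⊔ f {w ∷ L} (there p) = ≤-trans (≤-foldr-⊔ f p) (m≤n⊔m (f w) _)

module Tseitin (G : Graph) (χ : Charge G) where

  open Graph G using (n; Edge; Vertex; ends; _∋?_; incident; degree; maxDegree) renaming (m to edges)

  F : CNF edges
  F = tseitin G χ

  degree≤ : ∀ v → degree v ≤ maxDegree
  degree≤ v = ≤-foldr-⊔ degree (∈-allFin v)

  items-F : items F ≡ concatMap (solo ∘ incident) (allFin n)
  items-F = trans (items-concatMap (λ v → map falsifiedBy (violating G χ v)) (allFin n))
    (concatMap-cong (λ v → items-violations (χ v) (incident v)) (allFin n))

  concat-items : concat (items F) ≡ concatMap incident (allFin n)
  concat-items = trans (cong concat items-F) (concat-solo incident (allFin n))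

  ∑-twice : ∀ x → ∑ {edges} (λ e → indicator x e + indicator x e) ≡ 2
  ∑-twice x = trans (∑-distrib {edges} (indicator x) (indicator x)) (cong₂ _+_ single single)
    where
    single : ∑ (indicator x) ≡ 1
    single = ∑-single x (λ _ → 1)

  count-items : ∀ x → count x (concat (items F)) ≡ 2
  count-items x = trans (cong (count x) concat-items) (trans (ℕ-Handshake.handshake G (indicator x)) (∑-twice x))

  length-items-F : length (concat (items F)) ≡ edges + edges
  length-items-F = begin
    length (concat (items F))                       ≡⟨ length-∑ (concat (items F)) ⟩
    ∑ (λ x → count x (concat (items F)))            ≡⟨ ∑-cong count-items ⟩
    ∑ {edges} (λ _ → 1 + 1)                         ≡⟨ ∑-distrib {edges} (λ _ → 1) (λ _ → 1) ⟩
    ∑ {edges} (λ _ → 1) + ∑ {edges} (λ _ → 1)       ≡⟨ cong₂ _+_ (∑-1 edges) (∑-1 edges) ⟩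
    edges + edges ∎
    where open ≡-Reasoning

  count-incident : ∀ v x → count x (incident v) ≤ 1
  count-incident v x = begin
    count x (incident v)                                                    ≡⟨ ℕ-Handshake.fold-filter-tabulate (_∋? v) (indicator x) id ⟩
    ∑ (λ e → if does (e ∋? v) then indicator x e else 0)                     ≡⟨ ∑-cong swap ⟩
    ∑ (λ e → if does (x ≟ᶠ e) then (if does (e ∋? v) then 1 else 0) else 0)  ≡⟨ ∑-single x (λ e → if does (e ∋? v) then 1 else 0) ⟩
    (if does (x ∋? v) then 1 else 0)                                         ≤⟨ small (does (x ∋? v)) ⟩
    1 ∎
    where
    open ≤-Reasoning
    swap : ∀ e → (if does (e ∋? v) then indicator x e else 0) ≡
                 (if does (x ≟ᶠ e) then (if does (e ∋? v) then 1 else 0) else 0)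
    swap e with does (e ∋? v) | does (x ≟ᶠ e)
    ... | true  | true  = refl
    ... | true  | false = refl
    ... | false | true  = refl
    ... | false | false = refl
    small : ∀ b → (if b then 1 else 0) ≤ 1
    small true  = ≤-refl
    small false = z≤n

  regular : All (Regular maxDegree) (items F)
  regular = subst (All (Regular maxDegree)) (sym items-F)
    (All-solo⁺ incident (λ v → count-incident v , degree≤ v) (allFin n))

  short : All (λ C → length C ≤ edges) F
  short = go (allFin n)
    where
    go : ∀ L → All (λ C → length C ≤ edges) (concatMap (λ v → map falsifiedBy (violating G χ v)) L)
    go []      = []
    go (v ∷ L) = All-++⁺ (All-map (λ eq → ≤-trans (≤-reflexive eq) degree≤edges) (length-violations (χ v) (incident v))) (go L)
      where
      degree≤edges : degree v ≤ edges
      degree≤edges = ≤-trans (length-filter (_∋? v) (allFin edges)) (≤-reflexive (length-tabulate {n = edges} id))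

  nonempties≤ : nonempties F ≤ (edges + edges) * 2 ^ maxDegree
  nonempties≤ = ≤-trans (go (allFin n))
    (*-monoˡ-≤ (2 ^ maxDegree) (≤-reflexive (trans (cong length (sym concat-items)) length-items-F)))
    where
    open ≤-Reasoning
    f = λ v → map falsifiedBy (violating G χ v)
    go : ∀ L → nonempties (concatMap f L) ≤ length (concatMap incident L) * 2 ^ maxDegree
    go []      = z≤n
    go (v ∷ L) = begin
      nonempties (f v ++ concatMap f L)                             ≡⟨ nonempties-++ (f v) (concatMap f L) ⟩
      nonempties (f v) + nonempties (concatMap f L)                 ≤⟨ +-mono-≤ (nonempties-violations (χ v) (incident v) (degree≤ v)) (go L) ⟩
      degree v * 2 ^ maxDegree + length (concatMap incident L) * 2 ^ maxDegree ≡⟨ *-distribʳ-+ (2 ^ maxDegree) (degree v) _ ⟨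
      (degree v + length (concatMap incident L)) * 2 ^ maxDegree    ≡⟨ cong (_* 2 ^ maxDegree) (length-++ (incident v)) ⟨
      length (incident v ++ concatMap incident L) * 2 ^ maxDegree   ∎

  clauseOf : (Edge → Bool) → Vertex → Clause edges
  clauseOf τ v = map (λ e → e , not (τ e)) (incident v)

  private
    sum-even : ∀ k (f : Fin k → Bool) → XorHandshake.∑ (λ e → f e xor f e) ≡ false
    sum-even zero    f = refl
    sum-even (suc k) f rewrite xor-same (f zero) = sum-even k (f ∘ suc)

  -- Adding up all constraints counts every edge twice, which gives 0 modulo 2.
  satisfied⇒even : ∀ τ → (∀ v → parity (map τ (incident v)) ≡ χ v) → parity (map χ (allFin n)) ≡ false
  satisfied⇒even τ sat = begin
    parity (map χ (allFin n))                    ≡⟨ cong parity (map-cong sat (allFin n)) ⟨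
    fold (allFin n) (λ v → fold (incident v) τ)  ≡⟨ fold-concatMap incident (allFin n) τ ⟨
    fold (concatMap incident (allFin n)) τ       ≡⟨ handshake G τ ⟩
    XorHandshake.∑ (λ e → τ e xor τ e)           ≡⟨ sum-even edges τ ⟩
    false ∎
    where
    open ≡-Reasoning
    open XorHandshake using (fold; fold-concatMap; handshake)

  violated-clause : ∀ τ v → parity (map τ (incident v)) ≢ χ v → clauseOf τ v ∈ F
  violated-clause τ v ¬sat = ∈-concat⁺′ clause∈ (∈-map⁺ (λ v → map falsifiedBy (violating G χ v)) (∈-allFin v))
    where
    clause∈ : clauseOf τ v ∈ map falsifiedBy (violating G χ v)
    clause∈ = subst (_∈ map falsifiedBy (violating G χ v)) (sym (map-∘ (incident v)))
      (∈-map⁺ falsifiedBy (∈-filter⁺ _ (∈-assignments τ (incident v))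
        (λ eq → ¬sat (trans (cong parity (map-∘ (incident v))) eq))))

  unsatisfiable : OddCharge G χ → ∀ τ → ∃[ v ] clauseOf τ v ∈ F
  unsatisfiable odd τ =
    let v , ¬sat = ¬∀⟶∃¬ n (λ v → parity (map τ (incident v)) ≡ χ v) (λ v → parity (map τ (incident v)) ≟ᵇ χ v)
                     (λ sat → true≢false (trans (sym odd) (satisfied⇒even τ sat)))
    in v , violated-clause τ v ¬sat
    where
    true≢false : true ≢ false
    true≢false ()

-- Soundness and completeness of the search

module _ {m : ℕ} {F : CNF m} where

  -- At the root the path is empty, so the conclusion can only be the empty clause.
  Sound : Clause m → ProofTree m → Set
  Sound ρ π = Derives F π (conclusion π) × conclusion π ⊆ ρ

  find-sound : ∀ ρ → Maybe.All (Sound ρ) (find F ρ)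
  find-sound ρ = go F id
    where
    go : ∀ F′ → F′ ⊆ F → Maybe.All (Sound ρ) (find F′ ρ)
    go []       _   = Maybe.nothing
    go (C ∷ F′) sub = step (all? (_∈ˡ? ρ) C)
      where
      step : (d : Dec (All (_∈ ρ) C)) → Maybe.All (Sound ρ) (if does d then just (leaf C) else find F′ ρ)
      step (yes p) = Maybe.just (axiom (sub (here refl)) , All-lookup p)
      step (no _)  = go F′ (sub ∘ there)

  drop-literal : ∀ {l ρ} {C : Clause m} → C ⊆ l ∷ ρ → ¬ (l ∈ C) → C ⊆ ρ
  drop-literal sub l∉C k∈C with sub k∈C
  ... | here refl = ⊥-elim (l∉C k∈C)
  ... | there k∈ρ = k∈ρ

  remove-⊆ : ∀ {l ρ} (C : Clause m) → C ⊆ l ∷ ρ → remove l C ⊆ ρ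
  remove-⊆ {l} C sub k∈ with ∈-filter⁻ (λ l′ → ¬? (l′ ≟ˡ l)) {xs = C} k∈
  ... | k∈C , k≢l with sub k∈C
  ...   | here eq   = ⊥-elim (k≢l eq)
  ...   | there k∈ρ = k∈ρ

  combine-sound : ∀ {x ρ M N} → Maybe.All (Sound ((x , true) ∷ ρ)) M → Maybe.All (Sound ((x , false) ∷ ρ)) N →
                  Maybe.All (Sound ρ) (combine x M N)
  combine-sound Maybe.nothing  _             = Maybe.nothing
  combine-sound (Maybe.just _) Maybe.nothing = Maybe.nothing
  combine-sound {x} {ρ} {just π} {just π′} (Maybe.just (d , sub)) (Maybe.just (d′ , sub′)) =
    step ((x , true) ∈ˡ? conclusion π) ((x , false) ∈ˡ? conclusion π′)
    where
    step : (p : Dec ((x , true) ∈ conclusion π)) (q : Dec ((x , false) ∈ conclusion π′)) →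
           Maybe.All (Sound ρ) (if does p then (if does q then
             just (node (resolvent x (conclusion π) (conclusion π′)) x π π′) else just π′) else just π)
    step (no ¬p) _       = Maybe.just (d , drop-literal sub ¬p)
    step (yes p) (no ¬q) = Maybe.just (d′ , drop-literal sub′ ¬q)
    step (yes p) (yes q) = Maybe.just (resolve d d′ p q K-refl ,
      [ remove-⊆ (conclusion π) sub , remove-⊆ (conclusion π′) sub′ ]′ ∘ ∈-++⁻ (remove (x , true) (conclusion π)))

  build-sound : ∀ {k} → (∀ ρ → Maybe.All (Sound ρ) (k ρ)) → ∀ xs ρ → Maybe.All (Sound ρ) (build k xs ρ)
  build-sound sound []       ρ = sound ρ
  build-sound {k} sound (x ∷ xs) ρ = step (does ((x , true) ∈ˡ? ρ)) (does ((x , false) ∈ˡ? ρ))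
    where
    step : ∀ b c → Maybe.All (Sound ρ) (if b then build k xs ρ else if c then build k xs ρ else
      combine x (build k xs ((x , true) ∷ ρ)) (build k xs ((x , false) ∷ ρ)))
    step true  _     = build-sound sound xs ρ
    step false true  = build-sound sound xs ρ
    step false false = combine-sound (build-sound sound xs ((x , true) ∷ ρ)) (build-sound sound xs ((x , false) ∷ ρ))

  search-sound : ∀ Es Et ρ → Maybe.All (Sound ρ) (search F Es Et ρ)
  search-sound Es Et ρ with build (find F) Es ρ | build-sound find-sound Es ρ
  ... | just _  | p             = p
  ... | nothing | Maybe.nothing = build-sound find-sound Et ρ

  find-complete : ∀ {ρ} → find F ρ ≡ nothing → ∀ {C} → C ∈ F → ¬ (All (_∈ ρ) C)
  find-complete {ρ} = go F
    where
    go : ∀ F′ → find F′ ρ ≡ nothing → ∀ {C} → C ∈ F′ → ¬ (All (_∈ ρ) C)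
    go (D ∷ F′) eq C∈ p with all? (_∈ˡ? ρ) D
    go (D ∷ F′) eq (here refl) p | no ¬p = ¬p p
    go (D ∷ F′) eq (there C∈)  p | no ¬p = go F′ eq C∈ p

module _ {m : ℕ} where

  Consistent : Clause m → Set
  Consistent ρ = ∀ x → (x , true) ∈ ρ → ¬ ((x , false) ∈ ρ)

  Covers : Clause m → Fin m → Set
  Covers ρ x = ∃[ b ] (x , b) ∈ ρ

  Consistent-∷ : ∀ {ρ x b} → Consistent ρ → ¬ ((x , not b) ∈ ρ) → Consistent ((x , b) ∷ ρ)
  Consistent-∷ con ¬p y (here refl) (there q)   = ¬p q
  Consistent-∷ con ¬p y (there p)   (here refl) = ¬p p
  Consistent-∷ con ¬p y (there p)   (there q)   = con y p q

  record Branch (k : Clause m → Maybe (ProofTree m)) (xs : List (Fin m)) (ρ : Clause m) : Set where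
    field
      path       : Clause m
      extends    : ρ ⊆ path
      consistent : Consistent path
      covers     : ∀ {x} → x ∈ xs → Covers path x
      fails      : k path ≡ nothing

  combine-nothing : ∀ x (M N : Maybe (ProofTree m)) → combine x M N ≡ nothing → M ≡ nothing ⊎ N ≡ nothing
  combine-nothing x nothing  N        _  = inj₁ refl
  combine-nothing x (just π) nothing  _  = inj₂ refl
  combine-nothing x (just π) (just π′) eq =
    ⊥-elim (go (does ((x , true) ∈ˡ? conclusion π)) (does ((x , false) ∈ˡ? conclusion π′)) eq)
    where
    go : ∀ b c {π₁ π₂ π₃ : ProofTree m} → (if b then (if c then just π₁ else just π₂) else just π₃) ≢ nothing
    go false _     ()
    go true  false ()
    go true  true  ()

  -- `combine` fails only if one of the two subtrees fails. Following the failing ones downwards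
  -- leads to a path that sets all of `xs` and at which `k` fails.
  build-complete : ∀ {k} xs ρ → Consistent ρ → build k xs ρ ≡ nothing → Branch k xs ρ
  build-complete [] ρ con eq = record
    { path = ρ ; extends = id ; consistent = con ; covers = λ () ; fails = eq }
  build-complete {k} (x ∷ xs) ρ con eq = step ((x , true) ∈ˡ? ρ) ((x , false) ∈ˡ? ρ) eq
    where
    cover : ∀ {b ρ′} → ρ ⊆ ρ′ → (x , b) ∈ ρ′ → Branch k xs ρ′ → Branch k (x ∷ xs) ρ
    cover sub p B = record
      { path       = B.path
      ; extends    = B.extends ∘ sub
      ; consistent = B.consistent
      ; covers     = λ { (here refl) → _ , B.extends p ; (there q) → B.covers q }
      ; fails      = B.fails
      }
      where module B = Branch B
    step : (d : Dec ((x , true) ∈ ρ)) (e : Dec ((x , false) ∈ ρ)) →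
           (if does d then build k xs ρ else if does e then build k xs ρ else
             combine x (build k xs ((x , true) ∷ ρ)) (build k xs ((x , false) ∷ ρ))) ≡ nothing →
           Branch k (x ∷ xs) ρ
    step (yes p) _       eq = cover id p (build-complete xs ρ con eq)
    step (no ¬p) (yes q) eq = cover id q (build-complete xs ρ con eq)
    step (no ¬p) (no ¬q) eq with combine-nothing x (build k xs ((x , true) ∷ ρ)) (build k xs ((x , false) ∷ ρ)) eq
    ... | inj₁ eq′ = cover there (here refl) (build-complete xs _ (Consistent-∷ con ¬q) eq′)
    ... | inj₂ eq′ = cover there (here refl) (build-complete xs _ (Consistent-∷ con ¬p) eq′)

  <∣>-nothing : ∀ (M N : Maybe (ProofTree m)) → (M <∣> N) ≡ nothing → M ≡ nothing × N ≡ nothing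
  <∣>-nothing nothing nothing _ = refl , refl

  -- A path consists of the literals that it falsifies.
  value : Clause m → Fin m → Bool
  value ρ x = does ((x , false) ∈ˡ? ρ)

  value-∈ : ∀ {ρ x b} → Consistent ρ → (x , b) ∈ ρ → not (value ρ x) ≡ b
  value-∈ {ρ} {x} {false} con p with (x , false) ∈ˡ? ρ
  ... | yes _ = refl
  ... | no ¬p = ⊥-elim (¬p p)
  value-∈ {ρ} {x} {true}  con p with (x , false) ∈ˡ? ρ
  ... | yes q = ⊥-elim (con x p q)
  ... | no _  = refl

  covered : ∀ {ρ x} → Consistent ρ → Covers ρ x → (x , not (value ρ x)) ∈ ρ
  covered {ρ} {x} con (b , p) = subst (λ b → (x , b) ∈ ρ) (sym (value-∈ con p)) p

  -- Cut edges are set on the stem `ρ` that both paths extend, so the value read off one path is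
  -- also the value on the other.
  covered-by-both : ∀ {ρ ρ₁ ρ₂ x} → ρ ⊆ ρ₁ → ρ ⊆ ρ₂ → Consistent ρ₂ → Covers ρ x → (x , not (value ρ₂ x)) ∈ ρ₁
  covered-by-both {ρ₁ = ρ₁} {x = x} sub₁ sub₂ con₂ (b , p) =
    subst (λ b → (x , b) ∈ ρ₁) (sym (value-∈ con₂ (sub₂ p))) (sub₁ p)

-- Failing branches on both sides of the cut would give an assignment without a
-- falsified clause.
module _ {m n : ℕ} {F : CNF m} {incident : Fin n → List (Fin m)} {P Q Es Et Ec : List (Fin m)}
         (unsatisfiable : ∀ (τ : Fin m → Bool) → ∃[ v ] map (λ e → e , not (τ e)) (incident v) ∈ F)
         (sides : ∀ v → incident v ⊆ P ⊎ incident v ⊆ Q)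
         (P⊆ : ∀ {x : Fin m} → x ∈ P → x ∈ Es ⊎ x ∈ Ec) (Q⊆ : ∀ {x : Fin m} → x ∈ Q → x ∈ Et ⊎ x ∈ Ec)
         (Q∩Es : ∀ {x : Fin m} → x ∈ Q → ¬ (x ∈ Es)) where

  search-complete : build (search F Es Et) Ec [] ≢ nothing
  search-complete eq = contradict (unsatisfiable τ)
    where
    stem : Branch (search F Es Et) Ec []
    stem = build-complete Ec [] (λ _ ()) eq
    module R = Branch stem
    both = <∣>-nothing (build (find F) Es R.path) (build (find F) Et R.path) R.fails
    module S = Branch (build-complete Es R.path R.consistent (proj₁ both))
    module T = Branch (build-complete Et R.path R.consistent (proj₂ both))
    τ : Fin m → Bool
    -- Cut edges are read off `T.path`, but `S.path` would give the same values, as both extend the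
    -- stem.
    τ e = if does (e ∈ᵉ? Es) then value S.path e else value T.path e
    in-S : ∀ {e} → e ∈ P → (e , not (τ e)) ∈ S.path
    in-S {e} e∈P = go (e ∈ᵉ? Es) (P⊆ e∈P)
      where
      go : (d : Dec (e ∈ Es)) → e ∈ Es ⊎ e ∈ Ec →
           (e , not (if does d then value S.path e else value T.path e)) ∈ S.path
      go (yes p) _        = covered S.consistent (S.covers p)
      go (no ¬p) (inj₁ p) = ⊥-elim (¬p p)
      go (no _)  (inj₂ p) = covered-by-both S.extends T.extends T.consistent (R.covers p)
    in-T : ∀ {e} → e ∈ Q → (e , not (τ e)) ∈ T.path
    in-T {e} e∈Q = go (e ∈ᵉ? Es) (Q⊆ e∈Q)
      where
      go : (d : Dec (e ∈ Es)) → e ∈ Et ⊎ e ∈ Ec →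
           (e , not (if does d then value S.path e else value T.path e)) ∈ T.path
      go (yes p) _        = ⊥-elim (Q∩Es e∈Q p)
      go (no _)  (inj₁ p) = covered T.consistent (T.covers p)
      go (no _)  (inj₂ p) = covered T.consistent (proj₁ (R.covers p) , T.extends (proj₂ (R.covers p)))
    falsified : ∀ {A ρ} v → incident v ⊆ A → (∀ {e} → e ∈ A → (e , not (τ e)) ∈ ρ) →
                All (_∈ ρ) (map (λ e → e , not (τ e)) (incident v))
    falsified v sub inA = All-tabulate λ l∈ →
      let e , e∈ , eq = ∈-map⁻ (λ e → e , not (τ e)) l∈ in subst (_∈ _) (sym eq) (inA (sub e∈))
    contradict : ¬ (∃[ v ] map (λ e → e , not (τ e)) (incident v) ∈ F)
    contradict (v , C∈F) = go (sides v)
      where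
      go : incident v ⊆ P ⊎ incident v ⊆ Q → ⊥
      go (inj₁ sub) = find-complete S.fails C∈F (falsified v sub in-S)
      go (inj₂ sub) = find-complete T.fails C∈F (falsified v sub in-T)

  search-refutes : ∃[ π ] build (search F Es Et) Ec [] ≡ just π × Refutes F π
  search-refutes = go _ refl search-complete (build-sound (search-sound Es Et) Ec [])
    where
    empty : ∀ (C : Clause m) → C ⊆ [] → C ≡ []
    empty []      _   = refl
    empty (l ∷ C) sub with () ← sub (here refl)
    go : ∀ M → build (search F Es Et) Ec [] ≡ M → build (search F Es Et) Ec [] ≢ nothing →
         Maybe.All (Sound {F = F} []) (build (search F Es Et) Ec []) →
         ∃[ π ] build (search F Es Et) Ec [] ≡ just π × Refutes F π
    go nothing  eq ¬nothing _ = ⊥-elim (¬nothing eq)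
    go (just π) eq _ sound with subst (Maybe.All (Sound {F = F} [])) eq sound
    ... | Maybe.just (d , sub) = π , eq , subst (Derives F π) (empty (conclusion π) sub) d

module Correctness (G : Graph) (χ : Charge G) (odd : OddCharge G χ) where

  open Graph G using (incident; maxDegree)
  open Tseitin G χ

  balanced : Balanced (concat (items F)) maxDegree [] (greedyCut F)
  balanced = greedy-balanced (items F) initialCut regular record
    { total     = count-items
    ; inside-P  = λ _ → refl
    ; inside-Q  = λ _ → refl
    ; across    = λ _ → refl
    ; potential = ≤-trans (≤-reflexive (trans (+-identityʳ _) (*-zeroʳ (length (concat (items F)))))) z≤n
    }

  open Cut (greedyCut F)
  open FinalCut length-items-F balanced public

  sides : ∀ v → incident v ⊆ P ⊎ incident v ⊆ Q
  sides v = All-lookup (All-solo⁻ {R = λ V → V ⊆ P ⊎ V ⊆ Q} incident (inj₁ λ ())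
    (subst (All (λ V → V ⊆ P ⊎ V ⊆ Q)) items-F (greedy-covers (concat (items F)) (items F) initialCut))) (∈-allFin v)

  refutation : ∃[ π ] refute F ≡ just π × Refutes F π
  refutation = search-refutes (unsatisfiable odd) sides P⊆ Q⊆ Q∩Es

-- The exponent α lies between 82/100 and 83/100

*-mono-≤-nonNeg : ∀ {p q} → 0ℚ ℚ.≤ p → p ℚ.≤ q → p ℚ.* p ℚ.≤ q ℚ.* q
*-mono-≤-nonNeg {p} {q} 0≤p p≤q = ℚ.≤-trans
  (ℚ.*-monoˡ-≤-nonNeg p {{nonNegative 0≤p}} p≤q)
  (ℚ.*-monoʳ-≤-nonNeg q {{nonNegative (ℚ.≤-trans 0≤p p≤q)}} p≤q)

double-mono : ∀ {p q} → p ℚ.≤ q → 2ℚ ℚ.* p ℚ.≤ 2ℚ ℚ.* q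
double-mono = ℚ.*-monoˡ-≤-nonNeg 2ℚ

1-antimono : ∀ {p q} → p ℚ.≤ q → 1ℚ ℚ.- q ℚ.≤ 1ℚ ℚ.- p
1-antimono p≤q = ℚ.+-monoʳ-≤ 1ℚ (ℚ.neg-antimono-≤ p≤q)

fraction-≤ : ∀ {a b c d} .{{_ : NonZero b}} .{{_ : NonZero d}} → (ℤ.+ a ℚ./ b) ℚ.≤ (ℤ.+ c ℚ./ d) → a * d ≤ c * b
fraction-≤ {a} {suc b} {c} {suc d} p = ℤ.drop‿+≤+
  (subst₂ ℤ._≤_ (sym (ℤ.pos-* a (suc d))) (sym (ℤ.pos-* c (suc b)))
  (ℚᵘ.drop-*≤* (ℚᵘ.≤-respʳ-≃ (ℚ.toℚᵘ-fromℚᵘ (mkℚᵘ (ℤ.+ c) d))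
    (ℚᵘ.≤-respˡ-≃ (ℚ.toℚᵘ-fromℚᵘ (mkℚᵘ (ℤ.+ a) b)) (ℚ.toℚᵘ-mono-≤ p)))))
  where open import Relation.Binary.PropositionalEquality using (subst₂)

-- 7/10 lies below 1/√2, since 2 (7/10)² = 98/100, and `h` takes the value 82/100 there.
α<⇒82% : ∀ {q} → α< q → (ℤ.+ 82 ℚ./ 100) ℚ.≤ q
α<⇒82% {q} (x , 0≤x , 1<2x² , x≤1 , hx≤q) = ℚ.≤-trans (1-antimono (double-mono
    (*-mono-≤-nonNeg {1ℚ ℚ.- x} {ℤ.+ 3 ℚ./ 10} (1-antimono x≤1) (1-antimono 7/10≤x)))) hx≤q
  where
  7/10≤x : (ℤ.+ 7 ℚ./ 10) ℚ.≤ x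
  7/10≤x = ℚ.≮⇒≥ λ x<7/10 → ℚ.<-irrefl refl (ℚ.<-≤-trans 1<2x²
    (ℚ.≤-trans (double-mono (*-mono-≤-nonNeg 0≤x (ℚ.<⇒≤ x<7/10))) (from-yes (2ℚ ℚ.* (ℤ.+ 7 ℚ./ 10 ℚ.* (ℤ.+ 7 ℚ./ 10)) ℚ.≤? 1ℚ))))

-- 708/1000 is a close upper bound for 1/√2: twice its square is 1.002528, and `h` is 0.829472
-- there.
<α⇒83% : ∀ {q} → q <α → q ℚ.≤ (ℤ.+ 83 ℚ./ 100)
<α⇒83% {q} (x , 0≤x , 2x²<1 , q≤hx) = ℚ.≤-trans q≤hx (ℚ.≤-trans
    (1-antimono (double-mono (*-mono-≤-nonNeg {1ℚ ℚ.- ℤ.+ 708 ℚ./ 1000} {1ℚ ℚ.- x} (from-yes (0ℚ ℚ.≤? 1ℚ ℚ.- ℤ.+ 708 ℚ./ 1000))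
      (1-antimono x≤708/1000))))
    (from-yes (h (ℤ.+ 708 ℚ./ 1000) ℚ.≤? ℤ.+ 83 ℚ./ 100)))
  where
  x≤708/1000 : x ℚ.≤ (ℤ.+ 708 ℚ./ 1000)
  x≤708/1000 = ℚ.≮⇒≥ λ 708/1000<x → ℚ.<-irrefl refl (ℚ.≤-<-trans
    (ℚ.≤-trans (from-yes (1ℚ ℚ.≤? 2ℚ ℚ.* (ℤ.+ 708 ℚ./ 1000 ℚ.* (ℤ.+ 708 ℚ./ 1000))))
      (double-mono (*-mono-≤-nonNeg {ℤ.+ 708 ℚ./ 1000} (from-yes (0ℚ ℚ.≤? ℤ.+ 708 ℚ./ 1000)) (ℚ.<⇒≤ 708/1000<x)))) 2x²<1)

-- Asymptotics

n<2^n : ∀ n → n < 2 ^ n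
n<2^n zero    = s≤s z≤n
n<2^n (suc n) = begin
  1 + suc n           ≤⟨ +-mono-≤ (1≤2^ n) (n<2^n n) ⟩
  2 ^ n + 2 ^ n       ≡⟨ cong (2 ^ n +_) (+-identityʳ (2 ^ n)) ⟨
  2 ^ suc n           ∎
  where open ≤-Reasoning

^-cancelˡ-≤ : ∀ n .{{_ : NonZero n}} {x y} → x ^ n ≤ y ^ n → x ≤ y
^-cancelˡ-≤ n {x} {y} p with x ≤? y
... | yes x≤y = x≤y
... | no  x≰y = ⊥-elim (<⇒≱ (^-monoˡ-< n (≰⇒> x≰y)) p)

-- This is the `Y` of the cost estimates. The factor 2^Δ is due to the number of clauses; 400 leaves
-- room for the numerals up to 200 and for the constant in `literalSize`.
inputBound : ℕ → ℕ → ℕ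
inputBound m Δ = (m + m + 400) * 2 ^ Δ

timeBound : ℕ → ℕ → ℕ
timeBound m Δ = 2 ^ ((13 * m + 8 * Δ) / 16) * inputBound m Δ ^ exponent

-- Replaces a logarithm: its growth rate 1 / k can be made as small as needed.
logBound : (k : ℕ) .{{_ : NonZero k}} → ℕ → ℕ
logBound k m = (k + k + 400) + m / k

-- With q = m / k, m is at most k (q + 1). So the left side is at most 2 k + 400 times q + 1, and
-- each of these factors is at most a power of 2 by `n<2^n`.
linear≤2^logBound : ∀ k .{{_ : NonZero k}} m → m + m + 400 ≤ 2 ^ logBound k m
linear≤2^logBound k m = begin
  m + m + 400                             ≤⟨ +-mono-≤ (+-mono-≤ m≤ m≤) (m≤m*n 400 (suc q)) ⟩
  k * suc q + k * suc q + 400 * suc q     ≡⟨ cong (_+ 400 * suc q) (*-distribʳ-+ (suc q) k k) ⟨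
  (k + k) * suc q + 400 * suc q           ≡⟨ *-distribʳ-+ (suc q) (k + k) 400 ⟨
  (k + k + 400) * suc q                   ≤⟨ *-mono-≤ (<⇒≤ (n<2^n (k + k + 400))) (n<2^n q) ⟩
  2 ^ (k + k + 400) * 2 ^ q               ≡⟨ ^-distribˡ-+-* 2 (k + k + 400) q ⟨
  2 ^ logBound k m                        ∎
  where
  open ≤-Reasoning
  q = m / k
  m≤ : m ≤ k * suc q
  m≤ = begin
    m                   ≡⟨ m≡m%n+[m/n]*n m k ⟩
    m % k + q * k       ≤⟨ +-monoˡ-≤ (q * k) (<⇒≤ (m%n<n m k)) ⟩
    k + q * k           ≡⟨ *-comm (suc q) k ⟩
    k * suc q           ∎

private
  -- The comparison of exponents is scaled by 1600 = 16 * 100. Then `Δ` has the coefficient 800 +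
  -- 1600 * `exponent` and the logarithm has 1600 * `exponent`. With `K` above both, each
  -- contributes at most m, and 1300 m + 2 m stays below 82 * 16 m = 1312 m.
  K : ℕ
  K = suc (1600 * exponent + 800)

  -- `logBound (K + K) m` is a constant plus m / (2 K). From `m₀` on, the constant is at most m / (2
  -- K) as well, so that `K` times the sum is at most m.
  m₀ : ℕ
  m₀ = (K + K) * (K + K + (K + K) + 400)

  log≤ : ∀ m → m₀ ≤ m → K * logBound (K + K) m ≤ m
  log≤ m p = *-cancelˡ-≤ 2 (begin
    2 * (K * logBound (K + K) m)                        ≡⟨ regroup K C (m / (K + K)) ⟩
    (K + K) * C + (m / (K + K)) * (K + K)               ≤⟨ +-mono-≤ p (m/n*n≤m m (K + K)) ⟩
    m + m                                               ≡⟨ cong (m +_) (+-identityʳ m) ⟨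
    2 * m                                               ∎)
    where
    open ≤-Reasoning
    C = K + K + (K + K) + 400
    regroup : ∀ K C q → 2 * (K * (C + q)) ≡ (K + K) * C + q * (K + K)
    regroup = solve-∀

  timeBound≤ : ∀ m Δ → m₀ ≤ m → K * Δ ≤ m → timeBound m Δ ^ 100 ≤ 2 ^ (82 * m)
  timeBound≤ m Δ m₀≤m KΔ≤m = begin
    timeBound m Δ ^ 100                           ≤⟨ ^-monoˡ-≤ 100 (*-monoʳ-≤ (2 ^ D) input≤) ⟩
    (2 ^ D * 2 ^ (z * exponent)) ^ 100            ≡⟨ cong (_^ 100) (^-distribˡ-+-* 2 D (z * exponent)) ⟨
    (2 ^ (D + z * exponent)) ^ 100                ≡⟨ ^-*-assoc 2 (D + z * exponent) 100 ⟩
    2 ^ ((D + z * exponent) * 100)                ≤⟨ ^-monoʳ-≤ 2 exponent≤ ⟩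
    2 ^ (82 * m)                                  ∎
    where
    open ≤-Reasoning
    D = (13 * m + 8 * Δ) / 16
    l = logBound (K + K) m
    z = l + Δ
    input≤ : inputBound m Δ ^ exponent ≤ 2 ^ (z * exponent)
    input≤ = begin
      inputBound m Δ ^ exponent    ≤⟨ ^-monoˡ-≤ exponent (*-monoˡ-≤ (2 ^ Δ) (linear≤2^logBound (K + K) m)) ⟩
      (2 ^ l * 2 ^ Δ) ^ exponent   ≡⟨ cong (_^ exponent) (^-distribˡ-+-* 2 l Δ) ⟨
      (2 ^ z) ^ exponent           ≡⟨ ^-*-assoc 2 z exponent ⟩
      2 ^ (z * exponent)           ∎
    exponent≤ : (D + z * exponent) * 100 ≤ 82 * m
    exponent≤ = *-cancelʳ-≤ _ _ 16 (begin
      (D + z * exponent) * 100 * 16                             ≡⟨ first D z exponent ⟩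
      (D * 16) * 100 + 1600 * exponent * z                      ≤⟨ +-monoˡ-≤ _ (*-monoˡ-≤ 100 (m/n*n≤m (13 * m + 8 * Δ) 16)) ⟩
      -- The added terms round both coefficients up to `K`.
      (13 * m + 8 * Δ) * 100 + 1600 * exponent * (l + Δ)        ≤⟨ m≤m+n _ (801 * l + Δ) ⟩
      (13 * m + 8 * Δ) * 100 + 1600 * exponent * (l + Δ) + (801 * l + Δ) ≡⟨ second m l Δ exponent ⟩
      1300 * m + (K * l + K * Δ)                                ≤⟨ +-monoʳ-≤ (1300 * m) (+-mono-≤ (log≤ m m₀≤m) KΔ≤m) ⟩
      1300 * m + (m + m)                                        ≤⟨ m≤m+n _ (10 * m) ⟩
      1300 * m + (m + m) + 10 * m                               ≡⟨ third m ⟩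
      82 * m * 16                                               ∎)
      where
      first : ∀ D z e → (D + z * e) * 100 * 16 ≡ (D * 16) * 100 + 1600 * e * z
      first = solve-∀
      second : ∀ m l Δ e → (13 * m + 8 * Δ) * 100 + 1600 * e * (l + Δ) + (801 * l + Δ) ≡
               1300 * m + (suc (1600 * e + 800) * l + suc (1600 * e + 800) * Δ)
      second = solve-∀
      third : ∀ m → 1300 * m + (m + m) + 10 * m ≡ 82 * m * 16
      third = solve-∀

timeBound-eventually : ∀ {d} → o[√m] d → ∃[ N ] ∀ m → N ≤ m → timeBound m (d m) ^ 100 ≤ 2 ^ (82 * m)
timeBound-eventually {d} small = m₀ ⊔ N , λ m p →
  -- Here K d ≤ (K d)² ≤ m, the second inequality being the instance of the hypothesis for the
  -- constant `K`.
  timeBound≤ m (d m) (≤-trans (m≤m⊔n m₀ N) p) (≤-trans (n≤n*n (K * d m)) (bound m (≤-trans (m≤n⊔m m₀ N) p)))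
  where
  N = proj₁ (small K)
  bound = proj₂ (small K)
  n≤n*n : ∀ n → n ≤ n * n
  n≤n*n zero      = z≤n
  n≤n*n n@(suc _) = m≤m*n n n

Produces-mono : ∀ {out input s t} → s ≤ t → Produces out from input within s → Produces out from input within t
Produces-mono s≤t (u , d , p) = u , d , ≤-trans p s≤t

-- Refutation and time bound for a single graph

module Bounds (G : Graph) (χ : Charge G) {Δ : ℕ} (deg≤Δ : Graph.maxDegree G ≤ Δ) where

  open Graph G using (m; maxDegree)
  open Tseitin G χ

  private
    Y = inputBound m Δ

  linear≤Y : ∀ {a} → a ≤ m + m + 400 → a ≤ Y
  linear≤Y p = ≤-trans p (m≤m*n (m + m + 400) (2 ^ Δ) {{>-nonZero (1≤2^ Δ)}})

  200≤Y : 200 ≤ Y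
  200≤Y = linear≤Y (≤-trans (m≤m+n 200 200) (m≤n+m 400 (m + m)))

  literalSize≤Y : literalSize m ≤ Y
  literalSize≤Y = linear≤Y (≤-trans (≤-reflexive (sym (+-suc (m + m) 4))) (+-monoʳ-≤ (m + m) (m≤m+n 5 395)))

  m+m≤Y : m + m ≤ Y
  m+m≤Y = linear≤Y (m≤m+n (m + m) 400)

  m≤Y : m ≤ Y
  m≤Y = ≤-trans (m≤m+n m m) m+m≤Y

  nonempties≤Y : nonempties F ≤ Y
  nonempties≤Y = ≤-trans nonempties≤ (*-mono-≤ (m≤m+n (m + m) 400) (^-monoʳ-≤ 2 deg≤Δ))

  mainPoly≤timeBound : ∀ {e} → 16 * e ≤ 13 * m + 8 * Δ → 2 ^ e * mainPoly (literalSize m) Y ≤ timeBound m Δ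
  mainPoly≤timeBound {e} p = *-mono-≤ (^-monoʳ-≤ 2 e≤) (mainPoly≤ {literalSize m} 200≤Y literalSize≤Y)
    where
    open ≤-Reasoning
    e≤ : e ≤ (13 * m + 8 * Δ) / 16
    e≤ = begin
      e                       ≡⟨ m*n/n≡m e 16 ⟨
      e * 16 / 16             ≤⟨ /-monoˡ-≤ 16 (≤-trans (≤-reflexive (*-comm e 16)) p) ⟩
      (13 * m + 8 * Δ) / 16   ∎

  Answer : Set
  Answer = Σ[ π ∈ ProofTree m ] Refutes F π × (Produces encodeTree π from (program , encodeCNF F) within timeBound m Δ)

  answer : OddCharge G χ → Answer
  answer odd = go (hasEmpty F) refl
    where
    open Correctness G χ odd
    open Cut (greedyCut F)
    S = length Es ⊔ length Et
    short≤Y : All (λ C → length C ≤ Y) F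
    short≤Y = All-map (λ p → ≤-trans p m≤Y) short
    ends≤Y : length (concat (items F)) ≤ Y
    ends≤Y = ≤-trans (≤-reflexive length-items-F) m+m≤Y
    height≤Y : length Ec + S ≤ Y
    height≤Y = begin
      length Ec + S                       ≤⟨ +-monoʳ-≤ (length Ec) (m⊔n≤m+n (length Es) (length Et)) ⟩
      length Ec + (length Es + length Et) ≡⟨ +-comm (length Ec) _ ⟩
      (length Es + length Et) + length Ec ≡⟨ edges ⟩
      m                                   ≤⟨ m≤Y ⟩
      Y                                   ∎
      where open ≤-Reasoning
    height≤ : 16 * (length Ec + S) ≤ 13 * m + 8 * Δ
    height≤ = ≤-trans height (+-monoʳ-≤ (13 * m) (*-monoʳ-≤ 8 deg≤Δ))
    go : ∀ b → hasEmpty F ≡ b → Answer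
    go true  eq = leaf [] , axiom (hasEmpty-true F eq) ,
      Produces-mono (≤-trans (≤-reflexive (sym (*-identityˡ _))) (mainPoly≤timeBound {0} z≤n))
        (empty-produces F eq nonempties≤Y)
    go false eq = let π , found , refutes = refutation in π , refutes ,
      Produces-mono (mainPoly≤timeBound {length Ec + S} height≤)
        (refute-produces short≤Y (≤-trans (≤-reflexive (hasEmpty-false F eq)) nonempties≤Y) ends≤Y
          (m≤m⊔n (length Es) (length Et)) (m≤n⊔m (length Es) (length Et)) height≤Y eq found)

module Slack (d : ℕ → ℕ) (N : ℕ) (eventually : ∀ m → N ≤ m → timeBound m (d m) ^ 100 ≤ 2 ^ (82 * m)) where

  -- The term o(m) only has to absorb the finitely many m below N.
  slack : ℕ → ℕ
  slack m = if does (N ≤? m) then 0 else timeBound m (d m)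

  slack-large : ∀ {m} → N ≤ m → slack m ≡ 0
  slack-large {m} p = cong (if_then 0 else timeBound m (d m)) (dec-true (N ≤? m) p)

  slack-small : ∀ {m} → ¬ (N ≤ m) → slack m ≡ timeBound m (d m)
  slack-small {m} ¬p = cong (if_then 0 else timeBound m (d m)) (dec-false (N ≤? m) ¬p)

  slack-o : o[m] slack
  slack-o c = N , λ m p → ≤-trans (≤-reflexive (trans (cong (c *_) (slack-large p)) (*-zeroʳ c))) z≤n

  -- Below `N` the slack is the time t itself, and t < 2^t. From `N` on, it suffices that 82/100 ≤
  -- a/b, which is used after raising to the power 100 and clearing denominators.
  timeBound-α : ∀ m → timeBound m (d m) ≤ (m ^ 0) ·2^[α m + slack m ]
  timeBound-α m a b α<a/b = ≤-trans (bound (N ≤? m))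
      (≤-reflexive (trans (sym (+-identityʳ _)) (cong (_* 2 ^ (a * m + b * slack m)) (sym (^-zeroˡ b)))))
    where
    open ≤-Reasoning
    t = timeBound m (d m)
    bound : Dec (N ≤ m) → t ^ b ≤ 2 ^ (a * m + b * slack m)
    bound (no ¬p) = begin
      t ^ b                         ≤⟨ ^-monoˡ-≤ b (<⇒≤ (n<2^n t)) ⟩
      (2 ^ t) ^ b                   ≡⟨ ^-*-assoc 2 t b ⟩
      2 ^ (t * b)                   ≡⟨ cong (2 ^_) (trans (*-comm t b) (cong (b *_) (sym (slack-small ¬p)))) ⟩
      2 ^ (b * slack m)             ≤⟨ ^-monoʳ-≤ 2 (m≤n+m (b * slack m) (a * m)) ⟩
      2 ^ (a * m + b * slack m)     ∎
    bound (yes p) = ≤-trans (^-cancelˡ-≤ 100 (begin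
      (t ^ b) ^ 100                 ≡⟨ trans (^-*-assoc t b 100) (trans (cong (t ^_) (*-comm b 100)) (sym (^-*-assoc t 100 b))) ⟩
      (t ^ 100) ^ b                 ≤⟨ ^-monoˡ-≤ b (eventually m p) ⟩
      (2 ^ (82 * m)) ^ b            ≡⟨ ^-*-assoc 2 (82 * m) b ⟩
      2 ^ (82 * m * b)              ≤⟨ ^-monoʳ-≤ 2 exponent≤ ⟩
      2 ^ (a * m * 100)             ≡⟨ ^-*-assoc 2 (a * m) 100 ⟨
      (2 ^ (a * m)) ^ 100           ∎)) (^-monoʳ-≤ 2 (m≤m+n (a * m) (b * slack m)))
      where
      exponent≤ : 82 * m * b ≤ a * m * 100
      exponent≤ = begin
        82 * m * b     ≡⟨ swap 82 m b ⟩
        82 * b * m     ≤⟨ *-monoˡ-≤ m (fraction-≤ {82} {100} {a} {b} (α<⇒82% α<a/b)) ⟩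
        a * 100 * m    ≡⟨ swap a 100 m ⟩
        a * m * 100    ∎
        where
        swap : ∀ x y z → x * y * z ≡ x * z * y
        swap = solve-∀

  -- The slack vanishes from `N` on, so what remains is a/b ≤ 83/100.
  α-83% : ∀ m → N ≤ m → (m ^ 0) ·2^[α m + slack m ]≤2^[ 83 / 100 · m ]
  α-83% m p a b a/b<α = begin
    (1 ^ b * 2 ^ (a * m + b * slack m)) ^ 100  ≡⟨ cong (λ z → (z * 2 ^ (a * m + b * slack m)) ^ 100) (^-zeroˡ b) ⟩
    (1 * 2 ^ (a * m + b * slack m)) ^ 100      ≡⟨ cong (_^ 100) (*-identityˡ (2 ^ (a * m + b * slack m))) ⟩
    (2 ^ (a * m + b * slack m)) ^ 100          ≡⟨ ^-*-assoc 2 (a * m + b * slack m) 100 ⟩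
    2 ^ ((a * m + b * slack m) * 100)          ≤⟨ ^-monoʳ-≤ 2 exponent≤ ⟩
    2 ^ (83 * m * b)                           ∎
    where
    open ≤-Reasoning
    exponent≤ : (a * m + b * slack m) * 100 ≤ 83 * m * b
    exponent≤ = begin
      (a * m + b * slack m) * 100   ≡⟨ cong (λ z → (a * m + z) * 100) (trans (cong (b *_) (slack-large p)) (*-zeroʳ b)) ⟩
      (a * m + 0) * 100             ≡⟨ collect a m ⟩
      a * 100 * m                   ≤⟨ *-monoˡ-≤ m (fraction-≤ {a} {b} {83} {100} (<α⇒83% a/b<α)) ⟩
      83 * b * m                    ≡⟨ swap 83 b m ⟩
      83 * m * b                    ∎
      where
      collect : ∀ a m → (a * m + 0) * 100 ≡ a * 100 * m
      collect = solve-∀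
      swap : ∀ x y z → x * y * z ≡ x * z * y
      swap = solve-∀

theorem5p5 : Σ[ P ∈ Program ] Σ[ k ∈ ℕ ]
    ((d : ℕ → ℕ) → o[√m] d →
    Σ[ r ∈ (ℕ → ℕ) ] o[m] r ×
    ((G : Graph) (χ : Charge G) → let open Graph G in
    maxDegree ≤ d m → OddCharge G χ →
    Σ[ π ∈ ProofTree m ] Σ[ t ∈ ℕ ]
    Refutes (tseitin G χ) π ×
    (Produces encodeTree π from (P , encodeCNF (tseitin G χ)) within t) ×
    (1 ≤ m → t ≤ (m ^ k) ·2^[α m + r m ])) ×
    (∃[ m₀ ] ∀ m → m₀ ≤ m → (m ^ k) ·2^[α m + r m ]≤2^[ 83 / 100 · m ]))
-- The degree 0 is possible because `timeBound`, with all its polynomial factors, already lies below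
-- 2^(82 m / 100) for large m.
theorem5p5 = program , 0 , λ d small →
  let N , eventually = timeBound-eventually small in
  Slack.slack d N eventually , Slack.slack-o d N eventually ,
  (λ G χ deg≤ odd → let π , refutes , produced = Bounds.answer G χ deg≤ odd in
    π , timeBound (Graph.m G) (d (Graph.m G)) , refutes , produced ,
    λ _ → Slack.timeBound-α d N eventually (Graph.m G)) ,
  N , Slack.α-83% d N eventually
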